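{- Let $k$ and $n$ be positive integers such that $8\leqslant 2k\leqslant n<(k+1)^3$, and let $a_0,a_1,\ldots,a_k$ be non-zero integers each of which has all of its prime factors $\leqslant k$. Define $$c_j=(-1)^{k-j}\binom{n}{j}\binom{n-j-1}{k-j}\quad (0\leqslant j\leqslant k),\qquad F_{n,k}(x)=\sum_{j=0}^{k}a_jc_jx^j.$$ Then $F_{n,k}(x)$ is irreducible over $\mathbb{Q}$, except possibly when $(n,k)\in\{(8,4),(10,5),(12,6),(16,8)\}$.
   Context: The $c_j$ are the coefficients of $P_{n,k}(x-1)=\sum_{j=0}^k c_jx^j$, where $P_{n,k}(x)=\sum_{j=0}^k\binom{n}{j}x^j$. Equivalently, $c_j=\frac{(-1)^{k-j}\,n(n-1)\cdots(n-k)}{j!\,(k-j)!\,(n-j)}$. -}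

module Defs where

open import Data.Nat as ℕ using (ℕ; zero; suc; _∸_; _≤_)
open import Data.Nat.Combinatorics using (_C_)
open import Data.Nat.Primality using (Prime)
open import Data.Nat.Divisibility using (_∣_)
open import Data.Integer as ℤ using (ℤ; +_; -[1+_]; ∣_∣)
open import Data.Rational as ℚ using (ℚ; 0ℚ; _/_)
open import Data.Fin using (Fin; toℕ)
open import Data.List as List using (List; []; _∷_)
open import Data.Product using (Σ; ∃; _×_)
open import Relation.Nullary using (¬_)
open import Relation.Binary.PropositionalEquality using (_≡_; _≢_)

-- Polynomials over ℚ as coefficient lists, lowest degree first.
Poly : Set
Poly = List ℚ

coeff : Poly → ℕ → ℚ
coeff []       _       = 0ℚ
coeff (a ∷ p)  zero    = a
coeff (a ∷ p)  (suc i) = coeff p i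

_⊕_ : Poly → Poly → Poly
[]      ⊕ q       = q
p       ⊕ []      = p
(a ∷ p) ⊕ (b ∷ q) = (a ℚ.+ b) ∷ (p ⊕ q)

_⊗_ : Poly → Poly → Poly
[]      ⊗ q = []
(a ∷ p) ⊗ q = List.map (a ℚ.*_) q ⊕ (0ℚ ∷ (p ⊗ q))

NonConstant : Poly → Set
NonConstant p = Σ ℕ λ i → (1 ≤ i) × (coeff p i ≢ 0ℚ)

ReducibleQ : Poly → Set
ReducibleQ f = Σ Poly λ g → Σ Poly λ h →
  NonConstant g × NonConstant h × (∀ i → coeff f i ≡ coeff (g ⊗ h) i)

IrreducibleQ : Poly → Set
IrreducibleQ f = NonConstant f × ¬ ReducibleQ f

toℚ : ℤ → ℚ
toℚ z = z / 1

Smooth : ℕ → ℤ → Set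
Smooth k a = ∀ p → Prime p → p ∣ ∣ a ∣ → p ≤ k

c : ℕ → ℕ → ℕ → ℤ
c n k j = (-[1+ 0 ] ℤ.^ (k ∸ j)) ℤ.* (+ ((n C j) ℕ.* ((n ∸ j ∸ 1) C (k ∸ j))))

F : (n k : ℕ) → (Fin (suc k) → ℤ) → Poly
F n k a = List.tabulate λ j → toℚ (a j ℤ.* c n k (toℕ j))

{-# OPTIONS --safe #-}
-- Let p > k be prime, p^e ∥ n − l with 0 ≤ l ≤ k; since n < (k+1)³, e ≤ 2.  From
--   j! (k−j)! (n−j) |c_j| = n (n−1) ⋯ (n−k)
-- the coefficients a_j c_j with j ≠ l have valuation e while that at l is a unit, so the Newton polygon of F at p has
-- the vertices (0, e), (l, 0), (k, e).  The degree d of a factor is thus a sum of horizontal lengths of pieces of the two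
-- edges: for e = 1 this forces d ∈ {l, k−l}, and for e = 2 at most two odd l are compatible with a given d.  Hence F is
-- irreducible as soon as three of n, …, n−k (if n < (k+1)²), or three of the n − l with l odd (if n ≥ (k+1)²), have a prime
-- factor above k.  If there are fewer, Erdős's argument bounds the product of the remaining terms: after dropping, for each
-- prime p ≤ k, one term of maximal p-adic valuation, the product divides s! (or 2^s s!), which is too small unless k is
-- small or n is close to 2k.  For k < 16384 explicit primes and direct computation fill the gap; for larger k and
-- n < k^(3/2) one keeps track of the primes above √n and uses ∏_{p ≤ m} p ≤ 4^m.
module Submission where

open import Defs
open import Data.Nat hiding (∣_-_∣)
open import Data.Nat.Properties
open import Data.Nat.Divisibility
open import Data.Nat.DivMod using (m%n<n; m≡m%n+[m/n]*n; [m+kn]%n≡m%n; m/n*n≤m; m/n*n≡m)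
open import Data.Nat.Primality
open import Data.Nat.Primality.Factorisation using (factorise; module PrimeFactorisation)
open import Data.Nat.ListAction using (product)
open import Data.Nat.Combinatorics using (nCk≡n!/k![n-k]!; k![n∸k]!∣n!) renaming (_C_ to _choose_)
open import Data.Nat.Induction using (<-wellFounded; Acc; acc)
open import Data.Nat.Tactic.RingSolver using (solve-∀)
open import Data.Bool.Base using (Bool; true; false; if_then_else_; not; T; _∧_; _∨_)
open import Data.List.Base using (List; []; _∷_; length; map; tabulate)
open import Data.List.Relation.Unary.All as All using (All; []; _∷_)
open import Data.List.Relation.Unary.Any using (here; there)
open import Data.List.Properties using (length-map)
open import Data.List.Membership.Propositional using (_∈_)
open import Data.List.Membership.Propositional.Properties using (∈-map⁺)
open import Data.Integer using (ℤ; 0ℤ)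
import Data.Integer as ℤ
import Data.Integer.Properties as ℤ
open import Data.Rational using (ℚ; 0ℚ)
import Data.Rational as ℚ
import Data.Rational.Properties as ℚ
import Data.Rational.Unnormalised as ℚᵘ
import Data.Rational.Unnormalised.Properties as ℚᵘ
open import Data.Fin using (Fin; toℕ; fromℕ<)
import Data.Fin as Fin
open import Data.Fin.Properties using (toℕ-fromℕ<)
import Algebra.Properties.CommutativeSemigroup as CommutativeSemigroup
open import Algebra.Bundles using (CommutativeMonoid)
open import Data.Product using (Σ; ∃; ∃₂; _×_; _,_; proj₁; proj₂)
open import Data.Sum using (_⊎_; inj₁; inj₂; [_,_]′; map₁)
open import Data.Empty using (⊥; ⊥-elim)
open import Data.Unit using (tt)
open import Function using (_∘_; id)
open import Relation.Nullary using (¬_; Dec; yes; no; does)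
open import Relation.Nullary.Decidable using (toWitness; _×-dec_)
open import Relation.Binary.PropositionalEquality
open import Relation.Binary.Definitions using (tri<; tri≈; tri>)
import Data.Integer.Divisibility.Signed as ℤ∣
open ℤ∣ using () renaming (_∣_ to _∣ᶻ_; _∣?_ to _∣ᶻ?_)

-- A simple prime at l admits only d = l and d = k - l, so three such l exclude every d. A double
-- prime also allows an edge to be halved; several of the positions that this adds, such as l = 2d
-- and l = 2k - 2d, are even, and this is why only odd l are counted once n ≥ (k+1)². The price is a
-- progression of difference 2 with about k/2 terms, where the argument needs π(k) below about k/4.
-- Counting residues prime to 210, of density 48/210 < 1/4, supplies this for large k without
-- results on the distribution of primes. For large k and n < k^(3/2), dropping one term for each
-- prime up to k costs a factor n^π(k), which is too much; so terms are dropped only for primes up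
-- to at most 2√n, and a power of 4 pays for the others. On the algebraic side no ring of
-- polynomials is set up. A factorisation is a statement about which moduli divide which
-- coefficients, stable under exchange of the factors and under reversal, so arguments at the
-- constant coefficient serve both edges and both factors. Denominators are cleared globally and the
-- scaling is then made prime to one p at a time.

-- Powers, divisibility and p-adic valuations

prime>0 : ∀ {p} → Prime p → 0 < p
prime>0 pp = >-nonZero⁻¹ _ {{prime⇒nonZero pp}}

prime>1 : ∀ {p} → Prime p → 1 < p
prime>1 pp = nonTrivial⇒n>1 _ {{prime⇒nonTrivial pp}}

n<p^n : ∀ {p} → 1 < p → ∀ n → n < p ^ n
n<p^n 1<p zero = s≤s z≤n
n<p^n {p} 1<p (suc n) = begin-strict
  suc n       ≤⟨ n<p^n 1<p n ⟩
  p ^ n       <⟨ m<m*n (p ^ n) p {{>-nonZero (≤-<-trans z≤n (n<p^n 1<p n))}} 1<p ⟩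
  p ^ n * p   ≡⟨ *-comm (p ^ n) p ⟩
  p * p ^ n   ∎
  where open ≤-Reasoning

*-pos : ∀ {m n} → 0 < m → 0 < n → 0 < m * n
*-pos {suc m} {suc n} _ _ = s≤s z≤n

*-pos⁻ˡ : ∀ {m n} → 0 < m * n → 0 < m
*-pos⁻ˡ {suc m} _ = s≤s z≤n

*-pos⁻ʳ : ∀ {m n} → 0 < m * n → 0 < n
*-pos⁻ʳ {m} {n} h = *-pos⁻ˡ {n} {m} (subst (0 <_) (*-comm m n) h)

^-pos : ∀ {m} → 0 < m → ∀ n → 0 < m ^ n
^-pos 0<m zero = s≤s z≤n
^-pos 0<m (suc n) = *-pos 0<m (^-pos 0<m n)

∣⇒≤′ : ∀ {m n} → 0 < n → m ∣ n → m ≤ n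
∣⇒≤′ 0<n = ∣⇒≤ {{>-nonZero 0<n}}

^-∣-mono : ∀ p {a b} → a ≤ b → p ^ a ∣ p ^ b
^-∣-mono p {a} {b} a≤b = subst (p ^ a ∣_)
  (trans (sym (^-distribˡ-+-* p a (b ∸ a))) (cong (p ^_) (m+[n∸m]≡n a≤b))) (m∣m*n (p ^ (b ∸ a)))

-- p-adic valuation.  Junk values: ν p 0 = 0, and ν p n is only meaningful for p ≥ 2.

largestPower : ℕ → ℕ → ℕ → ℕ
largestPower p n zero = 0
largestPower p n (suc e) with p ^ suc e ∣? n
... | yes _ = suc e
... | no _ = largestPower p n e

ν : ℕ → ℕ → ℕ
ν p n = largestPower p n n

p^ν∣n : ∀ p n → p ^ ν p n ∣ n
p^ν∣n p n = go n
  where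
  go : ∀ e → p ^ largestPower p n e ∣ n
  go zero = 1∣ n
  go (suc e) with p ^ suc e ∣? n
  ... | yes d = d
  ... | no _ = go e

ν-max : ∀ {p n e} → Prime p → 0 < n → p ^ e ∣ n → e ≤ ν p n
ν-max {p} {n} {e} pp 0<n d = go n (<⇒≤ (<-≤-trans (n<p^n (prime>1 pp) e) (∣⇒≤′ 0<n d)))
  where
  go : ∀ b → e ≤ b → e ≤ largestPower p n b
  go zero e≤b = e≤b
  go (suc b) e≤b with p ^ suc b ∣? n
  ... | yes _ = e≤b
  ... | no ∤ with m≤n⇒m<n∨m≡n e≤b
  ...   | inj₁ e<b = go b (≤-pred e<b)
  ...   | inj₂ refl = ⊥-elim (∤ d)

ν-split : ∀ {p n} → Prime p → 0 < n → ∃ λ m → n ≡ m * p ^ ν p n × ¬ p ∣ m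
ν-split {p} {n} pp 0<n with p^ν∣n p n
... | divides m eq = m , eq , λ p∣m → <-irrefl refl
      (ν-max {e = suc (ν p n)} pp 0<n (subst (p ^ suc (ν p n) ∣_) (sym eq) (*-monoˡ-∣ (p ^ ν p n) p∣m)))

ν-* : ∀ {p a b} → Prime p → 0 < a → 0 < b → ν p (a * b) ≡ ν p a + ν p b
ν-* {p} {a} {b} pp 0<a 0<b = ≤-antisym (≮⇒≥ upper) lower
  where
  lower : ν p a + ν p b ≤ ν p (a * b)
  lower = ν-max pp (*-pos 0<a 0<b)
    (subst (_∣ a * b) (sym (^-distribˡ-+-* p (ν p a) (ν p b))) (*-pres-∣ (p^ν∣n p a) (p^ν∣n p b)))
  upper : ¬ (ν p a + ν p b < ν p (a * b))
  upper lt with ν-split pp 0<a | ν-split pp 0<b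
  ... | a' , eqa , p∤a' | b' , eqb , p∤b' =
    [ p∤a' , p∤b' ]′ (euclidsLemma a' b' pp p∣a'b')
    where
    A = p ^ ν p a
    B = p ^ ν p b
    q = ν p a + ν p b
    rearrange : ∀ x A y B → (x * A) * (y * B) ≡ (x * y) * (A * B)
    rearrange = solve-∀
    eq : a * b ≡ (a' * b') * p ^ q
    eq = trans (cong₂ _*_ eqa eqb) (trans (rearrange a' A b' B)
           (cong (a' * b' *_) (sym (^-distribˡ-+-* p (ν p a) (ν p b)))))
    p∣a'b' : p ∣ a' * b'
    p∣a'b' = *-cancelʳ-∣ (p ^ q) {{>-nonZero (^-pos (prime>0 pp) q)}}
      (subst (p ^ suc q ∣_) eq (∣-trans (^-∣-mono p lt) (p^ν∣n p (a * b))))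

ν-mono-∣ : ∀ {p a b} → Prime p → 0 < b → a ∣ b → ν p a ≤ ν p b
ν-mono-∣ {p} {a} pp 0<b a∣b = ν-max pp 0<b (∣-trans (p^ν∣n p a) a∣b)

ν-∤ : ∀ {p n} → ¬ p ∣ n → ν p n ≡ 0
ν-∤ {p} {n} p∤n with ν p n | p^ν∣n p n
... | zero | _ = refl
... | suc e | d = ⊥-elim (p∤n (∣-trans (m∣m*n (p ^ e)) d))

ν-∣ : ∀ {p n} → Prime p → 0 < n → p ∣ n → 1 ≤ ν p n
ν-∣ {p} pp 0<n p∣n = ν-max pp 0<n (subst (_∣ _) (sym (*-identityʳ p)) p∣n)

ν>0⇒∣ : ∀ {p n} → 1 ≤ ν p n → p ∣ n
ν>0⇒∣ {p} {n} h with p ∣? n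
... | yes d = d
... | no ∤ = ⊥-elim (<-irrefl refl (subst (1 ≤_) (ν-∤ ∤) h))

-- Induction along the prime factorisation of `a`: its first prime `q` divides `b` by the hypothesis
-- at `q`, and cancelling `q` on both sides preserves the comparison at every prime.
ν-≤⇒∣ : ∀ {a b} → 0 < a → 0 < b → (∀ {p} → Prime p → ν p a ≤ ν p b) → a ∣ b
ν-≤⇒∣ {a} {b} 0<a 0<b dom = subst (_∣ b) (sym isFactorisation)
    (go factors factorsPrime b 0<b (λ {p} pp → subst (λ z → ν p z ≤ ν p b) isFactorisation (dom pp)))
  where
  open PrimeFactorisation (factorise a {{>-nonZero 0<a}})
  go : ∀ qs → All Prime qs → ∀ b → 0 < b → (∀ {p} → Prime p → ν p (product qs) ≤ ν p b) → product qs ∣ b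
  go [] _ b _ _ = 1∣ b
  go (q ∷ qs) (pq ∷ pqs) b 0<b h with ν>0⇒∣ {q} {b} (≤-trans (ν-∣ pq 0<Q (m∣m*n (product qs))) (h pq))
    where 0<Q = *-pos (prime>0 pq) (productOfPrimes≥1 pqs)
  ... | divides b' refl = subst (_∣ b' * q) (*-comm (product qs) q) (*-monoˡ-∣ q (go qs pqs b' (*-pos⁻ˡ 0<b) h'))
    where
    h' : ∀ {p} → Prime p → ν p (product qs) ≤ ν p b'
    h' {p} pp = +-cancelˡ-≤ (ν p q) _ _ (begin
      ν p q + ν p (product qs)  ≡⟨ ν-* pp (prime>0 pq) (productOfPrimes≥1 pqs) ⟨
      ν p (q * product qs)      ≤⟨ h pp ⟩
      ν p (b' * q)              ≡⟨ ν-* {p} {b'} {q} pp (*-pos⁻ˡ 0<b) (prime>0 pq) ⟩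
      ν p b' + ν p q            ≡⟨ +-comm (ν p b') _ ⟩
      ν p q + ν p b'            ∎)
      where open ≤-Reasoning

-- Finite products, factorials and arithmetic progressions

∏ : ℕ → (ℕ → ℕ) → ℕ
∏ zero x = 1
∏ (suc s) x = ∏ s x * x s

∏-pos : ∀ s {x} → (∀ i → i < s → 0 < x i) → 0 < ∏ s x
∏-pos zero _ = s≤s z≤n
∏-pos (suc s) h = *-pos (∏-pos s (λ i i<s → h i (m<n⇒m<1+n i<s))) (h s ≤-refl)

∏-cong : ∀ s {x y} → (∀ i → i < s → x i ≡ y i) → ∏ s x ≡ ∏ s y
∏-cong zero _ = refl
∏-cong (suc s) h = cong₂ _*_ (∏-cong s (λ i i<s → h i (m<n⇒m<1+n i<s))) (h s ≤-refl)

∏-mono-≤ : ∀ s {x y} → (∀ i → i < s → x i ≤ y i) → ∏ s x ≤ ∏ s y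
∏-mono-≤ zero _ = ≤-refl
∏-mono-≤ (suc s) h = *-mono-≤ (∏-mono-≤ s (λ i i<s → h i (m<n⇒m<1+n i<s))) (h s ≤-refl)

∏-mono-∣ : ∀ s {x y} → (∀ i → i < s → x i ∣ y i) → ∏ s x ∣ ∏ s y
∏-mono-∣ zero _ = ∣-refl
∏-mono-∣ (suc s) h = *-pres-∣ (∏-mono-∣ s (λ i i<s → h i (m<n⇒m<1+n i<s))) (h s ≤-refl)

∏-scale : ∀ s a {x} → ∏ s (λ i → a * x i) ≡ a ^ s * ∏ s x
∏-scale zero a = refl
∏-scale (suc s) a {x} = trans (cong (_* (a * x s)) (∏-scale s a)) (shuffle (a ^ s) (∏ s x) a (x s))
  where
  shuffle : ∀ A P a y → (A * P) * (a * y) ≡ (a * A) * (P * y)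
  shuffle = solve-∀

∏-const : ∀ s a → ∏ s (λ _ → a) ≡ a ^ s
∏-const zero a = refl
∏-const (suc s) a = trans (cong (_* a) (∏-const s a)) (*-comm (a ^ s) a)

∏-+ : ∀ a b x → ∏ (a + b) x ≡ ∏ a x * ∏ b (λ i → x (a + i))
∏-+ a zero x = trans (cong (λ s → ∏ s x) (+-identityʳ a)) (sym (*-identityʳ _))
∏-+ a (suc b) x = trans (cong (λ s → ∏ s x) (+-suc a b))
  (trans (cong (_* x (a + b)) (∏-+ a b x)) (*-assoc (∏ a x) _ _))

∏-front : ∀ s x → ∏ (suc s) x ≡ x 0 * ∏ s (λ i → x (suc i))
∏-front s x = trans (∏-+ 1 s x) (cong (_* ∏ s (λ i → x (suc i))) (*-identityˡ (x 0)))

!-∏ : ∀ n → n ! ≡ ∏ n suc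
!-∏ zero = refl
!-∏ (suc n) = trans (cong (suc n *_) (!-∏ n)) (*-comm (suc n) _)

!-∏-tail : ∀ u k → u ! * ∏ k (λ i → suc (u + i)) ≡ (u + k) !
!-∏-tail u k = trans (cong (_* ∏ k (λ i → suc (u + i))) (!-∏ u)) (trans (sym (∏-+ u k suc)) (sym (!-∏ (u + k))))

!-pos : ∀ n → 0 < n !
!-pos n = >-nonZero⁻¹ _ {{n !≢0}}

!*!∣! : ∀ a b → a ! * b ! ∣ (a + b) !
!*!∣! a b = subst (λ z → a ! * z ! ∣ (a + b) !) (m+n∸m≡n a b) (k![n∸k]!∣n! (m≤m+n a b))

prime∣∏ : ∀ {p} → Prime p → ∀ s {x} → p ∣ ∏ s x → ∃ λ i → i < s × p ∣ x i
prime∣∏ pp zero d = ⊥-elim (¬prime[1] (subst Prime (∣1⇒≡1 d) pp))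
prime∣∏ pp (suc s) {x} d with euclidsLemma (∏ s x) (x s) pp d
... | inj₂ e = s , ≤-refl , e
... | inj₁ e with prime∣∏ pp s e
...   | i , i<s , f = i , m<n⇒m<1+n i<s , f

prime∤! : ∀ {p n} → Prime p → n < p → ¬ p ∣ n !
prime∤! {p} {n} pp n<p d with prime∣∏ pp n (subst (p ∣_) (!-∏ n) d)
... | i , i<n , e = <⇒≱ (≤-<-trans i<n n<p) (∣⇒≤ e)

ν-∏-mono : ∀ {p} → Prime p → ∀ s {x y} → (∀ i → i < s → 0 < x i) → (∀ i → i < s → 0 < y i) →
  (∀ i → i < s → ν p (x i) ≤ ν p (y i)) → ν p (∏ s x) ≤ ν p (∏ s y)
ν-∏-mono pp zero _ _ _ = ≤-refl
ν-∏-mono {p} pp (suc s) {x} {y} 0<x 0<y h = begin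
  ν p (∏ s x * x s)        ≡⟨ ν-* pp (∏-pos s (λ i → 0<x i ∘ m<n⇒m<1+n)) (0<x s ≤-refl) ⟩
  ν p (∏ s x) + ν p (x s)  ≤⟨ +-mono-≤ (ν-∏-mono pp s (λ i → 0<x i ∘ m<n⇒m<1+n) (λ i → 0<y i ∘ m<n⇒m<1+n)
                                         (λ i → h i ∘ m<n⇒m<1+n)) (h s ≤-refl) ⟩
  ν p (∏ s y) + ν p (y s)  ≡⟨ ν-* pp (∏-pos s (λ i → 0<y i ∘ m<n⇒m<1+n)) (0<y s ≤-refl) ⟨
  ν p (∏ s y * y s)        ∎
  where open ≤-Reasoning

∏-reverse : ∀ s (x : ℕ → ℕ) → ∏ s (λ i → x (s ∸ i)) ≡ ∏ s (x ∘ suc)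
∏-reverse zero x = refl
∏-reverse (suc s) x = begin
  ∏ (suc s) (λ i → x (suc s ∸ i))        ≡⟨ ∏-front s (λ i → x (suc s ∸ i)) ⟩
  x (suc s) * ∏ s (λ i → x (s ∸ i))      ≡⟨ cong (x (suc s) *_) (∏-reverse s x) ⟩
  x (suc s) * ∏ s (x ∘ suc)              ≡⟨ *-comm (x (suc s)) _ ⟩
  ∏ s (x ∘ suc) * x (suc s)              ∎
  where open ≡-Reasoning

∏-multiples : ∀ D t → ∏ t (λ i → D * suc i) ≡ D ^ t * t !
∏-multiples D t = trans (∏-scale t D) (cong (D ^ t *_) (sym (!-∏ t)))

-- Erdős: a prime power dividing two terms of the progression divides D times the difference of their indices,
-- so all terms but one of maximal valuation contribute no more than D^s s!.
ν-progression : ∀ {p} → Prime p → ∀ b D s i₀ {y} → 0 < b → 0 < D → i₀ ≤ s →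
  (∀ i → i ≤ s → ν p (b + D * i) ≤ ν p (b + D * i₀)) →
  (∀ i → i ≤ s → 0 < y i) → (∀ i → i ≤ s → ν p (y i) ≤ ν p (b + D * i)) →
  ν p (∏ (suc s) y) ≤ ν p (y i₀) + ν p (D ^ s * s !)
ν-progression {p} pp b D s i₀ {y} 0<b 0<D i₀≤s maximal 0<y y≤x = begin
  ν p (∏ (suc s) y)                                  ≡⟨ cong (ν p) split ⟩
  ν p (y i₀ * (Lo * Hi))                             ≡⟨ ν-* pp (0<y i₀ i₀≤s) (*-pos 0<Lo 0<Hi) ⟩
  ν p (y i₀) + ν p (Lo * Hi)                         ≡⟨ cong (ν p (y i₀) +_) (ν-* pp 0<Lo 0<Hi) ⟩
  ν p (y i₀) + (ν p Lo + ν p Hi)                     ≤⟨ +-monoʳ-≤ (ν p (y i₀)) (+-mono-≤ lo hi) ⟩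
  ν p (y i₀) + (ν p (D ^ i₀ * i₀ !) + ν p (D ^ t * t !))
    ≡⟨ cong (ν p (y i₀) +_) (ν-* pp (*-pos (^-pos 0<D i₀) (!-pos i₀)) (*-pos (^-pos 0<D t) (!-pos t))) ⟨
  ν p (y i₀) + ν p (D ^ i₀ * i₀ ! * (D ^ t * t !))
    ≤⟨ +-monoʳ-≤ (ν p (y i₀)) (ν-mono-∣ pp (*-pos (^-pos 0<D s) (!-pos s)) divides-total) ⟩
  ν p (y i₀) + ν p (D ^ s * s !)                     ∎
  where
  open ≤-Reasoning
  t = s ∸ i₀
  i₀+t≡s : i₀ + t ≡ s
  i₀+t≡s = m+[n∸m]≡n i₀≤s
  x : ℕ → ℕ
  x i = b + D * i
  0<x : ∀ i → 0 < x i
  0<x i = ≤-trans 0<b (m≤m+n b (D * i))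
  Lo = ∏ i₀ y
  Hi = ∏ t (λ i → y (i₀ + suc i))
  lo≤ : ∀ {i} → i < i₀ → i ≤ s
  lo≤ i<i₀ = <⇒≤ (<-≤-trans i<i₀ i₀≤s)
  hi≤ : ∀ {i} → i < t → i₀ + suc i ≤ s
  hi≤ i<t = subst (_ ≤_) i₀+t≡s (+-monoʳ-≤ i₀ i<t)
  0<Lo = ∏-pos i₀ (λ i i<i₀ → 0<y i (lo≤ i<i₀))
  0<Hi = ∏-pos t (λ i i<t → 0<y _ (hi≤ i<t))
  swap : ∀ l m h → l * (m * h) ≡ m * (l * h)
  swap = solve-∀
  split : ∏ (suc s) y ≡ y i₀ * (Lo * Hi)
  split = trans (cong (λ z → ∏ z y) (trans (cong suc (sym i₀+t≡s)) (sym (+-suc i₀ t))))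
    (trans (∏-+ i₀ (suc t) y) (trans (cong (Lo *_) (trans (∏-front t (λ i → y (i₀ + i)))
      (cong (λ z → y z * Hi) (+-identityʳ i₀)))) (swap Lo (y i₀) Hi)))
  offset : ∀ i j → x (i + j) ≡ x i + D * j
  offset i j = trans (cong (b +_) (*-distribˡ-+ D i j)) (sym (+-assoc b (D * i) (D * j)))
  hi-term : ∀ i → i < t → ν p (y (i₀ + suc i)) ≤ ν p (D * suc i)
  hi-term i i<t = ≤-trans (y≤x _ (hi≤ i<t)) (ν-max pp (*-pos 0<D (s≤s z≤n))
    (∣m+n∣m⇒∣n (subst (q ∣_) (offset i₀ (suc i)) (p^ν∣n p _))
      (∣-trans (^-∣-mono p (maximal _ (hi≤ i<t))) (p^ν∣n p _))))
    where q = p ^ ν p (x (i₀ + suc i))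
  lo-term : ∀ i → i < i₀ → ν p (y i) ≤ ν p (D * (i₀ ∸ i))
  lo-term i i<i₀ = ≤-trans (y≤x _ (lo≤ i<i₀)) (ν-max pp (*-pos 0<D (m<n⇒0<n∸m i<i₀))
    (∣m+n∣m⇒∣n (subst (q ∣_) (trans (cong x (sym (m+[n∸m]≡n (<⇒≤ i<i₀)))) (offset i (i₀ ∸ i)))
      (∣-trans (^-∣-mono p (maximal _ (lo≤ i<i₀))) (p^ν∣n p _))) (p^ν∣n p _)))
    where q = p ^ ν p (x i)
  hi : ν p Hi ≤ ν p (D ^ t * t !)
  hi = subst (λ z → ν p Hi ≤ ν p z) (∏-multiples D t)
    (ν-∏-mono pp t (λ i i<t → 0<y _ (hi≤ i<t)) (λ i _ → *-pos 0<D (s≤s z≤n)) hi-term)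
  lo : ν p Lo ≤ ν p (D ^ i₀ * i₀ !)
  lo = subst (λ z → ν p Lo ≤ ν p z) (trans (∏-reverse i₀ (D *_)) (∏-multiples D i₀))
    (ν-∏-mono pp i₀ (λ i i<i₀ → 0<y i (lo≤ i<i₀)) (λ i i<i₀ → *-pos 0<D (m<n⇒0<n∸m i<i₀)) lo-term)
  interleave : ∀ A B C E → A * B * (C * E) ≡ (A * C) * (B * E)
  interleave = solve-∀
  -- The index differences on the two sides of `i₀` multiply to `i₀ !` and `t !`, whose product
  -- divides `s !`.
  divides-total : D ^ i₀ * i₀ ! * (D ^ t * t !) ∣ D ^ s * s !
  divides-total = subst₂ _∣_ (sym (interleave (D ^ i₀) (i₀ !) (D ^ t) (t !)))
    (cong₂ _*_ (trans (sym (^-distribˡ-+-* D i₀ t)) (cong (D ^_) i₀+t≡s)) (cong _! i₀+t≡s))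
    (*-monoʳ-∣ (D ^ i₀ * D ^ t) (!*!∣! i₀ t))

-- Terms with a large prime factor, and the product of the others

-- The bound `p < suc x` turns the existential into a finite search.
HasPrimeAbove : ℕ → ℕ → Set
HasPrimeAbove k x = ∃ λ p → p < suc x × Prime p × k < p × p ∣ x

hasPrimeAbove? : ∀ k x → Dec (HasPrimeAbove k x)
hasPrimeAbove? k x = anyUpTo? (λ p → prime? p ×-dec (k <? p ×-dec (p ∣? x))) (suc x)

primeAbove : ∀ {k x p} → 0 < x → Prime p → k < p → p ∣ x → HasPrimeAbove k x
primeAbove 0<x pp k<p p∣x = _ , s≤s (∣⇒≤′ 0<x p∣x) , pp , k<p , p∣x

record Three (Q : ℕ → Set) : Set where
  constructor three
  field
    {l₁ l₂ l₃} : ℕ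
    l₁<l₂ : l₁ < l₂
    l₂<l₃ : l₂ < l₃
    q₁ : Q l₁
    q₂ : Q l₂
    q₃ : Q l₃

bit : Bool → ℕ
bit true = 1
bit false = 0

cnt : ℕ → (ℕ → Bool) → ℕ
cnt zero f = 0
cnt (suc s) f = bit (f s) + cnt s f

cnt-last : ∀ s f {m} → suc m ≤ cnt s f → ∃ λ i → i < s × f i ≡ true × m ≤ cnt i f
cnt-last (suc s) f h with f s in eq
... | true = s , ≤-refl , eq , ≤-pred h
... | false with cnt-last s f h
...   | i , i<s , fi , m≤ = i , m<n⇒m<1+n i<s , fi , m≤

cnt-∨ : ∀ s f g → cnt s (λ i → f i ∨ g i) ≤ cnt s f + cnt s g
cnt-∨ zero f g = z≤n
cnt-∨ (suc s) f g with f s | g s | cnt-∨ s f g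
... | true  | true  | h = s≤s (≤-trans h (+-monoʳ-≤ (cnt s f) (n≤1+n (cnt s g))))
... | true  | false | h = s≤s h
... | false | true  | h = subst (suc (cnt s (λ i → f i ∨ g i)) ≤_) (sym (+-suc (cnt s f) (cnt s g))) (s≤s h)
... | false | false | h = h

cnt-three : ∀ s f → 3 ≤ cnt s f → Three (λ i → i < s × f i ≡ true)
cnt-three s f h with cnt-last s f h
... | i₃ , i₃<s , f₃ , h₂ with cnt-last i₃ f h₂
...   | i₂ , i₂<i₃ , f₂ , h₁ with cnt-last i₂ f h₁
...     | i₁ , i₁<i₂ , f₁ , _ = three i₁<i₂ i₂<i₃ (<-trans (<-trans i₁<i₂ i₂<i₃) i₃<s , f₁)
                                  (<-trans i₂<i₃ i₃<s , f₂) (i₃<s , f₃)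

≡true⇒≡ : ∀ {i r} → (i ≡ᵇ r) ≡ true → i ≡ r
≡true⇒≡ {i} {r} eq = ≡ᵇ⇒≡ i r (subst T (sym eq) tt)

cnt-single : ∀ s r → cnt s (_≡ᵇ r) ≤ 1
cnt-single s r = ≮⇒≥ two
  where
  two : ¬ (1 < cnt s (_≡ᵇ r))
  two h with cnt-last s _ h
  ... | i , _ , ei , h₁ with cnt-last i _ h₁
  ...   | j , j<i , ej , _ = <-irrefl (trans (≡true⇒≡ ej) (sym (≡true⇒≡ ei))) j<i

elem : List ℕ → ℕ → Bool
elem [] i = false
elem (r ∷ R) i = (i ≡ᵇ r) ∨ elem R i

cnt-elem : ∀ s R → cnt s (elem R) ≤ length R
cnt-elem zero [] = z≤n
cnt-elem (suc s) [] = cnt-elem s []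
cnt-elem s (r ∷ R) = ≤-trans (cnt-∨ s (_≡ᵇ r) (elem R)) (+-mono-≤ (cnt-single s r) (cnt-elem s R))

≡ᵇ-refl : ∀ n → (n ≡ᵇ n) ≡ true
≡ᵇ-refl zero = refl
≡ᵇ-refl (suc n) = ≡ᵇ-refl n

∨-true : ∀ a → a ∨ true ≡ true
∨-true true = refl
∨-true false = refl

∈⇒elem : ∀ {R r} → r ∈ R → elem R r ≡ true
∈⇒elem {r ∷ R} (here refl) = cong (_∨ elem R r) (≡ᵇ-refl r)
∈⇒elem {r' ∷ R} {r} (there r∈R) = trans (cong ((r ≡ᵇ r') ∨_) (∈⇒elem r∈R)) (∨-true (r ≡ᵇ r'))

drop : (ℕ → Bool) → (ℕ → ℕ) → ℕ → ℕ
drop bad x i = if bad i then 1 else x i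

drop-pos : ∀ bad {x i} → 0 < x i → 0 < drop bad x i
drop-pos bad {i = i} h with bad i
... | true = s≤s z≤n
... | false = h

drop-lower : ∀ s bad {x b} → 0 < b → (∀ i → i < s → b ≤ x i) → b ^ s ≤ b ^ cnt s bad * ∏ s (drop bad x)
drop-lower zero bad 0<b h = ≤-refl
drop-lower (suc s) bad {x} {b} 0<b h with bad s | drop-lower s bad 0<b (λ i → h i ∘ m<n⇒m<1+n)
... | true  | ih = ≤-trans (*-monoʳ-≤ b ih) (≤-reflexive (regroup b (b ^ cnt s bad) _))
  where regroup : ∀ b c P → b * (c * P) ≡ b * c * (P * 1)
        regroup = solve-∀
... | false | ih = ≤-trans (*-mono-≤ (h s ≤-refl) ih) (≤-reflexive (regroup (x s) (b ^ cnt s bad) _))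
  where regroup : ∀ y c P → y * (c * P) ≡ c * (P * y)
        regroup = solve-∀

drop-upper : ∀ s bad {x X} → (∀ i → i < s → x i ≤ X) → ∏ s x ≤ X ^ cnt s bad * ∏ s (drop bad x)
drop-upper zero bad h = ≤-refl
drop-upper (suc s) bad {x} {X} h with bad s | drop-upper s bad (λ i → h i ∘ m<n⇒m<1+n)
... | true  | ih = ≤-trans (*-mono-≤ ih (h s ≤-refl)) (≤-reflexive (regroup X (X ^ cnt s bad) _))
  where regroup : ∀ b c P → c * P * b ≡ b * c * (P * 1)
        regroup = solve-∀
... | false | ih = ≤-trans (*-monoˡ-≤ (x s) ih) (≤-reflexive (*-assoc (X ^ cnt s bad) _ (x s)))

argmax : ∀ (f : ℕ → ℕ) s → ∃ λ i₀ → i₀ ≤ s × (∀ i → i ≤ s → f i ≤ f i₀)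
argmax f zero = 0 , z≤n , λ { _ z≤n → ≤-refl }
argmax f (suc s) with argmax f s
... | i₀ , i₀≤s , max with ≤-total (f i₀) (f (suc s))
...   | inj₁ le = suc s , ≤-refl , go
  where go : ∀ i → i ≤ suc s → f i ≤ f (suc s)
        go i i≤ with m≤n⇒m<n∨m≡n i≤
        ... | inj₁ i<  = ≤-trans (max i (≤-pred i<)) le
        ... | inj₂ refl = ≤-refl
...   | inj₂ ge = i₀ , m≤n⇒m≤1+n i₀≤s , go
  where go : ∀ i → i ≤ suc s → f i ≤ f i₀
        go i i≤ with m≤n⇒m<n∨m≡n i≤
        ... | inj₁ i<  = max i (≤-pred i<)
        ... | inj₂ refl = ge

ap : ℕ → ℕ → ℕ → ℕ
ap b D i = b + D * i

-- The 2 counts the terms with a prime above `k`, and `length ps` the terms of maximal valuation.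
-- `lower` measures `Y` by the smallest term alone; `upper` retains the full product, to be compared
-- with a binomial coefficient.
record Excised (k b D s : ℕ) (ps : List ℕ) : Set where
  field
    Y : ℕ
    Y>0 : 0 < Y
    lower : b ^ suc s ≤ b ^ (2 + length ps) * Y
    upper : ∏ (suc s) (ap b D) ≤ ap b D s ^ (2 + length ps) * Y
    ν-large : ∀ {p} → Prime p → k < p → ν p Y ≡ 0
    ν-listed : ∀ {p} → Prime p → p ∈ ps → ν p Y ≤ ν p (D ^ s * s !)
    ν-unlisted : ∀ {p} e → Prime p → (∀ i → i ≤ s → ν p (ap b D i) ≤ e) → ν p Y ≤ e + ν p (D ^ s * s !)
    ν-total : ∀ {p} → Prime p → ν p Y ≤ ν p (∏ (suc s) (ap b D))

-- Y is the product of the terms without prime factor above k, one term of maximal p-adic valuation being left out for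
-- each listed p.
excise : ∀ k b D s ps → 0 < b → 0 < D →
  Three (λ i → i ≤ s × HasPrimeAbove k (ap b D i)) ⊎ Excised k b D s ps
excise k b D s ps 0<b 0<D with 3 ≤? cnt (suc s) (λ i → does (hasPrimeAbove? k (ap b D i)))
... | yes h = inj₁ (convert (cnt-three (suc s) _ h))
  where
  good : ∀ {i} → i < suc s × does (hasPrimeAbove? k (ap b D i)) ≡ true → i ≤ s × HasPrimeAbove k (ap b D i)
  good {i} (i≤s , e) with hasPrimeAbove? k (ap b D i)
  ... | yes r = ≤-pred i≤s , r
  ... | no _ with () ← e
  convert : Three _ → Three _
  convert (three a b q₁ q₂ q₃) = three a b (good q₁) (good q₂) (good q₃)
... | no few = inj₂ record
  { Y = Y
  ; Y>0 = ∏-pos (suc s) y-pos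
  ; lower = ≤-trans (drop-lower (suc s) bad {x} 0<b (λ i _ → m≤m+n b (D * i)))
              (*-monoˡ-≤ Y (^-monoʳ-≤ b {{>-nonZero 0<b}} cnt≤))
  ; upper = ≤-trans (drop-upper (suc s) bad {x} (λ i i≤s → +-monoʳ-≤ b (*-monoʳ-≤ D (≤-pred i≤s))))
              (*-monoˡ-≤ Y (^-monoʳ-≤ (x s) {{>-nonZero (0<x s)}} cnt≤))
  ; ν-large = λ {p} pp k<p → ν-∤ λ d → large pp k<p (prime∣∏ pp (suc s) d)
  ; ν-listed = listed
  ; ν-unlisted = unlisted
  ; ν-total = λ pp → ν-∏-mono pp (suc s) y-pos (λ i _ → 0<x i) (λ i _ → ν-y pp i)
  }
  where
  x = ap b D
  0<x : ∀ i → 0 < x i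
  0<x i = ≤-trans 0<b (m≤m+n b (D * i))
  isRough : ℕ → Bool
  isRough i = does (hasPrimeAbove? k (x i))
  peak : ℕ → ℕ
  peak p = proj₁ (argmax (λ i → ν p (x i)) s)
  R = map peak ps
  bad : ℕ → Bool
  bad i = isRough i ∨ elem R i
  y = drop bad x
  Y = ∏ (suc s) y
  y-pos : ∀ i → i < suc s → 0 < y i
  y-pos i _ = drop-pos bad {x} (0<x i)
  cnt≤ : cnt (suc s) bad ≤ 2 + length ps
  cnt≤ = ≤-trans (cnt-∨ (suc s) isRough (elem R))
    (+-mono-≤ (≤-pred (≰⇒> few)) (subst (cnt (suc s) (elem R) ≤_) (length-map peak ps) (cnt-elem (suc s) R)))
  ν-1 : ∀ {p} → Prime p → ν p 1 ≡ 0
  ν-1 pp = ν-∤ λ d → ¬prime[1] (subst Prime (∣1⇒≡1 d) pp)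
  ν-y : ∀ {p} → Prime p → ∀ i → ν p (y i) ≤ ν p (x i)
  ν-y {p} pp i with bad i
  ... | true = subst (_≤ ν p (x i)) (sym (ν-1 pp)) z≤n
  ... | false = ≤-refl
  large : ∀ {p} → Prime p → k < p → ¬ ∃ λ i → i < suc s × p ∣ y i
  large pp k<p (i , _ , d) with hasPrimeAbove? k (x i) | elem R i
  ... | yes _ | _ = ¬prime[1] (subst Prime (∣1⇒≡1 d) pp)
  ... | no _ | true = ¬prime[1] (subst Prime (∣1⇒≡1 d) pp)
  ... | no r | false = r (primeAbove (0<x i) pp k<p d)
  bound : ∀ {p} → Prime p → ν p Y ≤ ν p (y (peak p)) + ν p (D ^ s * s !)
  bound {p} pp with argmax (λ i → ν p (x i)) s
  ... | i₀ , i₀≤s , max =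
    ν-progression pp b D s i₀ 0<b 0<D i₀≤s max (λ i i≤ → y-pos i (s≤s i≤)) (λ i _ → ν-y pp i)
  y-listed : ∀ i → elem R i ≡ true → y i ≡ 1
  y-listed i e with isRough i | elem R i
  ... | true | _ = refl
  ... | false | true = refl
  listed : ∀ {p} → Prime p → p ∈ ps → ν p Y ≤ ν p (D ^ s * s !)
  listed {p} pp p∈ps = subst (λ z → ν p Y ≤ z + ν p (D ^ s * s !))
    (trans (cong (ν p) (y-listed (peak p) (∈⇒elem (∈-map⁺ peak p∈ps)))) (ν-1 pp)) (bound pp)
  unlisted : ∀ {p} e → Prime p → (∀ i → i ≤ s → ν p (x i) ≤ e) → ν p Y ≤ e + ν p (D ^ s * s !)
  unlisted {p} e pp h = ≤-trans (bound pp) (+-monoˡ-≤ (ν p (D ^ s * s !))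
    (≤-trans (ν-y pp (peak p)) (h (peak p) (proj₁ (proj₂ (argmax (λ i → ν p (x i)) s))))))

-- Primes above `k` do not occur in `Y` and all others are listed, so Erdős's bound holds at every
-- prime at once.
excised-∣ : ∀ {k b D s ps} → 0 < D → (∀ {p} → Prime p → p ≤ k → p ∈ ps) →
  (E : Excised k b D s ps) → Excised.Y E ∣ D ^ s * s !
excised-∣ {k} {b} {D} {s} {ps} 0<D all E = ν-≤⇒∣ Y>0 (*-pos (^-pos 0<D s) (!-pos s)) dom
  where
  open Excised E
  dom : ∀ {p} → Prime p → ν p Y ≤ ν p (D ^ s * s !)
  dom {p} pp with p ≤? k
  ... | yes p≤k = ν-listed pp (all pp p≤k)
  ... | no p≰k = subst (_≤ ν p (D ^ s * s !)) (sym (ν-large pp (≰⇒> p≰k))) z≤n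

-- Primorials and their bound by powers of 4

primeOr1 : ℕ → ℕ
primeOr1 n = if does (prime? n) then n else 1

primeOr1-pos : ∀ n → 0 < primeOr1 n
primeOr1-pos n with prime? n
... | yes pp = prime>0 pp
... | no _ = s≤s z≤n

primeOr1-prime : ∀ {n} → Prime n → primeOr1 n ≡ n
primeOr1-prime {n} pp with prime? n
... | yes _ = refl
... | no ¬pp = ⊥-elim (¬pp pp)

primeOr1-¬prime : ∀ {n} → ¬ Prime n → primeOr1 n ≡ 1
primeOr1-¬prime {n} ¬pp with prime? n
... | yes pp = ⊥-elim (¬pp pp)
... | no _ = refl

primeOr1-∣ : ∀ n → primeOr1 n ∣ n
primeOr1-∣ n with prime? n
... | yes _ = ∣-refl
... | no _ = 1∣ n

prime∣prime : ∀ {p q} → Prime p → Prime q → p ∣ q → p ≡ q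
prime∣prime pp pq p∣q with prime⇒irreducible pq p∣q
... | inj₁ refl = ⊥-elim (¬prime[1] pp)
... | inj₂ eq = eq

prime∣primeOr1 : ∀ {p n} → Prime p → p ∣ primeOr1 n → p ≡ n
prime∣primeOr1 {p} {n} pp d with prime? n
... | yes pn = prime∣prime pp pn d
... | no _ = ⊥-elim (¬prime[1] (subst Prime (∣1⇒≡1 d) pp))

primorial : ℕ → ℕ
primorial m = ∏ m (primeOr1 ∘ suc)

primorial-pos : ∀ m → 0 < primorial m
primorial-pos m = ∏-pos m (λ i _ → primeOr1-pos (suc i))

∣∏ : ∀ s x {i} → i < s → x i ∣ ∏ s x
∣∏ (suc s) x {i} i<s with m≤n⇒m<n∨m≡n (≤-pred i<s)
... | inj₁ i<s' = ∣m⇒∣m*n (x s) (∣∏ s x i<s')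
... | inj₂ refl = n∣m*n (∏ s x)

prime∣primorial : ∀ {p m} → Prime p → p ≤ m → p ∣ primorial m
prime∣primorial {zero} pp _ = ⊥-elim (¬prime[0] pp)
prime∣primorial {suc p} {m} pp p≤m = subst (_∣ primorial m) (primeOr1-prime pp) (∣∏ m (primeOr1 ∘ suc) p≤m)

-- This is binom(2t+1, t) ≤ 4^t with denominators cleared. From t to t + 1 the binomial grows by
-- (2t+3)(2t+2)/((t+1)(t+2)), which is below 4.
central-bound : ∀ t → (suc t + t) ! ≤ 4 ^ t * (t ! * suc t !)
central-bound zero = ≤-refl
central-bound (suc t) = begin
  (suc (suc t) + suc t) !                              ≡⟨ cong _! (shift t) ⟩
  suc (suc (suc t + t)) * (suc (suc t + t) * (suc t + t) !)
    ≤⟨ *-monoʳ-≤ (suc (suc (suc t + t))) (*-monoʳ-≤ (suc (suc t + t)) (central-bound t)) ⟩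
  suc (suc (suc t + t)) * (suc (suc t + t) * (4 ^ t * (t ! * suc t !)))
    ≡⟨ regroup (suc (suc (suc t + t))) (suc (suc t + t)) (4 ^ t) (t ! * suc t !) ⟩
  (suc (suc (suc t + t)) * suc (suc t + t)) * (4 ^ t * (t ! * suc t !))
    ≤⟨ *-monoˡ-≤ (4 ^ t * (t ! * suc t !)) (m+n≤o⇒m≤o (suc (suc (suc t + t)) * suc (suc t + t)) (≤-reflexive (poly t))) ⟩
  (4 * (suc t * suc (suc t))) * (4 ^ t * (t ! * suc t !))
    ≡⟨ regroup′ (suc t) (suc (suc t)) (4 ^ t) (t !) (suc t !) ⟩
  4 * 4 ^ t * (suc t * t ! * (suc (suc t) * suc t !))  ∎
  where
  open ≤-Reasoning
  shift : ∀ t → suc (suc t) + suc t ≡ suc (suc (suc t + t))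
  shift = solve-∀
  regroup : ∀ a b c d → a * (b * (c * d)) ≡ a * b * (c * d)
  regroup = solve-∀
  regroup′ : ∀ a b c d e → 4 * (a * b) * (c * (d * e)) ≡ 4 * c * (a * d * (b * e))
  regroup′ = solve-∀
  poly : ∀ t → suc (suc (suc t + t)) * suc (suc t + t) + (2 * t + 2) ≡ 4 * (suc t * suc (suc t))
  poly = solve-∀

-- The primes in (t+1, 2t+1] all divide the binomial coefficient (2t+1)! / (t! (t+1)!).
primorial-tail : ∀ t → ∏ t (λ i → primeOr1 (suc (suc t + i))) ≤ 4 ^ t
primorial-tail t = go (!*!∣! t (suc t))
  where
  Q = ∏ t (λ i → primeOr1 (suc (suc t + i)))
  W = ∏ t (λ i → suc (suc t + i))
  0<Q : 0 < Q
  0<Q = ∏-pos t (λ i _ → primeOr1-pos (suc (suc t + i)))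
  0<W : 0 < W
  0<W = ∏-pos t (λ i _ → s≤s z≤n)
  W-eq : suc t ! * W ≡ (suc t + t) !
  W-eq = !-∏-tail (suc t) t
  Q∣W : Q ∣ W
  Q∣W = ∏-mono-∣ t (λ i _ → primeOr1-∣ (suc (suc t + i)))
  go : t ! * suc t ! ∣ (t + suc t) ! → Q ≤ 4 ^ t
  go (divides C eq) = ≤-trans (∣⇒≤′ 0<C (ν-≤⇒∣ 0<Q 0<C dom)) C≤
    where
    total : (suc t + t) ! ≡ C * (t ! * suc t !)
    total = trans (cong _! (+-comm (suc t) t)) eq
    0<C : 0 < C
    0<C = *-pos⁻ˡ (subst (0 <_) total (!-pos (suc t + t)))
    C≤ : C ≤ 4 ^ t
    C≤ = *-cancelʳ-≤ C (4 ^ t) (t ! * suc t !) {{>-nonZero (*-pos (!-pos t) (!-pos (suc t)))}}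
           (subst (_≤ 4 ^ t * (t ! * suc t !)) total (central-bound t))
    W≡C*t! : W ≡ C * t !
    W≡C*t! = *-cancelˡ-≡ W (C * t !) (suc t !) {{>-nonZero (!-pos (suc t))}}
      (trans W-eq (trans total (regroup C (t !) (suc t !))))
      where regroup : ∀ a b c → a * (b * c) ≡ c * (a * b)
            regroup = solve-∀
    dom : ∀ {p} → Prime p → ν p Q ≤ ν p C
    dom {p} pp with p ≤? suc t
    ... | yes p≤ = subst (_≤ ν p C) (sym (ν-∤ λ d → small (prime∣∏ pp t d))) z≤n
      where
      small : ¬ ∃ λ i → i < t × p ∣ primeOr1 (suc (suc t + i))
      small (i , _ , d) = <-irrefl (prime∣primeOr1 pp d) (≤-<-trans p≤ (s≤s (m≤m+n (suc t) i)))
    ... | no p≰ = begin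
      ν p Q                ≤⟨ ν-mono-∣ pp 0<W Q∣W ⟩
      ν p W                ≡⟨ cong (ν p) W≡C*t! ⟩
      ν p (C * t !)        ≡⟨ ν-* pp 0<C (!-pos t) ⟩
      ν p C + ν p (t !)    ≡⟨ cong (ν p C +_) (ν-∤ (prime∤! pp (≤-trans (n≤1+n (suc t)) (≰⇒> p≰)))) ⟩
      ν p C + 0            ≡⟨ +-identityʳ _ ⟩
      ν p C                ∎
      where open ≤-Reasoning

even-¬prime : ∀ t → ¬ Prime (2 * suc (suc t))
even-¬prime t pp with prime⇒irreducible pp (m∣m*n {2} (suc (suc t)))
... | inj₁ ()
... | inj₂ eq with () ← trans eq (*-comm 2 (suc (suc t)))

halve : ∀ n → ∃ λ t → n ≡ 2 * t ⊎ n ≡ suc (2 * t)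
halve zero = 0 , inj₁ refl
halve (suc n) with halve n
... | t , inj₁ eq = t , inj₂ (cong suc eq)
... | t , inj₂ eq = suc t , inj₁ (trans (cong suc eq) (sym (*-suc 2 t)))

-- Erdős's induction: an even number above 2 adds no prime; for 2u + 1 the primes up to u + 1 are
-- covered by induction and the later ones by `primorial-tail`.
primorial≤4^ : ∀ m → primorial m ≤ 4 ^ m
primorial≤4^ m = go m (<-wellFounded m)
  where
  go : ∀ m → Acc _<_ m → primorial m ≤ 4 ^ m
  go m (acc rec) with halve m
  ... | zero , inj₁ refl = s≤s z≤n
  ... | zero , inj₂ refl = s≤s z≤n
  ... | suc zero , inj₁ refl = s≤s (s≤s z≤n)
  ... | suc (suc t) , inj₁ refl = begin
    primorial n * primeOr1 (suc n)   ≡⟨ cong (primorial n *_) (primeOr1-¬prime (even-¬prime t)) ⟩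
    primorial n * 1                  ≡⟨ *-identityʳ _ ⟩
    primorial n                      ≤⟨ go n (rec ≤-refl) ⟩
    4 ^ n                            ≤⟨ ^-monoʳ-≤ 4 (n≤1+n n) ⟩
    4 ^ suc n                        ∎
    where
    open ≤-Reasoning
    n = pred (2 * suc (suc t))
  ... | suc t , inj₂ refl = begin
    primorial (suc (2 * u))          ≡⟨ cong primorial (shape u) ⟩
    primorial (suc u + u)            ≡⟨ ∏-+ (suc u) u (primeOr1 ∘ suc) ⟩
    primorial (suc u) * ∏ u (λ i → primeOr1 (suc (suc u + i)))
      ≤⟨ *-mono-≤ (go (suc u) (rec (subst (suc u <_) (sym (shape u)) (m<m+n (suc u) (s≤s z≤n))))) (primorial-tail u) ⟩
    4 ^ suc u * 4 ^ u                ≡⟨ ^-distribˡ-+-* 4 (suc u) u ⟨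
    4 ^ (suc u + u)                  ≡⟨ cong (4 ^_) (shape u) ⟨
    4 ^ suc (2 * u)                  ∎
    where
    open ≤-Reasoning
    u = suc t
    shape : ∀ u → suc (2 * u) ≡ suc u + u
    shape = solve-∀

-- The only multiples of p up to n are p, 2p, …, jp, and j < p makes each contribute valuation 1.
ν-!-≤ : ∀ {p} → Prime p → ∀ n j → j < p → n < p * suc j → ν p (n !) ≤ j
ν-!-≤ {p} pp zero j _ _ = subst (_≤ j) (sym (ν-∤ λ d → ¬prime[1] (subst Prime (∣1⇒≡1 d) pp))) z≤n
ν-!-≤ {p} pp (suc n) j j<p n< with p ∣? suc n
... | no ∤ = begin
  ν p (suc n * n !)          ≡⟨ ν-* pp (s≤s z≤n) (!-pos n) ⟩
  ν p (suc n) + ν p (n !)    ≡⟨ cong (_+ ν p (n !)) (ν-∤ ∤) ⟩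
  ν p (n !)                  ≤⟨ ν-!-≤ pp n j j<p (<-trans ≤-refl n<) ⟩
  j                          ∎
  where open ≤-Reasoning
... | yes (divides (suc q) eq) = begin
  ν p (suc n * n !)          ≡⟨ ν-* pp (s≤s z≤n) (!-pos n) ⟩
  ν p (suc n) + ν p (n !)    ≤⟨ +-mono-≤ ν≤1 (ν-!-≤ pp n q (<-trans q<j j<p)
                                  (≤-reflexive (trans eq (*-comm (suc q) p)))) ⟩
  1 + q                      ≤⟨ q<j ⟩
  j                          ∎
  where
  open ≤-Reasoning
  q<j : q < j
  q<j = ≤-pred (*-cancelˡ-< p (suc q) (suc j) (subst (_< p * suc j) (trans eq (*-comm (suc q) p)) n<))
  -- If p² divided (q + 1) p, then p would divide q + 1, which is at most j < p.
  ν≤1 : ν p (suc n) ≤ 1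
  ν≤1 = ≮⇒≥ λ 2≤ → >⇒∤ {suc q} (≤-<-trans q<j j<p) (*-cancelʳ-∣ p {{prime⇒nonZero pp}}
    (subst (p * p ∣_) eq (∣-trans (subst (_∣ p ^ ν p (suc n)) (cong (p *_) (*-identityʳ p)) (^-∣-mono p 2≤)) (p^ν∣n p (suc n)))))

-- Counting primes from above by sieving

sieve : (ℕ → Bool) → ℕ → List ℕ
sieve χ zero = []
sieve χ (suc n) = if χ n then n ∷ sieve χ n else sieve χ n

length-sieve : ∀ χ n → length (sieve χ n) ≡ cnt n χ
length-sieve χ zero = refl
length-sieve χ (suc n) with χ n
... | true = cong suc (length-sieve χ n)
... | false = length-sieve χ n

∈-sieve : ∀ χ n {p} → p < n → χ p ≡ true → p ∈ sieve χ n
∈-sieve χ (suc n) {p} p<n χp with m≤n⇒m<n∨m≡n (≤-pred p<n)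
∈-sieve χ (suc n) {p} p<n χp | inj₁ p<n' with χ n
... | true = there (∈-sieve χ n p<n' χp)
... | false = ∈-sieve χ n p<n' χp
∈-sieve χ (suc n) {p} p<n χp | inj₂ refl rewrite χp = here refl

cnt-+ : ∀ a b f → cnt (a + b) f ≡ cnt b (λ i → f (a + i)) + cnt a f
cnt-+ a zero f = cong (λ s → cnt s f) (+-identityʳ a)
cnt-+ a (suc b) f = trans (cong (λ s → cnt s f) (+-suc a b))
  (trans (cong (bit (f (a + b)) +_) (cnt-+ a b f)) (sym (+-assoc (bit (f (a + b))) _ _)))

divides? : ℕ → ℕ → Bool
divides? zero x = false
divides? (suc q) x = (x % suc q) ≡ᵇ 0

divides?-sound : ∀ q x → divides? q x ≡ true → q ∣ x
divides?-sound (suc q) x e = m%n≡0⇒n∣m x (suc q) (≡true⇒≡ e)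

divides?-complete : ∀ q x → 0 < q → q ∣ x → divides? q x ≡ true
divides?-complete (suc q) x _ d = cong (_≡ᵇ 0) (n∣m⇒m%n≡0 x (suc q) d)

unsieved : List ℕ → ℕ → Bool
unsieved [] x = true
unsieved (q ∷ qs) x = if divides? q x then x ≡ᵇ q else unsieved qs x

prime-unsieved : ∀ {qs p} → All (1 <_) qs → Prime p → unsieved qs p ≡ true
prime-unsieved [] pp = refl
prime-unsieved {q ∷ qs} {p} (1<q ∷ h) pp with divides? q p in eq
... | false = prime-unsieved h pp
... | true with prime⇒irreducible pp (divides?-sound q p eq)
...   | inj₁ refl = ⊥-elim (<-irrefl refl 1<q)
...   | inj₂ refl = ≡ᵇ-refl p

wheel : ℕ → Bool
wheel x = not (divides? 2 x ∨ divides? 3 x ∨ divides? 5 x ∨ divides? 7 x)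

wheel-periodic : ∀ x → wheel (x + 210) ≡ wheel x
wheel-periodic x = cong not (cong₂ _∨_ (shift 1 105) (cong₂ _∨_ (shift 2 70) (cong₂ _∨_ (shift 4 42) (shift 6 30))))
  where
  shift : ∀ q j → divides? (suc q) (x + j * suc q) ≡ divides? (suc q) x
  shift q j = cong (_≡ᵇ 0) ([m+kn]%n≡m%n x j (suc q))

cnt-wheel-periodic : ∀ x → cnt (x + 210) wheel ≡ 48 + cnt x wheel
cnt-wheel-periodic zero = refl
cnt-wheel-periodic (suc x) = trans (cong₂ (λ a b → bit a + b) (wheel-periodic x) (cnt-wheel-periodic x))
  (swap (bit (wheel x)) (cnt x wheel) {48})
  where swap : ∀ a b {c} → a + (c + b) ≡ c + (a + b)
        swap a b {c} = trans (sym (+-assoc a c b)) (trans (cong (_+ b) (+-comm a c)) (+-assoc c a b))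

-- Exactly φ(210) = 48 of 210 consecutive numbers are prime to 210, so the bound passes from one
-- period to the next; 270 is large enough for the first period.
cnt-wheel : ∀ x → 210 * cnt x wheel ≤ 48 * x + 270
cnt-wheel x = go x (<-wellFounded x)
  where
  table : ∀ {x} → x < 210 → 210 * cnt x wheel ≤ 48 * x + 270
  table = toWitness {a? = allUpTo? (λ x → 210 * cnt x wheel ≤? 48 * x + 270) 210} tt
  go : ∀ x → Acc _<_ x → 210 * cnt x wheel ≤ 48 * x + 270
  go x (acc rec) with x <? 210
  ... | yes x<210 = table x<210
  ... | no x≮210 = begin
    210 * cnt x wheel                ≡⟨ cong (λ z → 210 * cnt z wheel) eq ⟨
    210 * cnt (y + 210) wheel        ≡⟨ cong (210 *_) (cnt-wheel-periodic y) ⟩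
    210 * (48 + cnt y wheel)         ≡⟨ *-distribˡ-+ 210 48 (cnt y wheel) ⟩
    10080 + 210 * cnt y wheel        ≤⟨ +-monoʳ-≤ 10080 (go y (rec (subst (y <_) eq (m<m+n y (s≤s z≤n))))) ⟩
    10080 + (48 * y + 270)           ≡⟨ regroup y ⟩
    48 * (y + 210) + 270             ≡⟨ cong (λ z → 48 * z + 270) eq ⟩
    48 * x + 270                     ∎
    where
    open ≤-Reasoning
    y = x ∸ 210
    eq : y + 210 ≡ x
    eq = m∸n+n≡m (≮⇒≥ x≮210)
    shuffle : ∀ a b c → a + (b + c) ≡ b + a + c
    shuffle = solve-∀
    regroup : ∀ y → 10080 + (48 * y + 270) ≡ 48 * (y + 210) + 270
    regroup y = trans (shuffle 10080 (48 * y) 270) (cong (_+ 270) (sym (*-distribˡ-+ 48 y 210)))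

-- A list containing all primes up to `k`. The 1 and the composites in it are harmless: only the
-- length matters, and it grows like 8k/35.
wheelPrimes : ℕ → List ℕ
wheelPrimes k = 2 ∷ 3 ∷ 5 ∷ 7 ∷ sieve wheel (suc k)

∈-wheelPrimes : ∀ {k p} → Prime p → p ≤ k → p ∈ wheelPrimes k
∈-wheelPrimes {k} {p} pp p≤k with divides? 2 p in e₂
... | true = here (sym (prime∣prime prime[2] pp (divides?-sound 2 p e₂)))
... | false with divides? 3 p in e₃
...   | true = there (here (sym (prime∣prime (toWitness {a? = prime? 3} tt) pp (divides?-sound 3 p e₃))))
...   | false with divides? 5 p in e₅
...     | true = there (there (here (sym (prime∣prime (toWitness {a? = prime? 5} tt) pp (divides?-sound 5 p e₅)))))
...     | false with divides? 7 p in e₇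
...       | true = there (there (there (here (sym (prime∣prime (toWitness {a? = prime? 7} tt) pp (divides?-sound 7 p e₇))))))
...       | false = there (there (there (there (∈-sieve wheel (suc k) (s≤s p≤k) wheel-p))))
  where
  wheel-p : wheel p ≡ true
  wheel-p rewrite e₂ | e₃ | e₅ | e₇ = refl

wheelPrimes-length : ∀ k → 210 * length (wheelPrimes k) ≤ 48 * k + 1158
wheelPrimes-length k = begin
  210 * (4 + length (sieve wheel (suc k)))   ≡⟨ cong (λ z → 210 * (4 + z)) (length-sieve wheel (suc k)) ⟩
  210 * (4 + cnt (suc k) wheel)              ≡⟨ *-distribˡ-+ 210 4 (cnt (suc k) wheel) ⟩
  840 + 210 * cnt (suc k) wheel              ≤⟨ +-monoʳ-≤ 840 (cnt-wheel (suc k)) ⟩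
  840 + (48 * suc k + 270)                   ≡⟨ bump 840 48 270 k ⟩
  48 * k + 1158                              ∎
  where
  open ≤-Reasoning
  bump : ∀ a b c k → a + (b * suc k + c) ≡ b * k + (a + b + c)
  bump = solve-∀

-- Certified tables for 74 ≤ k < 16384

∧-true : ∀ {a b} → a ∧ b ≡ true → a ≡ true × b ≡ true
∧-true {true} {true} _ = refl , refl

≤ᵇ-sound : ∀ {m n} → (m ≤ᵇ n) ≡ true → m ≤ n
≤ᵇ-sound {m} {n} e = ≤ᵇ⇒≤ m n (subst T (sym e) tt)

<ᵇ-sound : ∀ {m n} → (m <ᵇ n) ≡ true → m < n
<ᵇ-sound {m} {n} e = <ᵇ⇒< m n (subst T (sym e) tt)

T⇒≡true : ∀ {b} → T b → b ≡ true
T⇒≡true {true} _ = refl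

-- Sieving by the primes up to 127 leaves only primes below 131² = 17161, so `π̂` is sharp
-- throughout the range of the tables.
smallPrimes : List ℕ
smallPrimes = 2 ∷ 3 ∷ 5 ∷ 7 ∷ 11 ∷ 13 ∷ 17 ∷ 19 ∷ 23 ∷ 29 ∷ 31 ∷ 37 ∷ 41 ∷ 43 ∷ 47 ∷ 53 ∷ 59 ∷ 61 ∷ 67 ∷ 71 ∷ 73 ∷
  79 ∷ 83 ∷ 89 ∷ 97 ∷ 101 ∷ 103 ∷ 107 ∷ 109 ∷ 113 ∷ 127 ∷ []

candidate : ℕ → Bool
candidate x = (1 <ᵇ x) ∧ unsieved smallPrimes x

π̂ : ℕ → ℕ
π̂ k = cnt (suc k) candidate

candidates : ℕ → List ℕ
candidates k = sieve candidate (suc k)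

prime-candidate : ∀ {p} → Prime p → candidate p ≡ true
prime-candidate {p} pp with 1 <ᵇ p in eq
... | true = prime-unsieved (toWitness {a? = All.all? (1 <?_) smallPrimes} tt) pp
... | false with () ← trans (sym eq) (T⇒≡true (<⇒<ᵇ (prime>1 pp)))

-- The prime count is carried from block to block instead of being restarted at 0.
π̂-extend : ∀ {A B c} → c ≡ cnt A candidate → A ≤ B → cnt (suc B ∸ A) (λ i → candidate (A + i)) + c ≡ π̂ B
π̂-extend {A} {B} refl A≤B = trans (sym (cnt-+ A (suc B ∸ A) candidate))
  (cong (λ z → cnt z candidate) (m+[n∸m]≡n (m≤n⇒m≤1+n A≤B)))

∈-candidates : ∀ {k p} → Prime p → p ≤ k → p ∈ candidates k
∈-candidates {k} pp p≤k = ∈-sieve candidate (suc k) (s≤s p≤k) (prime-candidate pp)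

noDivisorFrom : ℕ → ℕ → ℕ → Bool
noDivisorFrom zero d x = false
noDivisorFrom (suc fuel) d x = if x <ᵇ d * d then true else not (divides? d x) ∧ noDivisorFrom fuel (suc d) x

noDivisorFrom-sound : ∀ fuel d {x} → 1 < x → 0 < d → noDivisorFrom fuel d x ≡ true → _Rough_ d x → Prime x
noDivisorFrom-sound (suc fuel) d {x} 1<x 0<d e r with x <ᵇ d * d in lt
... | true = rough∧square>⇒prime {{n>1⇒nonTrivial 1<x}} r (<ᵇ-sound lt)
... | false with divides? d x in eq
...   | false = noDivisorFrom-sound fuel (suc d) 1<x (s≤s z≤n) e (∤⇒rough-suc (λ d∣x → clash (divides?-complete d x 0<d d∣x)) r)
  where clash : ¬ divides? d x ≡ true
        clash h with () ← trans (sym eq) h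

-- With fuel 200 the trial divisor can reach 201, and 201² = 40401 exceeds every prime in the
-- tables.
isPrime : ℕ → Bool
isPrime x = (1 <ᵇ x) ∧ noDivisorFrom 200 2 x

isPrime-sound : ∀ {x} → isPrime x ≡ true → Prime x
isPrime-sound {x} e with ∧-true {1 <ᵇ x} e
... | 1<x , e′ = noDivisorFrom-sound 200 2 (<ᵇ-sound 1<x) (s≤s z≤n) e′ 2-rough

-- A block (B , q₁ , q₂ , q₃) covers the k from A, where the previous block ended, up to B.  Either n − k ≥ q₁, and few
-- contradicts Erdős's bound, or the primes q₁ < q₂ < q₃ ≤ 2A lie among n − k, …, n.

PrimeBlock : Set
PrimeBlock = ℕ × ℕ × ℕ × ℕ

record PrimeBlockFor (k : ℕ) : Set where
  field
    A B q₁ q₂ q₃ : ℕ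
    A≤k : A ≤ k
    k≤B : k ≤ B
    q₁<q₂ : q₁ < q₂
    q₂<q₃ : q₂ < q₃
    q₃≤2A : q₃ ≤ 2 * A
    pq₁ : Prime q₁
    pq₂ : Prime q₂
    pq₃ : Prime q₃
    few : B ! < q₁ ^ (A ∸ suc (π̂ B))

checkPrimeBlocks : ℕ → ℕ → List PrimeBlock → Bool
checkPrimeBlocks A c [] = true
checkPrimeBlocks A c ((B , q₁ , q₂ , q₃) ∷ bs) =
  (A ≤ᵇ B) ∧ ((q₁ <ᵇ q₂) ∧ ((q₂ <ᵇ q₃) ∧ ((q₃ ≤ᵇ 2 * A) ∧ (isPrime q₁ ∧ (isPrime q₂ ∧ (isPrime q₃ ∧
  (((B !) <ᵇ q₁ ^ (A ∸ suc c′)) ∧ checkPrimeBlocks (suc B) c′ bs)))))))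
  where c′ = cnt (suc B ∸ A) (λ i → candidate (A + i)) + c

lastOr : ℕ → List PrimeBlock → ℕ
lastOr A [] = A
lastOr A ((B , _) ∷ bs) = lastOr (suc B) bs

checkPrimeBlocks-sound : ∀ A c bs → c ≡ cnt A candidate → checkPrimeBlocks A c bs ≡ true →
  ∀ k → A ≤ k → k < lastOr A bs → PrimeBlockFor k
checkPrimeBlocks-sound A c [] _ _ k A≤k k<A = ⊥-elim (<⇒≱ k<A A≤k)
checkPrimeBlocks-sound A c ((B , q₁ , q₂ , q₃) ∷ bs) c≡ e k A≤k k< with ∧-true {A ≤ᵇ B} e
... | A≤B , e with ∧-true {q₁ <ᵇ q₂} e
... | e₁ , e with ∧-true {q₂ <ᵇ q₃} e
... | e₂ , e with ∧-true {q₃ ≤ᵇ 2 * A} e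
... | e₃ , e with ∧-true {isPrime q₁} e
... | p₁ , e with ∧-true {isPrime q₂} e
... | p₂ , e with ∧-true {isPrime q₃} e
... | p₃ , e with ∧-true {(B !) <ᵇ q₁ ^ (A ∸ suc (cnt (suc B ∸ A) (λ i → candidate (A + i)) + c))} e
... | few , e with k ≤? B
...   | no k≰B = checkPrimeBlocks-sound (suc B) _ bs (π̂-extend c≡ (≤ᵇ-sound {A} A≤B)) e k (≰⇒> k≰B) k<
...   | yes k≤B = record
  { A = A ; B = B ; q₁ = q₁ ; q₂ = q₂ ; q₃ = q₃ ; A≤k = A≤k ; k≤B = k≤B
  ; q₁<q₂ = <ᵇ-sound e₁ ; q₂<q₃ = <ᵇ-sound e₂ ; q₃≤2A = ≤ᵇ-sound e₃
  ; pq₁ = isPrime-sound p₁ ; pq₂ = isPrime-sound p₂ ; pq₃ = isPrime-sound p₃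
  ; few = subst (λ z → B ! < q₁ ^ (A ∸ suc z)) (π̂-extend c≡ (≤ᵇ-sound {A} A≤B)) (<ᵇ-sound few) }

primeBlocks : List PrimeBlock
primeBlocks =
  (75 , 131 , 137 , 139) ∷ (78 , 139 , 149 , 151) ∷ (81 , 149 , 151 , 157) ∷ (83 , 151 , 157 , 163) ∷
  (86 , 157 , 163 , 167) ∷ (89 , 163 , 167 , 173) ∷ (93 , 167 , 173 , 179) ∷ (97 , 173 , 179 , 181) ∷
  (101 , 181 , 191 , 193) ∷ (105 , 193 , 197 , 199) ∷ (108 , 197 , 199 , 211) ∷ (111 , 197 , 199 , 211) ∷
  (113 , 199 , 211 , 223) ∷ (117 , 211 , 223 , 227) ∷ (122 , 227 , 229 , 233) ∷ (127 , 233 , 239 , 241) ∷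
  (132 , 239 , 241 , 251) ∷ (138 , 251 , 257 , 263) ∷ (145 , 269 , 271 , 277) ∷ (151 , 277 , 281 , 283) ∷
  (157 , 281 , 283 , 293) ∷ (165 , 307 , 311 , 313) ∷ (172 , 313 , 317 , 331) ∷ (179 , 317 , 331 , 337) ∷
  (188 , 349 , 353 , 359) ∷ (196 , 359 , 367 , 373) ∷ (205 , 379 , 383 , 389) ∷ (215 , 397 , 401 , 409) ∷
  (226 , 419 , 421 , 431) ∷ (237 , 439 , 443 , 449) ∷ (249 , 461 , 463 , 467) ∷ (261 , 487 , 491 , 499) ∷
  (273 , 509 , 521 , 523) ∷ (284 , 523 , 541 , 547) ∷ (298 , 557 , 563 , 569) ∷ (312 , 577 , 587 , 593) ∷
  (328 , 613 , 617 , 619) ∷ (346 , 643 , 647 , 653) ∷ (363 , 677 , 683 , 691) ∷ (381 , 709 , 719 , 727) ∷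
  (400 , 751 , 757 , 761) ∷ (420 , 773 , 787 , 797) ∷ (441 , 827 , 829 , 839) ∷ (462 , 877 , 881 , 883) ∷
  (485 , 907 , 911 , 919) ∷ (508 , 953 , 967 , 971) ∷ (534 , 997 , 1009 , 1013) ∷ (562 , 1061 , 1063 , 1069) ∷
  (591 , 1109 , 1117 , 1123) ∷ (619 , 1163 , 1171 , 1181) ∷ (649 , 1229 , 1231 , 1237) ∷ (681 , 1289 , 1291 , 1297) ∷
  (713 , 1321 , 1327 , 1361) ∷ (748 , 1409 , 1423 , 1427) ∷ (786 , 1487 , 1489 , 1493) ∷ (826 , 1559 , 1567 , 1571) ∷
  (866 , 1621 , 1627 , 1637) ∷ (910 , 1721 , 1723 , 1733) ∷ (954 , 1789 , 1801 , 1811) ∷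
  (1002 , 1889 , 1901 , 1907) ∷ (1051 , 1997 , 1999 , 2003) ∷ (1102 , 2087 , 2089 , 2099) ∷
  (1155 , 2161 , 2179 , 2203) ∷ (1213 , 2297 , 2309 , 2311) ∷ (1275 , 2411 , 2417 , 2423) ∷
  (1337 , 2543 , 2549 , 2551) ∷ (1406 , 2659 , 2663 , 2671) ∷ (1477 , 2797 , 2801 , 2803) ∷
  (1550 , 2927 , 2939 , 2953) ∷ (1623 , 3079 , 3083 , 3089) ∷ (1701 , 3217 , 3221 , 3229) ∷
  (1783 , 3373 , 3389 , 3391) ∷ (1871 , 3547 , 3557 , 3559) ∷ (1965 , 3727 , 3733 , 3739) ∷
  (2062 , 3923 , 3929 , 3931) ∷ (2161 , 4093 , 4099 , 4111) ∷ (2268 , 4283 , 4289 , 4297) ∷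
  (2379 , 4517 , 4519 , 4523) ∷ (2495 , 4733 , 4751 , 4759) ∷ (2619 , 4969 , 4973 , 4987) ∷
  (2745 , 5231 , 5233 , 5237) ∷ (2877 , 5477 , 5479 , 5483) ∷ (3017 , 5741 , 5743 , 5749) ∷
  (3166 , 6007 , 6011 , 6029) ∷ (3322 , 6317 , 6323 , 6329) ∷ (3484 , 6607 , 6619 , 6637) ∷
  (3652 , 6959 , 6961 , 6967) ∷ (3826 , 7253 , 7283 , 7297) ∷ (4009 , 7639 , 7643 , 7649) ∷
  (4202 , 8009 , 8011 , 8017) ∷ (4403 , 8377 , 8387 , 8389) ∷ (4614 , 8783 , 8803 , 8807) ∷
  (4834 , 9209 , 9221 , 9227) ∷ (5063 , 9643 , 9649 , 9661) ∷ (5305 , 10099 , 10103 , 10111) ∷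
  (5558 , 10597 , 10601 , 10607) ∷ (5821 , 11093 , 11113 , 11117) ∷ (6096 , 11617 , 11621 , 11633) ∷
  (6379 , 12157 , 12161 , 12163) ∷ (6680 , 12739 , 12743 , 12757) ∷ (6991 , 13331 , 13337 , 13339) ∷
  (7319 , 13933 , 13963 , 13967) ∷ (7663 , 14629 , 14633 , 14639) ∷ (8022 , 15307 , 15313 , 15319) ∷
  (8397 , 16001 , 16007 , 16033) ∷ (8788 , 16759 , 16763 , 16787) ∷ (9197 , 17551 , 17569 , 17573) ∷
  (9622 , 18367 , 18371 , 18379) ∷ (10067 , 19219 , 19231 , 19237) ∷ (10529 , 20117 , 20123 , 20129) ∷
  (11014 , 21023 , 21031 , 21059) ∷ (11522 , 22003 , 22013 , 22027) ∷ (12054 , 23029 , 23039 , 23041) ∷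
  (12607 , 24103 , 24107 , 24109) ∷ (13180 , 25171 , 25183 , 25189) ∷ (13780 , 26339 , 26347 , 26357) ∷
  (14413 , 27539 , 27541 , 27551) ∷ (15072 , 28807 , 28813 , 28817) ∷ (15752 , 30133 , 30137 , 30139) ∷
  (16383 , 31477 , 31481 , 31489) ∷ []

-- 21 is the number of primes below 74, the initial value of the running count.
primeBlocks-ok : checkPrimeBlocks 74 21 primeBlocks ≡ true
primeBlocks-ok = refl

half : ℕ → ℕ
half k = ⌊ pred k /2⌋

-- The terms with odd index are n − (2h+1), …, n − 1, where h = half k.
record OddBlockFor (k : ℕ) : Set where
  field
    A B : ℕ
    A≤k : A ≤ k
    k≤B : k ≤ B
    few : 2 ^ half B * half B ! < suc (A * A + A) ^ (half A ∸ suc (π̂ B))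

checkOddBlocks : ℕ → ℕ → List ℕ → Bool
checkOddBlocks A c [] = true
checkOddBlocks A c (B ∷ bs) =
  (A ≤ᵇ B) ∧ ((2 ^ half B * half B ! <ᵇ suc (A * A + A) ^ (half A ∸ suc c′)) ∧ checkOddBlocks (suc B) c′ bs)
  where c′ = cnt (suc B ∸ A) (λ i → candidate (A + i)) + c

lastOddOr : ℕ → List ℕ → ℕ
lastOddOr A [] = A
lastOddOr A (B ∷ bs) = lastOddOr (suc B) bs

checkOddBlocks-sound : ∀ A c bs → c ≡ cnt A candidate → checkOddBlocks A c bs ≡ true →
  ∀ k → A ≤ k → k < lastOddOr A bs → OddBlockFor k
checkOddBlocks-sound A c [] _ _ k A≤k k<A = ⊥-elim (<⇒≱ k<A A≤k)
checkOddBlocks-sound A c (B ∷ bs) c≡ e k A≤k k< with ∧-true {A ≤ᵇ B} e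
... | A≤B , e with ∧-true {2 ^ half B * half B ! <ᵇ suc (A * A + A) ^ (half A ∸ suc (cnt (suc B ∸ A) (λ i → candidate (A + i)) + c))} e
... | few , e with k ≤? B
...   | no k≰B = checkOddBlocks-sound (suc B) _ bs (π̂-extend c≡ (≤ᵇ-sound {A} A≤B)) e k (≰⇒> k≰B) k<
...   | yes k≤B = record
  { A = A ; B = B ; A≤k = A≤k ; k≤B = k≤B
  ; few = subst (λ z → 2 ^ half B * half B ! < suc (A * A + A) ^ (half A ∸ suc z))
            (π̂-extend c≡ (≤ᵇ-sound {A} A≤B)) (<ᵇ-sound few) }

oddBlocks : List ℕ
oddBlocks =
  74 ∷ 78 ∷ 82 ∷ 86 ∷ 92 ∷ 100 ∷ 106 ∷ 112 ∷ 124 ∷ 138 ∷ 156 ∷ 178 ∷ 202 ∷ 234 ∷ 274 ∷ 328 ∷ 396 ∷ 484 ∷ 600 ∷ 754 ∷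
  966 ∷ 1248 ∷ 1628 ∷ 2160 ∷ 2902 ∷ 3950 ∷ 5458 ∷ 7630 ∷ 10788 ∷ 15432 ∷ 16383 ∷ []

oddBlocks-ok : checkOddBlocks 74 21 oddBlocks ≡ true
oddBlocks-ok = refl

primeBlock : ∀ k → 74 ≤ k → k < 16384 → PrimeBlockFor k
primeBlock = checkPrimeBlocks-sound 74 21 primeBlocks refl primeBlocks-ok

oddBlock : ∀ k → 74 ≤ k → k < 16384 → OddBlockFor k
oddBlock = checkOddBlocks-sound 74 21 oddBlocks refl oddBlocks-ok

-- Smoothness tests and window scans for 13 ≤ k < 74

^-∣-cong : ∀ {a b} e → a ∣ b → a ^ e ∣ b ^ e
^-∣-cong zero _ = ∣-refl
^-∣-cong (suc e) a∣b = *-pres-∣ a∣b (^-∣-cong e a∣b)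

∣! : ∀ {k p} → 0 < p → p ≤ k → p ∣ k !
∣! {zero} (s≤s _) ()
∣! {suc k} {p} 0<p p≤k with m≤n⇒m<n∨m≡n p≤k
... | inj₁ p<k = ∣n⇒∣m*n (suc k) (∣! 0<p (≤-pred p<k))
... | inj₂ refl = m∣m*n (k !)

-- A prime p ≤ k divides k!, and p^ν ≤ x < 2^e forces ν < e, so (k!)^e absorbs every k-smooth x
-- below 2^e. Contrapositively, one division by a fixed number certifies a prime above `k` without
-- factoring x.
smooth-∣ : ∀ {k x e} → 0 < x → x < 2 ^ e → ¬ HasPrimeAbove k x → x ∣ (k !) ^ e
smooth-∣ {k} {x} {e} 0<x x<2^e ¬above = ν-≤⇒∣ {x} {(k !) ^ e} 0<x (^-pos (!-pos k) e) dom
  where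
  dom : ∀ {p} → Prime p → ν p x ≤ ν p ((k !) ^ e)
  dom {p} pp with p ∣? x
  ... | no ∤ = subst (_≤ ν p ((k !) ^ e)) (sym (ν-∤ ∤)) z≤n
  ... | yes p∣x with p ≤? k
  ...   | no p≰k = ⊥-elim (¬above (primeAbove 0<x pp (≰⇒> p≰k) p∣x))
  ...   | yes p≤k = ν-max pp (^-pos (!-pos k) e)
    (∣-trans (^-∣-cong (ν p x) (∣! (prime>0 pp) p≤k)) (^-∣-mono (k !) (<⇒≤ ν<e)))
    where
    ν<e : ν p x < e
    ν<e = ≰⇒> λ e≤ν → <-irrefl refl (<-≤-trans x<2^e (≤-trans (^-monoˡ-≤ e (prime>1 pp))
      (≤-trans (^-monoʳ-≤ p {{prime⇒nonZero pp}} e≤ν) (∣⇒≤′ 0<x (p^ν∣n p x)))))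

nonsmooth-sound : ∀ {k x e} → 0 < x → x < 2 ^ e → divides? x ((k !) ^ e) ≡ false → HasPrimeAbove k x
nonsmooth-sound {k} {x} {e} 0<x x< eq with hasPrimeAbove? k x
... | yes h = h
... | no ¬h with () ← trans (sym eq) (divides?-complete x ((k !) ^ e) 0<x (smooth-∣ {k} {x} {e} 0<x x< ¬h))

-- Number of terms left when the (c+1)-st non-divisor of M among x, x − D, x − 2D, … is met.
search : (M D : ℕ) → ℕ → ℕ → ℕ → ℕ
search M D zero x c = 0
search M D (suc f) x c with divides? x M
... | true = search M D f (x ∸ D) c
search M D (suc f) x zero | false = suc f
search M D (suc f) x (suc c) | false = search M D f (x ∸ D) c

-- Three hits for the window starting at hi serve all windows hi + D t, t ≤ r, so the scan jumps ahead.
scan : (M D s bound : ℕ) → ℕ → ℕ → Bool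
jump : (M D s bound : ℕ) → ℕ → ℕ → ℕ → Bool
scan M D s bound zero hi = false
scan M D s bound (suc fuel) hi = if bound ≤ᵇ hi then true else jump M D s bound fuel hi (search M D s hi 2)
jump M D s bound fuel hi zero = false
jump M D s bound fuel hi (suc r) = scan M D s bound fuel (hi + D * suc r)

cube : ℕ → ℕ
cube k = k * (k * k)

-- The first scan covers n < (k+1)². Odd l give the terms n - 1, n - 3, ..., so from (k+1)² on the
-- top of the window is n - 1, moved in steps of 2, with one scan for each parity of n.
checkWindows : ℕ → ℕ → Bool
checkWindows k M = scan M 1 (suc k) (suc k * suc k) 100000 (2 * k)
  ∧ (scan M 2 (suc (half k)) (cube (suc k)) 100000 (pred (suc k * suc k)) ∧ scan M 2 (suc (half k)) (cube (suc k)) 100000 (suc k * suc k))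

checkAllWindows : ℕ → ℕ → Bool
checkAllWindows zero k = true
checkAllWindows (suc j) k = checkWindows k ((k !) ^ 19) ∧ checkAllWindows j (suc k)

-- These are the 61 values 13 ≤ k < 74; the exponent 19 is admissible because (k+1)³ ≤ 74³ < 2^19.
allWindows-ok : checkAllWindows 61 13 ≡ true
allWindows-ok = refl

search-next : ∀ M D f x c {r} → search M D f x (suc c) ≡ suc r →
  ∃₂ λ i f′ → i + suc f′ ≡ f × divides? (x ∸ D * i) M ≡ false × search M D f′ (x ∸ D * suc i) c ≡ suc r
search-next M D (suc f) x c {r} e with divides? x M in eq
... | false = 0 , f , refl , subst (λ z → divides? (x ∸ z) M ≡ false) (sym (*-zeroʳ D)) eq ,
  subst (λ z → search M D f (x ∸ z) c ≡ _) (sym (*-identityʳ D)) e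
... | true with search-next M D f (x ∸ D) c e
...   | i , f′ , refl , here′ , rest = suc i , f′ , refl ,
  subst (λ z → divides? z M ≡ false) (shift i) here′ , subst (λ z → search M D f′ z c ≡ suc r) (shift (suc i)) rest
  where
  shift : ∀ i → x ∸ D ∸ D * i ≡ x ∸ D * suc i
  shift i = trans (∸-+-assoc x D (D * i)) (cong (x ∸_) (sym (*-suc D i)))

search-last : ∀ M D f x {r} → search M D f x 0 ≡ suc r → ∃ λ i → i + suc r ≡ f × divides? (x ∸ D * i) M ≡ false
search-last M D (suc f) x e with divides? x M in eq
search-last M D (suc f) x refl | false = 0 , refl , subst (λ z → divides? (x ∸ z) M ≡ false) (sym (*-zeroʳ D)) eq
... | true with search-last M D f (x ∸ D) e
...   | i , refl , here′ = suc i , refl ,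
  subst (λ z → divides? z M ≡ false) (trans (∸-+-assoc x D (D * i)) (cong (x ∸_) (sym (*-suc D i)))) here′

-- The slack `r` in `i + r < s` is how far the window may slide upwards before the third hit leaves
-- it.
search-three : ∀ M D s x {r} → search M D s x 2 ≡ suc r → Three (λ i → i + r < s × divides? (x ∸ D * i) M ≡ false)
search-three M D s x {r} e with search-next M D s x 1 e
... | i₁ , f₁ , refl , n₁ , e₁ with search-next M D f₁ (x ∸ D * suc i₁) 0 e₁
...   | i₂ , f₂ , refl , n₂ , e₂ with search-last M D f₂ (x ∸ D * suc i₁ ∸ D * suc i₂) e₂
...     | i₃ , refl , n₃ = three {l₁ = i₁} {suc i₁ + i₂} {suc i₁ + (suc i₂ + i₃)}
  (s≤s (m≤m+n i₁ i₂)) (+-monoʳ-< (suc i₁) (s≤s (m≤m+n i₂ i₃)))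
  (+-monoʳ-< i₁ (s≤s (≤-trans (m≤n+m r i₃) (≤-trans (+-monoʳ-≤ i₃ (n≤1+n r)) (≤-trans (n≤1+n (i₃ + suc r)) (m≤n+m (suc (i₃ + suc r)) i₂))))) , n₁)
  (≤-trans (≤-reflexive (cong suc (+-assoc (suc i₁) i₂ r))) (≤-trans (≤-reflexive (sym (+-suc (suc i₁) (i₂ + r))))
    (≤-trans (+-monoʳ-≤ (suc i₁) (≤-trans (≤-reflexive (sym (+-suc i₂ r))) (+-monoʳ-≤ i₂ (≤-trans (s≤s (≤-trans (m≤n+m r i₃) (+-monoʳ-≤ i₃ (n≤1+n r)))) ≤-refl))))
      (≤-reflexive (sym (+-suc i₁ (i₂ + suc (i₃ + suc r))))))) , subst (λ z → divides? z M ≡ false) (merge x i₁ i₂) n₂)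
  (≤-reflexive (regroup i₁ i₂ i₃ r) , subst (λ z → divides? z M ≡ false)
    (trans (cong (_∸ D * i₃) (merge x i₁ (suc i₂))) (trans (∸-+-assoc x (D * (suc i₁ + suc i₂)) (D * i₃))
      (cong (x ∸_) (trans (sym (*-distribˡ-+ D (suc i₁ + suc i₂) i₃)) (cong (D *_) (+-assoc (suc i₁) (suc i₂) i₃)))))) n₃)
  where
  merge : ∀ x i j → x ∸ D * suc i ∸ D * j ≡ x ∸ D * (suc i + j)
  merge x i j = trans (∸-+-assoc x (D * suc i) (D * j)) (cong (x ∸_) (sym (*-distribˡ-+ D (suc i) j)))
  regroup : ∀ a b c r → suc (suc a + (suc b + c) + r) ≡ a + suc (b + suc (c + suc r))
  regroup = solve-∀

mapThree : ∀ {Q R : ℕ → Set} (f : ℕ → ℕ) → (∀ {i j} → Q i → Q j → i < j → f i < f j) → (∀ {i} → Q i → R (f i)) →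
  Three Q → Three R
mapThree f mono g (three l₁<l₂ l₂<l₃ q₁ q₂ q₃) = three (mono q₁ q₂ l₁<l₂) (mono q₂ q₃ l₂<l₃) (g q₁) (g q₂) (g q₃)

flipThree : ∀ {Q R : ℕ → Set} (f : ℕ → ℕ) → (∀ {i j} → Q i → Q j → i < j → f j < f i) → (∀ {i} → Q i → R (f i)) →
  Three Q → Three R
flipThree f anti g (three l₁<l₂ l₂<l₃ q₁ q₂ q₃) = three (anti q₂ q₃ l₂<l₃) (anti q₁ q₂ l₁<l₂) (g q₃) (g q₂) (g q₁)

scan-sound : ∀ M D s bound fuel hi → scan M D s bound fuel hi ≡ true → ∀ t → hi + D * t < bound →
  Three (λ i → i < s × divides? (hi + D * t ∸ D * i) M ≡ false)
scan-sound M D s bound (suc fuel) hi e t t< with bound ≤ᵇ hi in eq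
... | true = ⊥-elim (<⇒≱ t< (≤-trans (≤ᵇ-sound eq) (m≤m+n hi (D * t))))
... | false with search M D s hi 2 in found
...   | suc r with t ≤? r
-- The window with top hi + D t contains the same numbers at indices larger by t.
...     | yes t≤r = mapThree (_+ t) (λ _ _ → +-monoˡ-< t)
  (λ { {i} (i< , n) → ≤-<-trans (+-monoʳ-≤ i t≤r) i< ,
     subst (λ z → divides? z M ≡ false) (sym (slide i)) n }) (search-three M D s hi found)
  where
  slide : ∀ i → hi + D * t ∸ D * (i + t) ≡ hi ∸ D * i
  slide i = trans (cong (hi + D * t ∸_) (*-distribˡ-+ D i t)) ([m+n]∸[o+n]≡m∸o hi (D * t) (D * i))
    where
    [m+n]∸[o+n]≡m∸o : ∀ m n o → m + n ∸ (o + n) ≡ m ∸ o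
    [m+n]∸[o+n]≡m∸o m n o = trans (cong₂ _∸_ (+-comm m n) (+-comm o n)) ([m+n]∸[m+o]≡n∸o n m o)
...     | no t≰r = subst (λ z → Three (λ i → i < s × divides? (z ∸ D * i) M ≡ false)) same
  (scan-sound M D s bound fuel (hi + D * suc r) e (t ∸ suc r) (subst (_< bound) (sym same) t<))
  where
  same : hi + D * suc r + D * (t ∸ suc r) ≡ hi + D * t
  same = trans (+-assoc hi _ _) (cong (hi +_) (trans (sym (*-distribˡ-+ D (suc r) (t ∸ suc r)))
    (cong (D *_) (m+[n∸m]≡n (≰⇒> t≰r)))))

Odd : ℕ → Set
Odd l = ∃ λ i → l ≡ suc (2 * i)

Window : ℕ → ℕ → Set
Window k n = Three (λ l → l ≤ k × HasPrimeAbove k (n ∸ l))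

OddWindow : ℕ → ℕ → Set
OddWindow k n = Three (λ l → l ≤ k × Odd l × HasPrimeAbove k (n ∸ l))

odd≤ : ∀ {k} → 0 < k → suc (2 * half k) ≤ k
odd≤ {suc k} _ = s≤s (≤-trans (≤-reflexive (cong (⌊ k /2⌋ +_) (+-identityʳ _)))
  (≤-trans (+-monoʳ-≤ ⌊ k /2⌋ (⌊n/2⌋≤⌈n/2⌉ k)) (≤-reflexive (⌊n/2⌋+⌈n/2⌉≡n k))))

checkWindows-sound : ∀ k e → 0 < k → cube (suc k) ≤ 2 ^ e → checkWindows k ((k !) ^ e) ≡ true →
  (∀ n → 2 * k ≤ n → n < suc k * suc k → Window k n) ×
  (∀ n → suc k * suc k ≤ n → n < cube (suc k) → OddWindow k n)
checkWindows-sound k e 0<k small ok with ∧-true ok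
... | ok₁ , ok′ with ∧-true ok′
...   | ok₂ , ok₃ = low , odd
  where
  M = (k !) ^ e
  square≤cube : suc k * suc k ≤ cube (suc k)
  square≤cube = m≤n*m (suc k * suc k) (suc k)
  witness : ∀ n l → l ≤ k → k < n → n < cube (suc k) → divides? (n ∸ l) M ≡ false → HasPrimeAbove k (n ∸ l)
  witness n l l≤k k<n n< eq =
    nonsmooth-sound {e = e} (m<n⇒0<n∸m (≤-<-trans l≤k k<n)) (<-≤-trans (≤-<-trans (m∸n≤m n l) n<) small) eq
  low : ∀ n → 2 * k ≤ n → n < suc k * suc k → Window k n
  low n 2k≤n n< = mapThree id (λ _ _ → id)
    (λ { {i} (i< , eq) → ≤-pred i< , witness n i (≤-pred i<) k<n (<-≤-trans n< square≤cube)
       (subst (λ z → divides? z M ≡ false) (cong₂ _∸_ n≡ (*-identityˡ i)) eq) })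
    (scan-sound M 1 (suc k) (suc k * suc k) 100000 (2 * k) ok₁ (n ∸ 2 * k) (subst (_< _) (sym n≡) n<))
    where
    n≡ : 2 * k + 1 * (n ∸ 2 * k) ≡ n
    n≡ = trans (cong (2 * k +_) (*-identityˡ _)) (m+[n∸m]≡n 2k≤n)
    k<n : k < n
    k<n = <-≤-trans (m<m+n k (≤-trans 0<k (≤-reflexive (sym (+-identityʳ k))))) 2k≤n
  odd : ∀ n → suc k * suc k ≤ n → n < cube (suc k) → OddWindow k n
  odd n ≤n n< = [ (λ e → go {pred (suc k * suc k)} (proj₁ e) ok₂ (proj₂ e)) , (λ e → go {suc k * suc k} (proj₁ e) ok₃ (proj₂ e)) ]′ cases
    where
    k<n : k < n
    k<n = ≤-trans (m≤m*n (suc k) (suc k)) ≤n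
    go : ∀ {hi} t → scan M 2 (suc (half k)) (cube (suc k)) 100000 hi ≡ true → n ≡ suc (hi + 2 * t) → OddWindow k n
    go {hi} t ok n≡ = mapThree (λ i → suc (2 * i)) (λ _ _ i<j → s≤s (*-monoʳ-< 2 i<j))
      (λ { {i} (i< , eq) → l≤k i< , (i , refl) , witness n (suc (2 * i)) (l≤k i<) k<n n<
         (subst (λ z → divides? z M ≡ false) (sym (cong (_∸ suc (2 * i)) n≡)) eq) })
      (scan-sound M 2 (suc (half k)) (cube (suc k)) 100000 hi ok t (<-trans ≤-refl (subst (_< cube (suc k)) n≡ n<)))
      where
      l≤k : ∀ {i} → i < suc (half k) → suc (2 * i) ≤ k
      l≤k i< = ≤-trans (s≤s (*-monoʳ-≤ 2 (≤-pred i<))) (odd≤ 0<k)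
    cases : (∃ λ t → n ≡ suc (pred (suc k * suc k) + 2 * t)) ⊎ (∃ λ t → n ≡ suc (suc k * suc k + 2 * t))
    cases with halve (n ∸ suc k * suc k) | m+[n∸m]≡n ≤n
    ... | t , inj₁ eq | n≡ = inj₁ (t , trans (sym n≡) (cong (suc k * suc k +_) eq))
    ... | t , inj₂ eq | n≡ = inj₂ (t , trans (sym n≡) (trans (cong (suc k * suc k +_) eq) (+-suc (suc k * suc k) (2 * t))))

checkAllWindows-sound : ∀ j k → checkAllWindows j k ≡ true → ∀ i → i < j → checkWindows (k + i) (((k + i) !) ^ 19) ≡ true
checkAllWindows-sound (suc j) k ok zero _ = subst (λ z → checkWindows z ((z !) ^ 19) ≡ true) (sym (+-identityʳ k))
  (proj₁ (∧-true ok))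
checkAllWindows-sound (suc j) k ok (suc i) i<j = subst (λ z → checkWindows z ((z !) ^ 19) ≡ true) (sym (+-suc k i))
  (checkAllWindows-sound j (suc k) (proj₂ (∧-true {checkWindows k ((k !) ^ 19)} ok)) i (≤-pred i<j))

smallWindows : ∀ k → 13 ≤ k → k < 74 →
  (∀ n → 2 * k ≤ n → n < suc k * suc k → Window k n) ×
  (∀ n → suc k * suc k ≤ n → n < cube (suc k) → OddWindow k n)
smallWindows k 13≤k k<74 = checkWindows-sound k 19 (≤-trans (s≤s z≤n) 13≤k) bound
  (subst (λ z → checkWindows z ((z !) ^ 19) ≡ true) (m+[n∸m]≡n 13≤k)
    (checkAllWindows-sound 61 13 allWindows-ok (k ∸ 13) (∸-monoˡ-< k<74 13≤k)))
  where
  bound : cube (suc k) ≤ 2 ^ 19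
  bound = ≤-trans (*-mono-≤ k<74 (*-mono-≤ k<74 k<74)) (≤ᵇ-sound {405224} {524288} refl)

-- Windows from the excised product

-- Of the s + 1 terms at most 2 + len are dropped, which leaves s - (len + 1). This is the origin of
-- the exponents `A ∸ suc (π̂ B)` and `half A ∸ suc (π̂ B)` in the tables.
lower-cancel : ∀ {b Y} s len → 0 < b → 0 < Y → b ^ suc s ≤ b ^ (2 + len) * Y → b ^ (s ∸ suc len) ≤ Y
lower-cancel {b} {Y} s len 0<b 0<Y h with suc len ≤? s
... | no ≰ = subst (λ z → b ^ z ≤ Y) (sym (m≤n⇒m∸n≡0 (<⇒≤ (≰⇒> ≰)))) 0<Y
... | yes ≤s = *-cancelˡ-≤ (b ^ (2 + len)) {{>-nonZero (^-pos 0<b (2 + len))}}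
  (≤-trans (≤-reflexive (trans (sym (^-distribˡ-+-* b (2 + len) (s ∸ suc len))) (cong (λ z → b ^ suc z) (m+[n∸m]≡n ≤s)))) h)

-- The progression ascends from n - s while windows are indexed by l in n - l, hence the flip. The
-- tables take s = k, the estimates for large k take s = k - 1.
excise-window : ∀ k n s ps → s ≤ k → k < n → Window k n ⊎ Excised k (n ∸ s) 1 s ps
excise-window k n s ps s≤k k<n = map₁ convert (excise k (n ∸ s) 1 s ps (m<n⇒0<n∸m (≤-<-trans s≤k k<n)) (s≤s z≤n))
  where
  term : ∀ {i} → i ≤ s → ap (n ∸ s) 1 i ≡ n ∸ (s ∸ i)
  term {i} i≤s = trans (cong (n ∸ s +_) (*-identityˡ i)) (trans (cong (λ z → n ∸ z + i) (sym (m∸n+n≡m i≤s)))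
    (trans (cong (_+ i) (sym (∸-+-assoc n (s ∸ i) i)))
      (m∸n+n≡m (m+n≤o⇒m≤o∸n i (≤-trans (≤-reflexive (m+[n∸m]≡n i≤s)) (≤-trans s≤k (<⇒≤ k<n)))))))
  convert : Three (λ i → i ≤ s × HasPrimeAbove k (ap (n ∸ s) 1 i)) → Window k n
  convert = flipThree (s ∸_) (λ _ q i<j → ∸-monoʳ-< i<j (proj₁ q))
    (λ { {i} (i≤s , h) → ≤-trans (m∸n≤m s i) s≤k , subst (HasPrimeAbove k) (term i≤s) h })

excise-oddWindow : ∀ k n ps → 0 < k → k < n → OddWindow k n ⊎ Excised k (n ∸ suc (2 * half k)) 2 (half k) ps
excise-oddWindow k n ps 0<k k<n = map₁ convert
  (excise k (n ∸ suc (2 * half k)) 2 (half k) ps (m<n⇒0<n∸m (≤-<-trans (odd≤ 0<k) k<n)) (s≤s z≤n))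
  where
  h = half k
  term : ∀ {i} → i ≤ h → ap (n ∸ suc (2 * h)) 2 i ≡ n ∸ suc (2 * (h ∸ i))
  term {i} i≤h = trans (cong (λ z → n ∸ z + 2 * i) split) (trans (cong (_+ 2 * i) (sym (∸-+-assoc n (suc (2 * (h ∸ i))) (2 * i))))
    (m∸n+n≡m (m+n≤o⇒m≤o∸n (2 * i) (≤-trans (≤-reflexive (trans (+-comm (2 * i) _) (sym split)))
      (≤-trans (odd≤ 0<k) (<⇒≤ k<n))))))
    where
    split : suc (2 * h) ≡ suc (2 * (h ∸ i)) + 2 * i
    split = cong suc (trans (cong (2 *_) (sym (m∸n+n≡m i≤h))) (*-distribˡ-+ 2 (h ∸ i) i))
  convert : Three (λ i → i ≤ h × HasPrimeAbove k (ap (n ∸ suc (2 * h)) 2 i)) → OddWindow k n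
  convert = flipThree (λ i → suc (2 * (h ∸ i))) (λ _ q i<j → s≤s (*-monoʳ-< 2 (∸-monoʳ-< i<j (proj₁ q))))
    (λ { {i} (i≤h , r) → ≤-trans (s≤s (*-monoʳ-≤ 2 (m∸n≤m h i))) (odd≤ 0<k) , (h ∸ i , refl) ,
         subst (HasPrimeAbove k) (term i≤h) r })

!-mono : ∀ {m n} → m ≤ n → m ! ≤ n !
!-mono {m} {n} m≤n = ∣⇒≤′ (!-pos n) (m≤n⇒m!∣n! m≤n)

cnt-mono : ∀ {a b} f → a ≤ b → cnt a f ≤ cnt b f
cnt-mono {a} {b} f a≤b = subst (λ z → cnt a f ≤ cnt z f) (m+[n∸m]≡n a≤b)
  (subst (cnt a f ≤_) (sym (cnt-+ a (b ∸ a) f)) (m≤n+m (cnt a f) _))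

candidates-length : ∀ {k B} → k ≤ B → length (candidates k) ≤ π̂ B
candidates-length {k} k≤B = subst (_≤ _) (sym (length-sieve candidate (suc k))) (cnt-mono candidate (s≤s k≤B))

block-window : ∀ {k n} → PrimeBlockFor k → 0 < k → 2 * k ≤ n → Window k n
block-window {k} {n} bl 0<k 2k≤n = [ id , (λ E → [ id , (λ h → ⊥-elim (counting E h)) ]′ direct) ]′
    (excise-window k n k (candidates k) ≤-refl k<n)
  where
  open PrimeBlockFor bl
  k≤n∸k : k ≤ n ∸ k
  k≤n∸k = m+n≤o⇒m≤o∸n k (≤-trans (≤-reflexive (cong (k +_) (sym (+-identityʳ k)))) 2k≤n)
  k<n : k < n
  k<n = <-≤-trans (m<m+n k 0<k) (≤-trans (≤-reflexive (cong (k +_) (sym (+-identityʳ k)))) 2k≤n)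
  direct : Window k n ⊎ (q₁ ≤ n ∸ k)
  direct with q₁ ≤? n ∸ k
  ... | yes q₁≤ = inj₂ q₁≤
  ... | no q₁≰ = inj₁ (three (∸-monoʳ-< q₂<q₃ (q≤n ≤-refl)) (∸-monoʳ-< q₁<q₂ (q≤n (<⇒≤ q₂<q₃)))
      (entry (≰⇒≥ q₁≰′₃) (q≤n ≤-refl) (<-trans b<q₁ q₁<q₃) pq₃)
      (entry (≰⇒≥ q₁≰′₂) (q≤n (<⇒≤ q₂<q₃)) (<-trans b<q₁ q₁<q₂) pq₂)
      (entry (<⇒≤ b<q₁) (q≤n (<⇒≤ q₁<q₃)) b<q₁ pq₁))
    where
    b<q₁ : n ∸ k < q₁
    b<q₁ = ≰⇒> q₁≰
    q₁<q₃ = <-trans q₁<q₂ q₂<q₃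
    q₁≰′₃ : ¬ q₃ ≤ n ∸ k
    q₁≰′₃ h = q₁≰ (≤-trans (<⇒≤ q₁<q₃) h)
    q₁≰′₂ : ¬ q₂ ≤ n ∸ k
    q₁≰′₂ h = q₁≰ (≤-trans (<⇒≤ q₁<q₂) h)
    q≤n : ∀ {q} → q ≤ q₃ → q ≤ n
    q≤n q≤ = ≤-trans q≤ (≤-trans q₃≤2A (≤-trans (*-monoʳ-≤ 2 A≤k) 2k≤n))
    entry : ∀ {q} → n ∸ k ≤ q → q ≤ n → n ∸ k < q → Prime q → n ∸ q ≤ k × HasPrimeAbove k (n ∸ (n ∸ q))
    entry {q} b≤q q≤n b<q pq = m≤n+o⇒m∸n≤o n q (≤-trans (m≤n+m∸n n k) (≤-trans (+-monoʳ-≤ k b≤q) (≤-reflexive (+-comm k q)))) ,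
      subst (HasPrimeAbove k) (sym (m∸[m∸n]≡n q≤n)) (primeAbove (prime>0 pq) pq (≤-<-trans k≤n∸k b<q) ∣-refl)
  counting : Excised k (n ∸ k) 1 k (candidates k) → ¬ q₁ ≤ n ∸ k
  counting E q₁≤ = <⇒≱ few (begin
    q₁ ^ (A ∸ suc (π̂ B))                          ≤⟨ ^-monoˡ-≤ (A ∸ suc (π̂ B)) q₁≤ ⟩
    (n ∸ k) ^ (A ∸ suc (π̂ B))                     ≤⟨ ^-monoʳ-≤ (n ∸ k) {{>-nonZero 0<b}}
                                                       (∸-mono A≤k (s≤s (candidates-length k≤B))) ⟩
    (n ∸ k) ^ (k ∸ suc (length (candidates k)))   ≤⟨ lower-cancel k _ 0<b Y>0 lower ⟩
    Y                                             ≤⟨ ∣⇒≤′ (*-pos (^-pos (s≤s z≤n) k) (!-pos k))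
                                                       (excised-∣ (s≤s z≤n) ∈-candidates E) ⟩
    1 ^ k * k !                                   ≡⟨ trans (cong (_* k !) (^-zeroˡ k)) (*-identityˡ (k !)) ⟩
    k !                                           ≤⟨ !-mono k≤B ⟩
    B !                                           ∎)
    where
    open ≤-Reasoning
    open Excised E
    0<b : 0 < n ∸ k
    0<b = ≤-trans 0<k k≤n∸k

half-mono : ∀ {a b} → a ≤ b → half a ≤ half b
half-mono a≤b = ⌊n/2⌋-mono (pred-mono-≤ a≤b)

block-oddWindow : ∀ {k n} → OddBlockFor k → 0 < k → suc k * suc k ≤ n → OddWindow k n
block-oddWindow {k} {n} bl 0<k ≤n = [ id , (λ E → ⊥-elim (counting E)) ]′ (excise-oddWindow k n (candidates k) 0<k k<n)
  where
  open OddBlockFor bl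
  h = half k
  k<n : k < n
  k<n = ≤-trans (m≤m*n (suc k) (suc k)) ≤n
  b = n ∸ suc (2 * h)
  -- The smallest term is n - (2h + 1) ≥ (k+1)² - k = k² + k + 1.
  b≥ : suc (A * A + A) ≤ b
  b≥ = ≤-trans (s≤s (+-mono-≤ (*-mono-≤ A≤k A≤k) A≤k))
    (m+n≤o⇒m≤o∸n (suc (k * k + k)) (≤-trans (+-monoʳ-≤ (suc (k * k + k)) (odd≤ 0<k)) (≤-trans (≤-reflexive (square k)) ≤n)))
    where square : ∀ k → suc (k * k + k) + k ≡ suc k * suc k
          square = solve-∀
  counting : ¬ Excised k b 2 h (candidates k)
  counting E = <⇒≱ few (begin
    suc (A * A + A) ^ (half A ∸ suc (π̂ B))     ≤⟨ ^-monoˡ-≤ (half A ∸ suc (π̂ B)) b≥ ⟩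
    b ^ (half A ∸ suc (π̂ B))                   ≤⟨ ^-monoʳ-≤ b {{>-nonZero 0<b}}
                                                    (∸-mono (half-mono A≤k) (s≤s (candidates-length k≤B))) ⟩
    b ^ (h ∸ suc (length (candidates k)))      ≤⟨ lower-cancel h _ 0<b Y>0 lower ⟩
    Y                                          ≤⟨ ∣⇒≤′ (*-pos (^-pos (s≤s z≤n) h) (!-pos h))
                                                    (excised-∣ (s≤s z≤n) ∈-candidates E) ⟩
    2 ^ h * h !                                ≤⟨ *-mono-≤ (^-monoʳ-≤ 2 (half-mono k≤B)) (!-mono (half-mono k≤B)) ⟩
    2 ^ half B * half B !                      ∎)
    where
    open ≤-Reasoning
    open Excised E
    0<b : 0 < b
    0<b = ≤-trans (s≤s z≤n) b≥

-- Estimates for k ≥ 16384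

^-distrib-* : ∀ a b n → (a * b) ^ n ≡ a ^ n * b ^ n
^-distrib-* a b zero = refl
^-distrib-* a b (suc n) = trans (cong (a * b *_) (^-distrib-* a b n)) (swap a b (a ^ n) (b ^ n))
  where swap : ∀ a b c d → (a * b) * (c * d) ≡ (a * c) * (b * d)
        swap = solve-∀

^-cancelʳ-≤ : ∀ {b x y} → 1 < b → b ^ x ≤ b ^ y → x ≤ y
^-cancelʳ-≤ {b} 1<b h = ≮⇒≥ λ y<x → <⇒≱ (^-monoʳ-< b 1<b y<x) h

swap-* : ∀ a b c → a * (b * c) ≡ b * (a * c)
swap-* = solve-∀

-- This is (u+1)⋯(u+k) = k!·binom(u+k, k), so bounds on binomial coefficients can be stated without
-- division.
rising : ℕ → ℕ → ℕ
rising k u = ∏ k (λ i → suc (u + i))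

rising-pos : ∀ k u → 0 < rising k u
rising-pos k u = ∏-pos k (λ _ _ → s≤s z≤n)

rising-mono : ∀ k {u v} → u ≤ v → rising k u ≤ rising k v
rising-mono k u≤v = ∏-mono-≤ k (λ i _ → s≤s (+-monoˡ-≤ i u≤v))

rising-suc : ∀ k u → suc u * rising k (suc u) ≡ rising k u * suc (u + k)
rising-suc k u = sym (trans (∏-front k (λ i → suc (u + i)))
  (cong₂ _*_ (cong suc (+-identityʳ u)) (∏-cong k (λ i _ → cong suc (+-suc u i)))))

-- This is (n/k)^k ≤ binom(n, k) with denominators cleared; it holds factor by factor, as n i ≤ k (n
-- - k + i) for 1 ≤ i ≤ k.
rising-ratio : ∀ k n → k ≤ n → k ! * n ^ k ≤ k ^ k * rising k (n ∸ k)
rising-ratio k n k≤n = begin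
  k ! * n ^ k                            ≡⟨ trans (*-comm (k !) (n ^ k)) (cong (n ^ k *_) (!-∏ k)) ⟩
  n ^ k * ∏ k suc                        ≡⟨ ∏-scale k n ⟨
  ∏ k (λ i → n * suc i)                  ≤⟨ ∏-mono-≤ k term ⟩
  ∏ k (λ i → k * suc (n ∸ k + i))        ≡⟨ ∏-scale k k ⟩
  k ^ k * rising k (n ∸ k)               ∎
  where
  open ≤-Reasoning
  term : ∀ i → i < k → n * suc i ≤ k * suc (n ∸ k + i)
  term i i<k = begin
    n * suc i                          ≡⟨ cong (_* suc i) (m∸n+n≡m k≤n) ⟨
    (n ∸ k + k) * suc i                ≡⟨ *-distribʳ-+ (suc i) (n ∸ k) k ⟩
    (n ∸ k) * suc i + k * suc i        ≤⟨ +-monoˡ-≤ (k * suc i) (*-monoʳ-≤ (n ∸ k) i<k) ⟩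
    (n ∸ k) * k + k * suc i            ≡⟨ cong (_+ k * suc i) (*-comm (n ∸ k) k) ⟩
    k * (n ∸ k) + k * suc i            ≡⟨ *-distribˡ-+ k (n ∸ k) (suc i) ⟨
    k * (n ∸ k + suc i)                ≡⟨ cong (k *_) (+-suc (n ∸ k) i) ⟩
    k * suc (n ∸ k + i)                ∎

-- The ratio of the two products is (u+1+k)/(u+1).
rising-grow : ∀ k u → 2 * suc u ≤ 3 * k → 5 * rising k u ≤ 3 * rising k (suc u)
rising-grow k u h = *-cancelˡ-≤ (suc u) (begin
  suc u * (5 * R)                       ≡⟨ shuffle (suc u) R ⟩
  (3 * suc u + 2 * suc u) * R           ≤⟨ *-monoˡ-≤ R (+-monoʳ-≤ (3 * suc u) h) ⟩
  (3 * suc u + 3 * k) * R               ≡⟨ shuffle′ u k R ⟩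
  3 * (R * suc (u + k))                 ≡⟨ cong (3 *_) (rising-suc k u) ⟨
  3 * (suc u * rising k (suc u))        ≡⟨ swap-* 3 (suc u) (rising k (suc u)) ⟩
  suc u * (3 * rising k (suc u))        ∎)
  where
  open ≤-Reasoning
  R = rising k u
  shuffle : ∀ a R → a * (5 * R) ≡ (3 * a + 2 * a) * R
  shuffle = solve-∀
  shuffle′ : ∀ u k R → (3 * suc u + 3 * k) * R ≡ 3 * (R * suc (u + k))
  shuffle′ = solve-∀

-- The condition 2j ≤ k keeps all intermediate u + 1 at or below 3k/2, where a step still gains the
-- factor 5/3.
rising-grow* : ∀ k j → 2 * j ≤ k → 5 ^ j * rising k k ≤ 3 ^ j * rising k (k + j)
rising-grow* k zero _ = ≤-reflexive (cong (λ z → 1 * rising k z) (sym (+-identityʳ k)))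
rising-grow* k (suc j) h = begin
  5 * 5 ^ j * rising k k                 ≡⟨ *-assoc 5 (5 ^ j) _ ⟩
  5 * (5 ^ j * rising k k)               ≤⟨ *-monoʳ-≤ 5 (rising-grow* k j (≤-trans (*-monoʳ-≤ 2 (n≤1+n j)) h)) ⟩
  5 * (3 ^ j * rising k (k + j))         ≡⟨ swap-* 5 (3 ^ j) _ ⟩
  3 ^ j * (5 * rising k (k + j))         ≤⟨ *-monoʳ-≤ (3 ^ j) (rising-grow k (k + j) range) ⟩
  3 ^ j * (3 * rising k (suc (k + j)))   ≡⟨ trans (swap-* (3 ^ j) 3 _) (sym (*-assoc 3 (3 ^ j) _)) ⟩
  3 * 3 ^ j * rising k (suc (k + j))     ≡⟨ cong (λ z → 3 * 3 ^ j * rising k z) (+-suc k j) ⟨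
  3 * 3 ^ j * rising k (k + suc j)       ∎
  where
  open ≤-Reasoning
  range : 2 * suc (k + j) ≤ 3 * k
  range = begin
    2 * suc (k + j)       ≡⟨ cong (2 *_) (+-suc k j) ⟨
    2 * (k + suc j)       ≡⟨ *-distribˡ-+ 2 k (suc j) ⟩
    2 * k + 2 * suc j     ≤⟨ +-monoʳ-≤ (2 * k) h ⟩
    2 * k + k             ≡⟨ +-comm (2 * k) k ⟩
    3 * k                 ∎

-- 4 · 3³ ≤ 5³
rising-cube : ∀ k j → 2 * j ≤ k → 4 ^ j * rising k k ^ 3 ≤ rising k (k + j) ^ 3
rising-cube k j h = *-cancelˡ-≤ (27 ^ j) {{>-nonZero (^-pos (s≤s z≤n) j)}} (begin
  27 ^ j * (4 ^ j * P ^ 3)        ≡⟨ *-assoc (27 ^ j) (4 ^ j) _ ⟨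
  27 ^ j * 4 ^ j * P ^ 3          ≡⟨ cong (_* P ^ 3) (^-distrib-* 27 4 j) ⟨
  108 ^ j * P ^ 3                 ≤⟨ *-monoˡ-≤ (P ^ 3) (^-monoˡ-≤ j (≤ᵇ-sound {108} {125} refl)) ⟩
  125 ^ j * P ^ 3                 ≡⟨ cong (_* P ^ 3) (power 5) ⟩
  (5 ^ j) ^ 3 * P ^ 3             ≡⟨ ^-distrib-* (5 ^ j) P 3 ⟨
  (5 ^ j * P) ^ 3                 ≤⟨ ^-monoˡ-≤ 3 (rising-grow* k j h) ⟩
  (3 ^ j * P′) ^ 3                ≡⟨ ^-distrib-* (3 ^ j) P′ 3 ⟩
  (3 ^ j) ^ 3 * P′ ^ 3            ≡⟨ cong (_* P′ ^ 3) (power 3) ⟨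
  27 ^ j * P′ ^ 3                 ∎)
  where
  open ≤-Reasoning
  P = rising k k
  P′ = rising k (k + j)
  power : ∀ a → (a ^ 3) ^ j ≡ (a ^ j) ^ 3
  power a = trans (^-*-assoc a 3 j) (trans (cong (a ^_) (*-comm 3 j)) (sym (^-*-assoc a j 3)))

-- For m = k + 1 this is 4^m ≤ 2m·binom(2m, m), denominators cleared; the induction step loses only
-- 2m ≤ 2m + 1.
central-lower : ∀ k → 4 ^ suc k * (suc k ! * suc k !) ≤ 2 * suc k * (suc k + suc k) !
central-lower zero = ≤-refl
central-lower (suc k) = begin
  4 * 4 ^ m * (suc m * m ! * (suc m * m !))       ≡⟨ regroup (4 ^ m) (suc m) (m !) ⟩
  4 * (suc m * suc m) * (4 ^ m * (m ! * m !))     ≤⟨ *-monoʳ-≤ (4 * (suc m * suc m)) (central-lower k) ⟩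
  4 * (suc m * suc m) * (2 * m * (m + m) !)       ≤⟨ *-monoʳ-≤ (4 * (suc m * suc m)) (*-monoˡ-≤ ((m + m) !) 2m≤) ⟩
  4 * (suc m * suc m) * (suc (m + m) * (m + m) !) ≡⟨ regroup′ m ((m + m) !) ⟩
  2 * suc m * (suc (suc (m + m)) * (suc (m + m) * (m + m) !))
    ≡⟨ cong (λ z → 2 * suc m * z !) (cong suc (sym (+-suc m m))) ⟩
  2 * suc m * (suc m + suc m) !                   ∎
  where
  open ≤-Reasoning
  m = suc k
  2m≤ : 2 * m ≤ suc (m + m)
  2m≤ = ≤-trans (≤-reflexive (cong (m +_) (+-identityʳ m))) (n≤1+n (m + m))
  regroup : ∀ a b c → 4 * a * (b * c * (b * c)) ≡ 4 * (b * b) * (a * (c * c))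
  regroup = solve-∀
  regroup′ : ∀ m f → 4 * (suc m * suc m) * (suc (m + m) * f) ≡ 2 * suc m * (suc (suc (m + m)) * (suc (m + m) * f))
  regroup′ = solve-∀

rising-central : ∀ k → 0 < k → 4 ^ k * k ! ≤ 2 * k * rising k k
rising-central k@(suc k′) _ = *-cancelˡ-≤ (k !) {{>-nonZero (!-pos k)}} (begin
  k ! * (4 ^ k * k !)            ≡⟨ swap-* (k !) (4 ^ k) (k !) ⟩
  4 ^ k * (k ! * k !)            ≤⟨ central-lower k′ ⟩
  2 * k * (k + k) !              ≡⟨ cong (2 * k *_) (!-∏-tail k k) ⟨
  2 * k * (k ! * rising k k)     ≡⟨ swap-* (2 * k) (k !) _ ⟩
  k ! * (2 * k * rising k k)     ∎)
  where open ≤-Reasoning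

log₄ : ∀ n → 0 < n → ∃ λ h → 4 ^ h ≤ n × n < 4 ^ suc h
log₄ (suc zero) _ = 0 , s≤s z≤n , s≤s (s≤s z≤n)
log₄ (suc (suc n)) _ with log₄ (suc n) (s≤s z≤n)
... | h , lo , hi with suc (suc n) <? 4 ^ suc h
...   | yes hi′ = h , m≤n⇒m≤1+n lo , hi′
...   | no hi′ = suc h , ≮⇒≥ hi′ , ≤-<-trans hi (^-monoʳ-< 4 (s≤s (s≤s z≤n)) {suc h} ≤-refl)

wheel-quarter : ∀ r → 4 * length (wheelPrimes r) ≤ r + 32
wheel-quarter r = *-cancelˡ-≤ 210 (begin
  210 * (4 * len)        ≡⟨ swap-* 210 4 len ⟩
  4 * (210 * len)        ≤⟨ *-monoʳ-≤ 4 (wheelPrimes-length r) ⟩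
  4 * (48 * r + 1158)    ≡⟨ *-distribˡ-+ 4 (48 * r) 1158 ⟩
  4 * (48 * r) + 4632    ≡⟨ cong (_+ 4632) (*-assoc 4 48 r) ⟨
  192 * r + 4632         ≤⟨ +-mono-≤ (*-monoˡ-≤ r (≤ᵇ-sound {192} {210} refl)) (≤ᵇ-sound {4632} {6720} refl) ⟩
  210 * r + 6720         ≡⟨ *-distribˡ-+ 210 r 32 ⟨
  210 * (r + 32)         ∎)
  where
  open ≤-Reasoning
  len = length (wheelPrimes r)

-- The factor 4 is dictated by the odd windows, which end in k ≤ 4 len + 6; the wheel density 48/210
-- just suffices.
wheel-large : ∀ k → 16384 ≤ k → 4 * length (wheelPrimes k) + 8 ≤ k
wheel-large k k≥ = *-cancelˡ-≤ 210 (begin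
  210 * (4 * len + 8)        ≡⟨ *-distribˡ-+ 210 (4 * len) 8 ⟩
  210 * (4 * len) + 1680     ≡⟨ cong (_+ 1680) (swap-* 210 4 len) ⟩
  4 * (210 * len) + 1680     ≤⟨ +-monoˡ-≤ 1680 (*-monoʳ-≤ 4 (wheelPrimes-length k)) ⟩
  4 * (48 * k + 1158) + 1680 ≡⟨ cong (_+ 1680) (*-distribˡ-+ 4 (48 * k) 1158) ⟩
  4 * (48 * k) + 4632 + 1680 ≡⟨ +-assoc (4 * (48 * k)) 4632 1680 ⟩
  4 * (48 * k) + 6312        ≡⟨ cong (_+ 6312) (*-assoc 4 48 k) ⟨
  192 * k + 6312             ≤⟨ +-monoʳ-≤ (192 * k) (≤-trans (≤-trans (≤ᵇ-sound {6312} {16384} refl) k≥) (m≤n*m k 18)) ⟩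
  192 * k + 18 * k           ≡⟨ *-distribʳ-+ k 192 18 ⟨
  210 * k                    ∎)
  where
  open ≤-Reasoning
  len = length (wheelPrimes k)

-- With 4^(g+1) ≤ n < 4^(g+2) and r = 2^(g+2), these are (log₂ n) (2 + π(r)) and (log₂ n) (3 + π(r)) up to rounding.
growth : ℕ → ℕ → ℕ
growth c g = (2 * g + 4) * (c + 2 ^ g)

growth-mono : ∀ c {g g′} → g ≤ g′ → growth c g ≤ growth c g′
growth-mono c g≤ = *-mono-≤ (+-monoˡ-≤ 4 (*-monoʳ-≤ 2 g≤)) (+-monoʳ-≤ c (^-monoʳ-≤ 2 g≤))

2^suc-≤ : ∀ c g → c + 2 ^ suc g ≤ 2 * (c + 2 ^ g)
2^suc-≤ c g = ≤-trans (+-monoˡ-≤ (2 ^ suc g) (m≤n*m c 2)) (≤-reflexive (sym (*-distribˡ-+ 2 c (2 ^ g))))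

-- The ratio 5/2 serves two comparisons: (5/2)³ < 16 for the cube of `growth`, and 5/2 < 4 for
-- `growth` itself.
growth-suc-5/2 : ∀ c g → 2 ≤ g → 2 * growth c (suc g) ≤ 5 * growth c g
growth-suc-5/2 c g 2≤g = begin
  2 * ((2 * suc g + 4) * (c + 2 ^ suc g))       ≤⟨ *-monoʳ-≤ 2 (*-monoʳ-≤ (2 * suc g + 4) (2^suc-≤ c g)) ⟩
  2 * ((2 * suc g + 4) * (2 * (c + 2 ^ g)))     ≡⟨ regroup g (c + 2 ^ g) ⟩
  (8 * g + 20 + 4) * (c + 2 ^ g)                ≤⟨ *-monoˡ-≤ (c + 2 ^ g) (+-monoʳ-≤ (8 * g + 20) (*-monoʳ-≤ 2 2≤g)) ⟩
  (8 * g + 20 + 2 * g) * (c + 2 ^ g)            ≡⟨ regroup′ g (c + 2 ^ g) ⟩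
  5 * ((2 * g + 4) * (c + 2 ^ g))               ∎
  where
  open ≤-Reasoning
  regroup : ∀ g x → 2 * ((2 * suc g + 4) * (2 * x)) ≡ (8 * g + 20 + 4) * x
  regroup = solve-∀
  regroup′ : ∀ g x → (8 * g + 20 + 2 * g) * x ≡ 5 * ((2 * g + 4) * x)
  regroup′ = solve-∀

cube-below-16^ : ∀ (f : ℕ → ℕ) g₀ → (∀ g → g₀ ≤ g → 2 * f (suc g) ≤ 5 * f g) → f g₀ ^ 3 ≤ 16 ^ suc g₀ →
  ∀ g → g₀ ≤ g → f g ^ 3 ≤ 16 ^ suc g
cube-below-16^ f g₀ slow base g g₀≤g with m≤n⇒m<n∨m≡n g₀≤g
... | inj₂ refl = base
cube-below-16^ f g₀ slow base (suc g) _ | inj₁ g₀<suc-g = *-cancelˡ-≤ 8 (begin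
  8 * f (suc g) ^ 3         ≡⟨ ^-distrib-* 2 (f (suc g)) 3 ⟨
  (2 * f (suc g)) ^ 3       ≤⟨ ^-monoˡ-≤ 3 (slow g g₀≤g) ⟩
  (5 * f g) ^ 3             ≡⟨ ^-distrib-* 5 (f g) 3 ⟩
  125 * f g ^ 3             ≤⟨ *-mono-≤ (≤ᵇ-sound {125} {128} refl) (cube-below-16^ f g₀ slow base g g₀≤g) ⟩
  128 * 16 ^ suc g          ≡⟨ *-assoc 8 16 (16 ^ suc g) ⟩
  8 * 16 ^ suc (suc g)      ∎)
  where
  open ≤-Reasoning
  g₀≤g = ≤-pred g₀<suc-g

linear-below-4^ : ∀ (f : ℕ → ℕ) g₀ → (∀ g → g₀ ≤ g → 2 * f (suc g) ≤ 5 * f g) → 8 * suc (3 * f g₀) ≤ 4 ^ suc g₀ →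
  ∀ g → g₀ ≤ g → 8 * suc (3 * f g) ≤ 4 ^ suc g
linear-below-4^ f g₀ slow base g g₀≤g with m≤n⇒m<n∨m≡n g₀≤g
... | inj₂ refl = base
linear-below-4^ f g₀ slow base (suc g) _ | inj₁ g₀<suc-g = begin
  8 * suc (3 * f (suc g))   ≤⟨ *-monoʳ-≤ 8 (s≤s (*-monoʳ-≤ 3 step)) ⟩
  8 * suc (3 * (4 * f g))   ≤⟨ *-monoʳ-≤ 8 (m+n≤o⇒m≤o (suc (3 * (4 * f g))) (≤-reflexive (regroup (f g)))) ⟩
  8 * (4 * suc (3 * f g))   ≡⟨ swap-* 8 4 (suc (3 * f g)) ⟩
  4 * (8 * suc (3 * f g))   ≤⟨ *-monoʳ-≤ 4 (linear-below-4^ f g₀ slow base g g₀≤g) ⟩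
  4 ^ suc (suc g)           ∎
  where
  open ≤-Reasoning
  g₀≤g = ≤-pred g₀<suc-g
  regroup : ∀ f → suc (3 * (4 * f)) + 3 ≡ 4 * suc (3 * f)
  regroup = solve-∀
  step : f (suc g) ≤ 4 * f g
  step = *-cancelˡ-≤ 2 (begin
    2 * f (suc g)   ≤⟨ slow g g₀≤g ⟩
    5 * f g         ≤⟨ *-monoˡ-≤ (f g) (≤ᵇ-sound {5} {8} refl) ⟩
    8 * f g         ≡⟨ *-assoc 2 4 (f g) ⟩
    2 * (4 * f g)   ∎)

growth-cube : ∀ g → 10 ≤ g → growth 10 g ^ 3 ≤ 16 ^ suc g
growth-cube = cube-below-16^ (growth 10) 10 (λ g 10≤g → growth-suc-5/2 10 g (≤-trans (≤ᵇ-sound {2} {10} refl) 10≤g))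
  (≤ᵇ-sound {growth 10 10 ^ 3} {16 ^ 11} refl)

growth-linear : ∀ g → 9 ≤ g → 8 * suc (3 * growth 11 g) ≤ 4 ^ suc g
growth-linear = linear-below-4^ (growth 11) 9 (λ g 9≤g → growth-suc-5/2 11 g (≤-trans (≤ᵇ-sound {2} {9} refl) 9≤g))
  (≤ᵇ-sound {8 * suc (3 * growth 11 9)} {4 ^ 10} refl)

≤half : ∀ k → k ≤ suc (suc (2 * half k))
≤half zero = z≤n
≤half (suc k) = s≤s (begin
  k                              ≡⟨ ⌊n/2⌋+⌈n/2⌉≡n k ⟨
  ⌊ k /2⌋ + ⌈ k /2⌉              ≤⟨ +-monoʳ-≤ ⌊ k /2⌋ (⌊n/2⌋-mono (n≤1+n (suc k))) ⟩
  ⌊ k /2⌋ + suc ⌊ k /2⌋          ≡⟨ +-suc ⌊ k /2⌋ ⌊ k /2⌋ ⟩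
  suc (⌊ k /2⌋ + ⌊ k /2⌋)        ≡⟨ cong (λ z → suc (⌊ k /2⌋ + z)) (+-identityʳ ⌊ k /2⌋) ⟨
  suc (2 * ⌊ k /2⌋)              ∎)
  where open ≤-Reasoning

-- The terms are at least k², while `Y` is at most 2·4⋯(2h) ≤ k^h. Comparing exponents gives 2(h - 1
-- - len) ≤ h, hence k ≤ 2h + 2 ≤ 4 len + 6, against `wheel-large`.
large-oddWindow : ∀ k n → 16384 ≤ k → suc k * suc k ≤ n → OddWindow k n
large-oddWindow k n k≥ ≤n = [ id , (λ E → ⊥-elim (counting E)) ]′ (excise-oddWindow k n (wheelPrimes k) 0<k k<n)
  where
  0<k : 0 < k
  0<k = ≤-trans (≤ᵇ-sound {1} {16384} refl) k≥
  1<k : 1 < k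
  1<k = ≤-trans (≤ᵇ-sound {2} {16384} refl) k≥
  k<n : k < n
  k<n = ≤-trans (m≤m*n (suc k) (suc k)) ≤n
  h = half k
  b = n ∸ suc (2 * h)
  len = length (wheelPrimes k)
  e = h ∸ suc len
  k²≤b : k * k ≤ b
  k²≤b = m+n≤o⇒m≤o∸n (k * k) (≤-trans (+-monoʳ-≤ (k * k) (odd≤ 0<k))
    (≤-trans (m+n≤o⇒m≤o (k * k + k) (≤-reflexive (square k))) ≤n))
    where square : ∀ k → k * k + k + suc k ≡ suc k * suc k
          square = solve-∀
  counting : ¬ Excised k b 2 h (wheelPrimes k)
  counting E = <-irrefl refl (begin-strict
    k                        ≤⟨ ≤half k ⟩
    suc (suc (2 * h))        ≤⟨ s≤s (s≤s (*-monoʳ-≤ 2 h≤)) ⟩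
    2 + 2 * (2 * suc len)    ≡⟨ regroup len ⟩
    4 * len + 6              <⟨ +-monoʳ-< (4 * len) (≤ᵇ-sound {7} {8} refl) ⟩
    4 * len + 8              ≤⟨ wheel-large k k≥ ⟩
    k                        ∎)
    where
    open ≤-Reasoning
    open Excised E
    regroup : ∀ l → 2 + 2 * (2 * suc l) ≡ 4 * l + 6
    regroup = solve-∀
    powers : k ^ (2 * e) ≤ k ^ h
    powers = begin
      k ^ (2 * e)              ≡⟨ ^-*-assoc k 2 e ⟨
      (k ^ 2) ^ e              ≡⟨ cong (λ z → (k * z) ^ e) (*-identityʳ k) ⟩
      (k * k) ^ e              ≤⟨ ^-monoˡ-≤ e k²≤b ⟩
      b ^ e                    ≤⟨ lower-cancel h len (≤-trans (*-pos 0<k 0<k) k²≤b) Y>0 lower ⟩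
      Y                        ≤⟨ ∣⇒≤′ (*-pos (^-pos (s≤s z≤n) h) (!-pos h)) (excised-∣ (s≤s z≤n) ∈-wheelPrimes E) ⟩
      2 ^ h * h !              ≡⟨ ∏-multiples 2 h ⟨
      ∏ h (λ i → 2 * suc i)    ≤⟨ ∏-mono-≤ h (λ i i<h → ≤-trans (*-monoʳ-≤ 2 i<h) (<⇒≤ (odd≤ 0<k))) ⟩
      ∏ h (λ _ → k)            ≡⟨ ∏-const h k ⟩
      k ^ h                    ∎
    h≤ : h ≤ 2 * suc len
    h≤ = +-cancelˡ-≤ h _ _ (begin
      h + h                          ≡⟨ cong (h +_) (+-identityʳ h) ⟨
      2 * h                          ≤⟨ *-monoʳ-≤ 2 (m≤n+m∸n h (suc len)) ⟩
      2 * (suc len + e)              ≡⟨ *-distribˡ-+ 2 (suc len) e ⟩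
      2 * suc len + 2 * e            ≤⟨ +-monoʳ-≤ (2 * suc len) (^-cancelʳ-≤ 1<k powers) ⟩
      2 * suc len + h                ≡⟨ +-comm (2 * suc len) h ⟩
      h + 2 * suc len                ∎)

module LargeWindow (k n : ℕ) (k≥ : 16384 ≤ k) (2k≤n : 2 * k ≤ n) where

  open ≤-Reasoning

  0<k : 0 < k
  0<k = ≤-trans (≤ᵇ-sound {1} {16384} refl) k≥

  1<k : 1 < k
  1<k = ≤-trans (≤ᵇ-sound {2} {16384} refl) k≥

  k+k≤n : k + k ≤ n
  k+k≤n = ≤-trans (≤-reflexive (cong (k +_) (sym (+-identityʳ k)))) 2k≤n

  k<n : k < n
  k<n = <-≤-trans (m<m+n k 0<k) k+k≤n

  k≤n : k ≤ n
  k≤n = <⇒≤ k<n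

  0<n : 0 < n
  0<n = ≤-trans 0<k k≤n

  -- With k terms, n - k excluded, the full product is n!/(n-k)! = k!·binom(n, k).
  s = pred k

  k≡ : suc s ≡ k
  k≡ = suc-pred k {{>-nonZero 0<k}}

  u = n ∸ k

  k≤u : k ≤ u
  k≤u = m+n≤o⇒m≤o∸n k k+k≤n

  R = rising k u

  b = n ∸ s

  b≡ : b ≡ suc u
  b≡ = trans (cong (_∸ s) (trans (sym (m∸n+n≡m k≤n)) (trans (cong (u +_) (sym k≡)) (+-suc u s)))) (m+n∸n≡m (suc u) s)

  terms : ∏ (suc s) (ap b 1) ≡ R
  terms = trans (cong (λ z → ∏ z (ap b 1)) k≡) (∏-cong k (λ i _ → cong₂ _+_ b≡ (*-identityˡ i)))

  last-term : ap b 1 s ≡ n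
  last-term = trans (cong (b +_) (*-identityˡ s)) (m∸n+n≡m (≤-trans pred[n]≤n k≤n))

  s!∣k! : 1 ^ s * s ! ∣ k !
  s!∣k! = subst (_∣ k !) (sym (trans (cong (_* s !) (^-zeroˡ s)) (*-identityˡ (s !)))) (m≤n⇒m!∣n! {s} {k} pred[n]≤n)

  ν-s! : ∀ {p} → Prime p → ν p (1 ^ s * s !) ≤ ν p (k !)
  ν-s! pp = ν-mono-∣ pp (!-pos k) s!∣k!

  upper′ : ∀ {ps} (E : Excised k b 1 s ps) → R ≤ n ^ (2 + length ps) * Excised.Y E
  upper′ {ps} E = subst₂ (λ P X → P ≤ X ^ (2 + length ps) * Excised.Y E) terms last-term (Excised.upper E)

  -- From (n/k)^k ≤ binom(n, k) and Y ≤ k! there remains n^e ≤ k^k with e = k - 2 - len. Squaring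
  -- and inserting k³ ≤ n² gives 3e ≤ 2k, that is k ≤ 3(2 + len).
  far : k * (k * k) ≤ n * n → ¬ Excised k b 1 s (wheelPrimes k)
  far k³≤n² E = <-irrefl refl (begin-strict
    k                       ≤⟨ k≤ ⟩
    3 * (2 + len)           ≤⟨ m≤m+n (3 * (2 + len)) len ⟩
    3 * (2 + len) + len     ≡⟨ regroup len ⟩
    4 * len + 6             <⟨ +-monoʳ-< (4 * len) (≤ᵇ-sound {7} {8} refl) ⟩
    4 * len + 8             ≤⟨ wheel-large k k≥ ⟩
    k                       ∎)
    where
    open Excised E
    len = length (wheelPrimes k)
    e = k ∸ (2 + len)
    regroup : ∀ l → 3 * (2 + l) + l ≡ 4 * l + 6
    regroup = solve-∀
    2+len≤k : 2 + len ≤ k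
    2+len≤k = ≤-trans (≤-trans (+-mono-≤ (≤ᵇ-sound {2} {8} refl) (m≤n*m len 4)) (≤-reflexive (+-comm 8 (4 * len)))) (wheel-large k k≥)
    Y≤ : Y ≤ k !
    Y≤ = ∣⇒≤′ (!-pos k) (∣-trans (excised-∣ (s≤s z≤n) ∈-wheelPrimes E) s!∣k!)
    reduced : n ^ e ≤ k ^ k
    reduced = *-cancelˡ-≤ (n ^ (2 + len)) {{>-nonZero (^-pos 0<n (2 + len))}} (*-cancelˡ-≤ (k !) {{>-nonZero (!-pos k)}} (begin
      k ! * (n ^ (2 + len) * n ^ e)     ≡⟨ cong (k ! *_) (trans (sym (^-distribˡ-+-* n (2 + len) e)) (cong (n ^_) (m+[n∸m]≡n 2+len≤k))) ⟩
      k ! * n ^ k                       ≤⟨ rising-ratio k n k≤n ⟩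
      k ^ k * R                         ≤⟨ *-monoʳ-≤ (k ^ k) (≤-trans (upper′ E) (*-monoʳ-≤ (n ^ (2 + len)) Y≤)) ⟩
      k ^ k * (n ^ (2 + len) * k !)     ≡⟨ swap (k ^ k) (n ^ (2 + len)) (k !) ⟩
      k ! * (n ^ (2 + len) * k ^ k)     ∎))
      where swap : ∀ a b c → a * (b * c) ≡ c * (b * a)
            swap = solve-∀
    powers : k ^ (3 * e) ≤ k ^ (2 * k)
    powers = begin
      k ^ (3 * e)               ≡⟨ ^-*-assoc k 3 e ⟨
      (k ^ 3) ^ e               ≡⟨ cong (λ z → (k * (k * z)) ^ e) (*-identityʳ k) ⟩
      (k * (k * k)) ^ e         ≤⟨ ^-monoˡ-≤ e k³≤n² ⟩
      (n * n) ^ e               ≡⟨ ^-distrib-* n n e ⟩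
      n ^ e * n ^ e             ≤⟨ *-mono-≤ reduced reduced ⟩
      k ^ k * k ^ k             ≡⟨ ^-distribˡ-+-* k k k ⟨
      k ^ (k + k)               ≡⟨ cong (λ z → k ^ (k + z)) (+-identityʳ k) ⟨
      k ^ (2 * k)               ∎
    k≤ : k ≤ 3 * (2 + len)
    k≤ = +-cancelˡ-≤ (2 * k) _ _ (begin
      2 * k + k                     ≡⟨ +-comm (2 * k) k ⟩
      3 * k                         ≡⟨ cong (3 *_) (m+[n∸m]≡n 2+len≤k) ⟨
      3 * (2 + len + e)             ≡⟨ *-distribˡ-+ 3 (2 + len) e ⟩
      3 * (2 + len) + 3 * e         ≤⟨ +-monoʳ-≤ (3 * (2 + len)) (^-cancelʳ-≤ 1<k powers) ⟩
      3 * (2 + len) + 2 * k         ≡⟨ +-comm (3 * (2 + len)) (2 * k) ⟩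
      2 * k + 3 * (2 + len)         ∎)

  -- n < k^(3/2): primes above √n occur to the first power, and those in (n/3, k] do not survive in binom(n, k).
  module Near (n²<k³ : n * n < k * (k * k)) (g : ℕ) (lo : 4 ^ suc g ≤ n) (hi : n < 4 ^ suc (suc g))
    (E : Excised k b 1 s (wheelPrimes (2 ^ suc (suc g)))) where

    open Excised E

    r = 2 ^ suc (suc g)
    m = k ⊓ (n / 3)
    len = length (wheelPrimes r)

    n<r² : n < r * r
    n<r² = <-≤-trans hi (≤-reflexive (^-distrib-* 2 2 (suc (suc g))))

    len≤ : len ≤ 8 + 2 ^ g
    len≤ = *-cancelˡ-≤ 4 (begin
      4 * len                    ≤⟨ wheel-quarter r ⟩
      2 * (2 * 2 ^ g) + 32       ≡⟨ cong (_+ 32) (*-assoc 2 2 (2 ^ g)) ⟨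
      4 * 2 ^ g + 32             ≡⟨ +-comm (4 * 2 ^ g) 32 ⟩
      32 + 4 * 2 ^ g             ≡⟨ *-distribˡ-+ 4 8 (2 ^ g) ⟨
      4 * (8 + 2 ^ g)            ∎)

    term-ν : ∀ {p} → Prime p → r < p → ∀ i → i ≤ s → ν p (ap b 1 i) ≤ 1
    term-ν {p} pp r<p i i≤s = ≮⇒≥ λ 2≤ν → <⇒≱ (<-trans n<r² (*-mono-< r<p r<p))
      (≤-trans (∣⇒≤′ 0<x (∣-trans (subst (_∣ p ^ ν p x) (cong (p *_) (*-identityʳ p)) (^-∣-mono p 2≤ν)) (p^ν∣n p x)))
        (≤-trans (+-monoʳ-≤ b (*-monoʳ-≤ 1 i≤s)) (≤-reflexive last-term)))
      where
      x = ap b 1 i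
      0<x : 0 < x
      0<x = ≤-trans (≤-trans (s≤s z≤n) (≤-reflexive (sym b≡))) (m≤m+n b (1 * i))

    -- As 3p > n, the prime occurs at most twice in n!. One occurrence lies in u! because p ≤ k ≤ u,
    -- so at most one is left for `R`, and k! has one too.
    middle : ∀ {p} → Prime p → r < p → p ≤ k → n < p * 3 → ν p Y ≤ ν p (k !)
    middle {p} pp r<p p≤k n<3p = ≤-trans (≤-trans (ν-total pp) (≤-reflexive (cong (ν p) terms)))
      (≤-trans (+-cancelˡ-≤ 1 _ _ (begin
        1 + ν p R                ≤⟨ +-monoˡ-≤ (ν p R) (ν-∣ pp (!-pos u) (∣! (prime>0 pp) (≤-trans p≤k k≤u))) ⟩
        ν p (u !) + ν p R        ≡⟨ ν-* pp (!-pos u) (rising-pos k u) ⟨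
        ν p (u ! * R)            ≡⟨ cong (ν p) (trans (!-∏-tail u k) (cong _! (m∸n+n≡m k≤n))) ⟩
        ν p (n !)                ≤⟨ ν-!-≤ pp n 2 2<p n<3p ⟩
        2                        ∎))
        (ν-∣ pp (!-pos k) (∣! (prime>0 pp) p≤k)))
      where
      2<p : 2 < p
      2<p = ≤-<-trans (m≤m*n 2 (2 * 2 ^ g) {{>-nonZero (^-pos (s≤s z≤n) (suc g))}}) r<p

    -- Primes up to `r` are listed. Those in (r, n/3] may exceed their valuation in k! by one, which
    -- `primorial m` supplies; the rest up to `k` fall under `middle`.
    Y≤ : Y ≤ k ! * 4 ^ m
    Y≤ = ≤-trans (∣⇒≤′ 0<K (ν-≤⇒∣ {Y} {k ! * primorial m} Y>0 0<K dom)) (*-monoʳ-≤ (k !) (primorial≤4^ m))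
      where
      0<K : 0 < k ! * primorial m
      0<K = *-pos (!-pos k) (primorial-pos m)
      ν-K : ∀ {p} → Prime p → ν p (k ! * primorial m) ≡ ν p (k !) + ν p (primorial m)
      ν-K pp = ν-* pp (!-pos k) (primorial-pos m)
      from-k! : ∀ {p} → Prime p → ν p Y ≤ ν p (k !) → ν p Y ≤ ν p (k ! * primorial m)
      from-k! pp h = ≤-trans h (≤-trans (m≤m+n _ _) (≤-reflexive (sym (ν-K pp))))
      dom : ∀ {p} → Prime p → ν p Y ≤ ν p (k ! * primorial m)
      dom {p} pp with p ≤? k
      ... | no p≰k = subst (_≤ ν p (k ! * primorial m)) (sym (ν-large pp (≰⇒> p≰k))) z≤n
      ... | yes p≤k with p ≤? r
      ...   | yes p≤r = from-k! pp (≤-trans (ν-listed pp (∈-wheelPrimes pp p≤r)) (ν-s! pp))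
      ...   | no p≰r with p ≤? n / 3
      ...     | yes p≤n/3 = ≤-trans (ν-unlisted 1 pp (term-ν pp (≰⇒> p≰r)))
        (≤-trans (+-mono-≤ (ν-∣ pp (primorial-pos m) (prime∣primorial pp (⊓-glb p≤k p≤n/3))) (ν-s! pp))
          (≤-reflexive (trans (+-comm (ν p (primorial m)) _) (sym (ν-K pp)))))
      ...     | no p≰n/3 = from-k! pp (middle pp (≰⇒> p≰r) p≤k (begin-strict
        n                       ≡⟨ m≡m%n+[m/n]*n n 3 ⟩
        n % 3 + n / 3 * 3       <⟨ +-monoˡ-< (n / 3 * 3) (m%n<n n 3) ⟩
        suc (n / 3) * 3         ≤⟨ *-monoˡ-≤ 3 (≰⇒> p≰n/3) ⟩
        p * 3                   ∎))

    R≤ : R ≤ n ^ (2 + len) * (k ! * 4 ^ m)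
    R≤ = ≤-trans (upper′ E) (*-monoʳ-≤ (n ^ (2 + len)) Y≤)

    n≤2^ : n ≤ 2 ^ (2 * g + 4)
    n≤2^ = ≤-trans (<⇒≤ hi) (≤-reflexive (trans (^-*-assoc 2 2 (suc (suc g))) (cong (2 ^_) (shape g))))
      where shape : ∀ g → 2 * suc (suc g) ≡ 2 * g + 4
            shape = solve-∀

    n^≤2^ : ∀ x → n ^ x ≤ 2 ^ ((2 * g + 4) * x)
    n^≤2^ x = ≤-trans (^-monoˡ-≤ x n≤2^) (≤-reflexive (^-*-assoc 2 (2 * g + 4) x))

    -- Here (n/k)^k ≥ 8^k, and 4^m ≤ 4^k takes only part of it, so 2^k ≤ n^(2 + len) survives.
    k≤growth : 8 * k ≤ n → k ≤ growth 10 g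
    k≤growth 8k≤n = ≤-trans (^-cancelʳ-≤ (s≤s (s≤s z≤n)) (≤-trans 2^k≤ (n^≤2^ (2 + len))))
        (*-monoʳ-≤ (2 * g + 4) (+-monoʳ-≤ 2 len≤))
      where
      swap : ∀ K F N V → K * (N * (F * V)) ≡ F * (V * K * N)
      swap = solve-∀
      2^k≤ : 2 ^ k ≤ n ^ (2 + len)
      2^k≤ = *-cancelˡ-≤ ((4 * k) ^ k) {{>-nonZero (^-pos (*-pos {4} (s≤s z≤n) 0<k) k)}} (*-cancelˡ-≤ (k !) {{>-nonZero (!-pos k)}} (begin
        k ! * ((4 * k) ^ k * 2 ^ k)                  ≡⟨ cong (k ! *_) (^-distrib-* (4 * k) 2 k) ⟨
        k ! * (4 * k * 2) ^ k                        ≡⟨ cong (λ z → k ! * z ^ k) (trans (*-comm (4 * k) 2) (sym (*-assoc 2 4 k))) ⟩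
        k ! * (8 * k) ^ k                            ≤⟨ *-monoʳ-≤ (k !) (^-monoˡ-≤ k 8k≤n) ⟩
        k ! * n ^ k                                  ≤⟨ rising-ratio k n k≤n ⟩
        k ^ k * R                                    ≤⟨ *-monoʳ-≤ (k ^ k) R≤ ⟩
        k ^ k * (n ^ (2 + len) * (k ! * 4 ^ m))      ≤⟨ *-monoʳ-≤ (k ^ k) (*-monoʳ-≤ (n ^ (2 + len)) (*-monoʳ-≤ (k !) (^-monoʳ-≤ 4 (m⊓n≤m k (n / 3))))) ⟩
        k ^ k * (n ^ (2 + len) * (k ! * 4 ^ k))      ≡⟨ swap (k ^ k) (k !) (n ^ (2 + len)) (4 ^ k) ⟩
        k ! * (4 ^ k * k ^ k * n ^ (2 + len))        ≡⟨ cong (λ z → k ! * (z * n ^ (2 + len))) (^-distrib-* 4 k k) ⟨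
        k ! * ((4 * k) ^ k * n ^ (2 + len))          ∎))

    -- For n near 2k, (n/k)^k is too weak against 4^m. Instead 4^k ≤ 2k·binom(2k, k) is combined
    -- with a gain of 4^(j/3) from j ≤ k/2 further steps, and cubing clears the thirds. This leaves
    -- 4^t ≤ n^(3(3 + len)), the additional n paying for the factor 2k.
    k≤growth′ : k ≤ suc (3 * growth 11 g)
    k≤growth′ with halve k
    ... | t , parity-of-k = begin
      k                                        ≤⟨ k≤1+2t ⟩
      suc (2 * t)                              ≤⟨ s≤s (^-cancelʳ-≤ (s≤s (s≤s z≤n)) (≤-trans (≤-reflexive (sym (^-*-assoc 2 2 t))) 4^t≤)) ⟩
      suc ((2 * g + 4) * ((3 + len) * 3))      ≤⟨ s≤s (*-monoʳ-≤ (2 * g + 4) (*-monoˡ-≤ 3 (+-monoʳ-≤ 3 len≤))) ⟩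
      suc ((2 * g + 4) * ((11 + 2 ^ g) * 3))   ≡⟨ cong suc (trans (sym (*-assoc (2 * g + 4) (11 + 2 ^ g) 3)) (*-comm ((2 * g + 4) * (11 + 2 ^ g)) 3)) ⟩
      suc (3 * growth 11 g)                    ∎
      where
      k≤1+2t : k ≤ suc (2 * t)
      k≤1+2t = [ (λ eq → ≤-trans (≤-reflexive eq) (n≤1+n _)) , ≤-reflexive ]′ parity-of-k
      2t≤k : 2 * t ≤ k
      2t≤k = [ (λ eq → ≤-reflexive (sym eq)) , (λ eq → ≤-trans (n≤1+n _) (≤-reflexive (sym eq))) ]′ parity-of-k
      j = (n ∸ 2 * k) ⊓ t
      k+j≤u : k + j ≤ u
      k+j≤u = ≤-trans (+-monoʳ-≤ k (≤-trans (m⊓n≤m (n ∸ 2 * k) t)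
        (≤-reflexive (trans (cong (n ∸_) (cong (k +_) (+-identityʳ k))) (sym (∸-+-assoc n k k))))))
        (≤-reflexive (m+[n∸m]≡n k≤u))
      -- If j = t, then m ≤ k is enough; if j = n - 2k, then 3m ≤ n = 2k + j and t ≤ k.
      exponents : t + 3 * m ≤ 3 * k + j
      exponents with ⊓-sel (n ∸ 2 * k) t
      ... | inj₂ j≡t = ≤-trans (≤-reflexive (+-comm t (3 * m))) (+-mono-≤ (*-monoʳ-≤ 3 (m⊓n≤m k (n / 3))) (≤-reflexive (sym j≡t)))
      ... | inj₁ j≡ = begin
        t + 3 * m                  ≤⟨ +-mono-≤ (≤-trans (m≤n*m t 2) 2t≤k) (≤-trans (*-monoʳ-≤ 3 (m⊓n≤n k (n / 3)))
                                        (≤-trans (≤-reflexive (*-comm 3 (n / 3))) (m/n*n≤m n 3))) ⟩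
        k + n                      ≡⟨ cong (k +_) (m+[n∸m]≡n 2k≤n) ⟨
        k + (2 * k + (n ∸ 2 * k))  ≡⟨ +-assoc k (2 * k) _ ⟨
        3 * k + (n ∸ 2 * k)        ≡⟨ cong (3 * k +_) j≡ ⟨
        3 * k + j                  ∎
      cubed : ∀ a x → a ^ (3 * x) ≡ (a ^ x) ^ 3
      cubed a x = trans (cong (a ^_) (*-comm 3 x)) (sym (^-*-assoc a x 3))
      K = k !
      Z = n ^ (2 + len)
      P = rising k k
      chain : 4 ^ t * ((4 ^ m) ^ 3 * K ^ 3) ≤ (n * Z) ^ 3 * ((4 ^ m) ^ 3 * K ^ 3)
      chain = begin
        4 ^ t * ((4 ^ m) ^ 3 * K ^ 3)              ≡⟨ *-assoc (4 ^ t) _ _ ⟨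
        4 ^ t * (4 ^ m) ^ 3 * K ^ 3                ≡⟨ cong (λ z → 4 ^ t * z * K ^ 3) (cubed 4 m) ⟨
        4 ^ t * 4 ^ (3 * m) * K ^ 3                ≡⟨ cong (_* K ^ 3) (^-distribˡ-+-* 4 t (3 * m)) ⟨
        4 ^ (t + 3 * m) * K ^ 3                    ≤⟨ *-monoˡ-≤ (K ^ 3) (^-monoʳ-≤ 4 exponents) ⟩
        4 ^ (3 * k + j) * K ^ 3                    ≡⟨ cong (_* K ^ 3) (trans (^-distribˡ-+-* 4 (3 * k) j) (cong (_* 4 ^ j) (cubed 4 k))) ⟩
        (4 ^ k) ^ 3 * 4 ^ j * K ^ 3                ≡⟨ rotate ((4 ^ k) ^ 3) (4 ^ j) (K ^ 3) ⟩
        (4 ^ k) ^ 3 * K ^ 3 * 4 ^ j                ≡⟨ cong (_* 4 ^ j) (^-distrib-* (4 ^ k) K 3) ⟨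
        (4 ^ k * K) ^ 3 * 4 ^ j                    ≤⟨ *-monoˡ-≤ (4 ^ j) (^-monoˡ-≤ 3 (rising-central k 0<k)) ⟩
        (2 * k * P) ^ 3 * 4 ^ j                    ≡⟨ cong (_* 4 ^ j) (^-distrib-* (2 * k) P 3) ⟩
        (2 * k) ^ 3 * P ^ 3 * 4 ^ j                ≡⟨ trans (*-assoc ((2 * k) ^ 3) (P ^ 3) (4 ^ j)) (cong ((2 * k) ^ 3 *_) (*-comm (P ^ 3) (4 ^ j))) ⟩
        (2 * k) ^ 3 * (4 ^ j * P ^ 3)              ≤⟨ *-mono-≤ (^-monoˡ-≤ 3 2k≤n) (≤-trans (rising-cube k j (≤-trans (*-monoʳ-≤ 2 (m⊓n≤n (n ∸ 2 * k) t)) 2t≤k))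
                                                        (^-monoˡ-≤ 3 (≤-trans (rising-mono k k+j≤u) R≤))) ⟩
        n ^ 3 * (Z * (K * 4 ^ m)) ^ 3              ≡⟨ ^-distrib-* n (Z * (K * 4 ^ m)) 3 ⟨
        (n * (Z * (K * 4 ^ m))) ^ 3                ≡⟨ cong (_^ 3) (regroup n Z K (4 ^ m)) ⟩
        (n * Z * (4 ^ m * K)) ^ 3                  ≡⟨ ^-distrib-* (n * Z) (4 ^ m * K) 3 ⟩
        (n * Z) ^ 3 * (4 ^ m * K) ^ 3              ≡⟨ cong ((n * Z) ^ 3 *_) (^-distrib-* (4 ^ m) K 3) ⟩
        (n * Z) ^ 3 * ((4 ^ m) ^ 3 * K ^ 3)        ∎
        where
        rotate : ∀ a b c → a * b * c ≡ a * c * b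
        rotate = solve-∀
        regroup : ∀ n z k v → n * (z * (k * v)) ≡ n * z * (v * k)
        regroup = solve-∀
      4^t≤ : 4 ^ t ≤ 2 ^ ((2 * g + 4) * ((3 + len) * 3))
      4^t≤ = begin
        4 ^ t                     ≤⟨ *-cancelʳ-≤ (4 ^ t) ((n * Z) ^ 3) ((4 ^ m) ^ 3 * K ^ 3)
                                       {{>-nonZero (*-pos (^-pos (^-pos (s≤s z≤n) m) 3) (^-pos (!-pos k) 3))}} chain ⟩
        (n ^ (3 + len)) ^ 3       ≡⟨ ^-*-assoc n (3 + len) 3 ⟩
        n ^ ((3 + len) * 3)       ≤⟨ n^≤2^ ((3 + len) * 3) ⟩
        2 ^ ((2 * g + 4) * ((3 + len) * 3)) ∎

    upper-range : ¬ 8 * k ≤ n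
    upper-range 8k≤n with g ≤? 9
    ... | yes g≤9 = <⇒≱ (<-≤-trans (≤ᵇ-sound {suc (growth 10 9)} {16384} refl) k≥)
                      (≤-trans (k≤growth 8k≤n) (growth-mono 10 g≤9))
    ... | no g≰9 = <⇒≱ n²<k³ (begin
      k * (k * k)             ≡⟨ cong (λ z → k * (k * z)) (*-identityʳ k) ⟨
      k ^ 3                   ≤⟨ ^-monoˡ-≤ 3 (k≤growth 8k≤n) ⟩
      growth 10 g ^ 3         ≤⟨ growth-cube g (≰⇒> g≰9) ⟩
      16 ^ suc g              ≡⟨ ^-distrib-* 4 4 (suc g) ⟩
      4 ^ suc g * 4 ^ suc g   ≤⟨ *-mono-≤ lo lo ⟩
      n * n                   ∎)

    lower-range : ¬ n < 8 * k
    lower-range n<8k with g ≤? 8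
    -- `suc (3 * growth 11 8)` is 16021, the tightest of the bounds that k ≥ 16384 has to beat.
    ... | yes g≤8 = <⇒≱ (<-≤-trans (≤ᵇ-sound {suc (suc (3 * growth 11 8))} {16384} refl) k≥)
                      (≤-trans k≤growth′ (s≤s (*-monoʳ-≤ 3 (growth-mono 11 g≤8))))
    ... | no g≰8 = <⇒≱ n<8k (begin
      8 * k                         ≤⟨ *-monoʳ-≤ 8 k≤growth′ ⟩
      8 * suc (3 * growth 11 g)     ≤⟨ growth-linear g (≰⇒> g≰8) ⟩
      4 ^ suc g                     ≤⟨ lo ⟩
      n                             ∎)

    absurd : ⊥
    absurd with 8 * k ≤? n
    ... | yes h = upper-range h
    ... | no h = lower-range (≰⇒> h)

  near : n * n < k * (k * k) → ∀ g → 4 ^ suc g ≤ n → n < 4 ^ suc (suc g) → Window k n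
  near n²<k³ g lo hi = [ id , (λ E → ⊥-elim (Near.absurd n²<k³ g lo hi E)) ]′
    (excise-window k n s (wheelPrimes (2 ^ suc (suc g))) pred[n]≤n k<n)

  window : Window k n
  window with k * (k * k) ≤? n * n
  ... | yes h = [ id , (λ E → ⊥-elim (far h E)) ]′ (excise-window k n s (wheelPrimes k) pred[n]≤n k<n)
  ... | no h with log₄ n 0<n
  ...   | suc g , lo , hi = near (≰⇒> h) g lo hi
  ...   | zero , lo , hi = ⊥-elim (<⇒≱ hi (≤-trans (≤ᵇ-sound {4} {16384} refl) (≤-trans k≥ k≤n)))

-- Degrees of a factor permitted by large primes

-- Possible degrees d of a factor when a prime above k divides n − l exactly once, respectively at most twice.
Strong : ℕ → ℕ → ℕ → Set
Strong k d l = l ≡ d ⊎ l + d ≡ k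

Weak : ℕ → ℕ → ℕ → Set
Weak k d l = Strong k d l ⊎ l ≡ 2 * d ⊎ l + 2 * d ≡ k ⊎ l + 2 * d ≡ 2 * k ⊎ l + k ≡ 2 * d ⊎ (2 * d ≡ k × ∃ λ i → l ≡ 2 * i)

-- The interface between algebra and arithmetic: Newton polygons establish it for the degree of a
-- factor, and the windows refute it for 0 < d < k.
record Compatible (k n d : ℕ) : Set where
  field
    weak : ∀ {l p} → l ≤ k → Prime p → k < p → p ∣ n ∸ l → Weak k d l
    strong : ∀ {l p} → l ≤ k → Prime p → k < p → p ∣ n ∸ l → ¬ p * p ∣ n ∸ l → Strong k d l

strong-unique : ∀ {k d} → ¬ Three (Strong k d)
strong-unique {k} {d} (three {l₁} {l₂} {l₃} l₁<l₂ l₂<l₃ q₁ q₂ q₃) = go q₁ q₂ q₃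
  where
  same₁ : ∀ {l l′} → l < l′ → l ≡ d → l′ ≡ d → ⊥
  same₁ lt e e′ = <-irrefl (trans e (sym e′)) lt
  same₂ : ∀ {l l′} → l < l′ → l + d ≡ k → l′ + d ≡ k → ⊥
  same₂ lt e e′ = <-irrefl (+-cancelʳ-≡ d _ _ (trans e (sym e′))) lt
  go : Strong k d l₁ → Strong k d l₂ → Strong k d l₃ → ⊥
  go (inj₁ a) (inj₁ b) _ = same₁ l₁<l₂ a b
  go (inj₁ a) (inj₂ b) (inj₁ c) = same₁ (<-trans l₁<l₂ l₂<l₃) a c
  go (inj₁ a) (inj₂ b) (inj₂ c) = same₂ l₂<l₃ b c
  go (inj₂ a) (inj₂ b) _ = same₂ l₁<l₂ a b
  go (inj₂ a) (inj₁ b) (inj₁ c) = same₁ l₂<l₃ b c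
  go (inj₂ a) (inj₁ b) (inj₂ c) = same₂ (<-trans l₁<l₂ l₂<l₃) a c

odd+even : ∀ {l} j m → Odd l → l + 2 * j ≢ 2 * m
odd+even j m (i , refl) e = even≢odd m (i + j) (trans (sym e) (cong suc (sym (*-distribˡ-+ 2 i j))))

odd+odd : ∀ {l l′} → Odd l → Odd l′ → ∃ λ e → l + l′ ≡ 2 * e
odd+odd (i , refl) (j , refl) = suc (i + j) , shape i j
  where shape : ∀ i j → suc (2 * i) + suc (2 * j) ≡ 2 * suc (i + j)
        shape = solve-∀

-- The alternatives l = 2d, l + 2d = 2k and the one with 2d = k force l to be even. Of the others, l
-- + 2d = k and l + k = 2d exclude each other. So three odd l would be d, k - d and one of these
-- two; but then k = d + (k - d) is even, and so is the third l.
odd-weak-unique : ∀ {k d} → ¬ Three (λ l → Odd l × Weak k d l)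
odd-weak-unique {k} {d} (three {l₁} {l₂} {l₃} l₁<l₂ l₂<l₃ (o₁ , w₁) (o₂ , w₂) (o₃ , w₃)) =
  go (classify o₁ w₁) (classify o₂ w₂) (classify o₃ w₃)
  where
  l₁<l₃ = <-trans l₁<l₂ l₂<l₃
  Tail : ℕ → Set
  Tail l = l + 2 * d ≡ k ⊎ l + k ≡ 2 * d
  Kind : ℕ → Set
  Kind l = l ≡ d ⊎ l + d ≡ k ⊎ Tail l
  classify : ∀ {l} → Odd l → Weak k d l → Kind l
  classify o (inj₁ (inj₁ e)) = inj₁ e
  classify o (inj₁ (inj₂ e)) = inj₂ (inj₁ e)
  classify (i , refl) (inj₂ (inj₁ e)) = ⊥-elim (even≢odd d i (sym e))
  classify o (inj₂ (inj₂ (inj₁ e))) = inj₂ (inj₂ (inj₁ e))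
  classify o (inj₂ (inj₂ (inj₂ (inj₁ e)))) = ⊥-elim (odd+even d k o e)
  classify o (inj₂ (inj₂ (inj₂ (inj₂ (inj₁ e))))) = inj₂ (inj₂ (inj₂ e))
  classify (i , refl) (inj₂ (inj₂ (inj₂ (inj₂ (inj₂ (_ , j , e)))))) = ⊥-elim (even≢odd j i (sym e))
  same₁ : ∀ {l l′} → l < l′ → l ≡ d → l′ ≡ d → ⊥
  same₁ lt e e′ = <-irrefl (trans e (sym e′)) lt
  same₂ : ∀ {l l′} → l < l′ → l + d ≡ k → l′ + d ≡ k → ⊥
  same₂ lt e e′ = <-irrefl (+-cancelʳ-≡ d _ _ (trans e (sym e′))) lt
  opposite : ∀ {l l′} → Odd l → l + 2 * d ≡ k → l′ + k ≡ 2 * d → ⊥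
  opposite {l} {l′} (i , refl) e e′ = <⇒≱ (m<n+m (2 * d) {l} (s≤s z≤n))
    (≤-trans (≤-reflexive e) (≤-trans (m≤n+m k l′) (≤-reflexive e′)))
  same₃ : ∀ {l l′} → Odd l → Odd l′ → l < l′ → Tail l → Tail l′ → ⊥
  same₃ o o′ lt (inj₁ e) (inj₁ e′) = <-irrefl (+-cancelʳ-≡ (2 * d) _ _ (trans e (sym e′))) lt
  same₃ o o′ lt (inj₂ e) (inj₂ e′) = <-irrefl (+-cancelʳ-≡ k _ _ (trans e (sym e′))) lt
  same₃ o o′ lt (inj₁ e) (inj₂ e′) = opposite o e e′
  same₃ o o′ lt (inj₂ e) (inj₁ e′) = opposite o′ e′ e
  all-kinds : ∀ {a b c} → Odd a → Odd b → Odd c → a ≡ d → b + d ≡ k → Tail c → ⊥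
  all-kinds oa ob oc refl eb (inj₁ ec) with odd+odd ob oa
  ... | e , eq = odd+even d e oc (trans ec (trans (sym eb) eq))
  all-kinds oa ob oc refl eb (inj₂ ec) with odd+odd ob oa
  ... | e , eq = odd+even e d oc (trans (cong (_ +_) (trans (sym eq) eb)) ec)
  go : Kind l₁ → Kind l₂ → Kind l₃ → ⊥
  go (inj₁ a) (inj₁ b) _ = same₁ l₁<l₂ a b
  go (inj₁ a) _ (inj₁ c) = same₁ l₁<l₃ a c
  go _ (inj₁ b) (inj₁ c) = same₁ l₂<l₃ b c
  go (inj₂ (inj₁ a)) (inj₂ (inj₁ b)) _ = same₂ l₁<l₂ a b
  go (inj₂ (inj₁ a)) _ (inj₂ (inj₁ c)) = same₂ l₁<l₃ a c
  go _ (inj₂ (inj₁ b)) (inj₂ (inj₁ c)) = same₂ l₂<l₃ b c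
  go (inj₂ (inj₂ a)) (inj₂ (inj₂ b)) _ = same₃ o₁ o₂ l₁<l₂ a b
  go (inj₂ (inj₂ a)) _ (inj₂ (inj₂ c)) = same₃ o₁ o₃ l₁<l₃ a c
  go _ (inj₂ (inj₂ b)) (inj₂ (inj₂ c)) = same₃ o₂ o₃ l₂<l₃ b c
  go (inj₁ a) (inj₂ (inj₁ b)) (inj₂ (inj₂ c)) = all-kinds o₁ o₂ o₃ a b c
  go (inj₁ a) (inj₂ (inj₂ b)) (inj₂ (inj₁ c)) = all-kinds o₁ o₃ o₂ a c b
  go (inj₂ (inj₁ a)) (inj₁ b) (inj₂ (inj₂ c)) = all-kinds o₂ o₁ o₃ b a c
  go (inj₂ (inj₁ a)) (inj₂ (inj₂ b)) (inj₁ c) = all-kinds o₃ o₁ o₂ c a b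
  go (inj₂ (inj₂ a)) (inj₁ b) (inj₂ (inj₁ c)) = all-kinds o₂ o₃ o₁ b c a
  go (inj₂ (inj₂ a)) (inj₂ (inj₁ b)) (inj₁ c) = all-kinds o₃ o₂ o₁ c b a

-- Below (k+1)² no term is divisible by the square of a prime above `k`, so all three positions
-- would be `Strong`, while only d and k - d are.
window-incompatible : ∀ {k n d} → n < suc k * suc k → k < n → Window k n → ¬ Compatible k n d
window-incompatible {k} {n} {d} n< k<n w comp = strong-unique {k} {d} (mapThree id (λ _ _ → id) entry w)
  where
  entry : ∀ {l} → l ≤ k × HasPrimeAbove k (n ∸ l) → Strong k d l
  entry {l} (l≤k , p , _ , pp , k<p , p∣) = Compatible.strong comp l≤k pp k<p p∣
    λ p²∣ → <⇒≱ n< (≤-trans (*-mono-≤ k<p k<p) (≤-trans (∣⇒≤′ (m<n⇒0<n∸m (≤-<-trans l≤k k<n)) p²∣) (m∸n≤m n l)))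

oddWindow-incompatible : ∀ {k n d} → OddWindow k n → ¬ Compatible k n d
oddWindow-incompatible {k} {n} {d} w comp = odd-weak-unique {k} {d} (mapThree id (λ _ _ → id)
  (λ { (l≤k , o , p , _ , pp , k<p , p∣) → o , Compatible.weak comp l≤k pp k<p p∣ }) w)

-- For k ≤ 12 three large primes need not exist, and every d is tested.

allBelow anyBelow : ℕ → (ℕ → Bool) → Bool
allBelow zero f = true
allBelow (suc s) f = f s ∧ allBelow s f
anyBelow zero f = false
anyBelow (suc s) f = f s ∨ anyBelow s f

allBelow-sound : ∀ s f → allBelow s f ≡ true → ∀ {i} → i < s → f i ≡ true
allBelow-sound (suc s) f e {i} i<s with ∧-true {f s} e | m≤n⇒m<n∨m≡n (≤-pred i<s)
... | _ , e′ | inj₁ i<s′ = allBelow-sound s f e′ i<s′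
... | e′ , _ | inj₂ refl = e′

anyBelow-sound : ∀ s f → anyBelow s f ≡ true → ∃ λ i → i < s × f i ≡ true
anyBelow-sound (suc s) f e with f s in eq
... | true = s , ≤-refl , eq
... | false with anyBelow-sound s f e
...   | i , i<s , fi = i , m<n⇒m<1+n i<s , fi

strong? weak? : ℕ → ℕ → ℕ → Bool
strong? k d l = (l ≡ᵇ d) ∨ (l + d ≡ᵇ k)
weak? k d l = strong? k d l ∨ (l ≡ᵇ 2 * d) ∨ (l + 2 * d ≡ᵇ k) ∨ (l + 2 * d ≡ᵇ 2 * k) ∨ (l + k ≡ᵇ 2 * d) ∨ ((2 * d ≡ᵇ k) ∧ divides? 2 l)

≡⇒≡ᵇtrue : ∀ {m n} → m ≡ n → (m ≡ᵇ n) ≡ true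
≡⇒≡ᵇtrue {m} refl = ≡ᵇ-refl m

∨-introˡ : ∀ {a} b → a ≡ true → a ∨ b ≡ true
∨-introˡ b refl = refl

∨-introʳ : ∀ a {b} → b ≡ true → a ∨ b ≡ true
∨-introʳ a refl = ∨-true a

strong?-complete : ∀ {k d l} → Strong k d l → strong? k d l ≡ true
strong?-complete {k} {d} {l} (inj₁ e) = ∨-introˡ (l + d ≡ᵇ k) (≡⇒≡ᵇtrue e)
strong?-complete {k} {d} {l} (inj₂ e) = ∨-introʳ (l ≡ᵇ d) (≡⇒≡ᵇtrue e)

weak?-complete : ∀ {k d l} → Weak k d l → weak? k d l ≡ true
weak?-complete {k} {d} {l} (inj₁ s) = ∨-introˡ _ (strong?-complete {k} {d} {l} s)
weak?-complete {k} {d} {l} (inj₂ w) = ∨-introʳ (strong? k d l) (rest w)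
  where
  rest : l ≡ 2 * d ⊎ l + 2 * d ≡ k ⊎ l + 2 * d ≡ 2 * k ⊎ l + k ≡ 2 * d ⊎ (2 * d ≡ k × ∃ λ i → l ≡ 2 * i) →
    (l ≡ᵇ 2 * d) ∨ (l + 2 * d ≡ᵇ k) ∨ (l + 2 * d ≡ᵇ 2 * k) ∨ (l + k ≡ᵇ 2 * d) ∨ ((2 * d ≡ᵇ k) ∧ divides? 2 l) ≡ true
  rest (inj₁ e) = ∨-introˡ _ (≡⇒≡ᵇtrue e)
  rest (inj₂ (inj₁ e)) = ∨-introʳ (l ≡ᵇ 2 * d) (∨-introˡ _ (≡⇒≡ᵇtrue e))
  rest (inj₂ (inj₂ (inj₁ e))) = ∨-introʳ (l ≡ᵇ 2 * d) (∨-introʳ (l + 2 * d ≡ᵇ k) (∨-introˡ _ (≡⇒≡ᵇtrue e)))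
  rest (inj₂ (inj₂ (inj₂ (inj₁ e)))) = ∨-introʳ (l ≡ᵇ 2 * d) (∨-introʳ (l + 2 * d ≡ᵇ k) (∨-introʳ (l + 2 * d ≡ᵇ 2 * k)
    (∨-introˡ _ (≡⇒≡ᵇtrue e))))
  rest (inj₂ (inj₂ (inj₂ (inj₂ (e , i , l≡))))) = ∨-introʳ (l ≡ᵇ 2 * d) (∨-introʳ (l + 2 * d ≡ᵇ k) (∨-introʳ (l + 2 * d ≡ᵇ 2 * k)
    (∨-introʳ (l + k ≡ᵇ 2 * d) (cong₂ _∧_ (≡⇒≡ᵇtrue e) (divides?-complete 2 l (s≤s z≤n) (divides i (trans l≡ (*-comm 2 i))))))))

-- `i` stands for the root i + 1; roots up to 46 are enough since x < 47² = 2209. Composite roots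
-- are tried as well, which only makes the test stricter.
noSquare? : ℕ → ℕ → Bool
noSquare? k x = allBelow 46 (λ i → (i <ᵇ k) ∨ not (divides? (suc i * suc i) x))

-- The large prime itself stays unknown: an l that is not `Weak` refutes d for any such prime, and
-- an l that is not `Strong` does so if no square of a number above `k` divides n - l.
excludes? : (k n M d l : ℕ) → Bool
excludes? k n M d l = not (divides? (n ∸ l) M) ∧ (not (weak? k d l) ∨ (noSquare? k (n ∸ l) ∧ not (strong? k d l)))

exceptional? : ℕ → ℕ → Bool
exceptional? k n = (n ≡ᵇ 2 * k) ∧ ((k ≡ᵇ 4) ∨ (k ≡ᵇ 5) ∨ (k ≡ᵇ 6) ∨ (k ≡ᵇ 8))

checkDegrees : (k M n : ℕ) → Bool
checkDegrees k M n = exceptional? k n ∨ allBelow (pred k) (λ d → anyBelow (suc k) (excludes? k n M (suc d)))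

checkSmall : ℕ → ℕ → Bool
checkSmall k M = allBelow (cube (suc k) ∸ 2 * k) (λ i → checkDegrees k M (2 * k + i))

-- The nine values are 4 ≤ k ≤ 12, and the exponent 12 is admissible because n < 13³ < 2^12.
small-ok : allBelow 9 (λ i → checkSmall (4 + i) (((4 + i) !) ^ 12)) ≡ true
small-ok = refl

not-true : ∀ {b} → not b ≡ true → b ≡ false
not-true {false} _ = refl

∨-elim : ∀ {a b} → a ∨ b ≡ true → a ≡ true ⊎ b ≡ true
∨-elim {true} _ = inj₁ refl
∨-elim {false} e = inj₂ e

true≢false : ∀ {b} → b ≡ true → b ≢ false
true≢false refl ()

noSquare?-sound : ∀ {k x p} → 0 < x → x < 2209 → noSquare? k x ≡ true → k < p → ¬ p * p ∣ x
noSquare?-sound {k} {x} {suc i} 0<x x< e k<p p²∣x with ∨-elim (allBelow-sound 46 (λ i → (i <ᵇ k) ∨ not (divides? (suc i * suc i) x)) e i<46)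
  where
  i<46 : i < 46
  i<46 = ≰⇒> λ 46≤i → <⇒≱ x< (≤-trans (*-mono-≤ (s≤s 46≤i) (s≤s 46≤i)) (∣⇒≤′ 0<x p²∣x))
... | inj₁ i<k = <⇒≱ k<p (<ᵇ-sound i<k)
... | inj₂ e′ = true≢false (divides?-complete (suc i * suc i) x (s≤s z≤n) p²∣x) (not-true e′)

excludes?-sound : ∀ {k n d l} → l ≤ k → k < n → n < 2209 → excludes? k n ((k !) ^ 12) d l ≡ true → ¬ Compatible k n d
excludes?-sound {k} {n} {d} {l} l≤k k<n n< e comp with ∧-true e
... | e₁ , e₂ = [ no-weak , (λ e₃ → no-strong (∧-true e₃)) ]′ (∨-elim e₂)
  where
  open Compatible comp
  0<x : 0 < n ∸ l
  0<x = m<n⇒0<n∸m (≤-<-trans l≤k k<n)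
  x< : n ∸ l < 2209
  x< = ≤-<-trans (m∸n≤m n l) n<
  above : HasPrimeAbove k (n ∸ l)
  above = nonsmooth-sound {e = 12} 0<x (<-≤-trans x< (≤ᵇ-sound {2209} {2 ^ 12} refl)) (not-true e₁)
  p = proj₁ above
  pp = proj₁ (proj₂ (proj₂ above))
  k<p = proj₁ (proj₂ (proj₂ (proj₂ above)))
  p∣ = proj₂ (proj₂ (proj₂ (proj₂ above)))
  no-weak : not (weak? k d l) ≡ true → ⊥
  no-weak h = true≢false (weak?-complete {k} {d} {l} (weak l≤k pp k<p p∣)) (not-true h)
  no-strong : noSquare? k (n ∸ l) ≡ true × not (strong? k d l) ≡ true → ⊥
  no-strong (h , h′) = true≢false (strong?-complete {k} {d} {l} (strong l≤k pp k<p p∣ (noSquare?-sound 0<x x< h k<p))) (not-true h′)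

Exceptional : ℕ → ℕ → Set
Exceptional k n = (n ≡ 8 × k ≡ 4) ⊎ (n ≡ 10 × k ≡ 5) ⊎ (n ≡ 12 × k ≡ 6) ⊎ (n ≡ 16 × k ≡ 8)

exceptional?-sound : ∀ k n → exceptional? k n ≡ true → Exceptional k n
exceptional?-sound k n e with ∧-true e
... | e₁ , e₂ with ∨-elim {k ≡ᵇ 4} e₂
...   | inj₁ h with refl ← ≡true⇒≡ {k} {4} h = inj₁ (≡true⇒≡ e₁ , refl)
...   | inj₂ e₃ with ∨-elim {k ≡ᵇ 5} e₃
...     | inj₁ h with refl ← ≡true⇒≡ {k} {5} h = inj₂ (inj₁ (≡true⇒≡ e₁ , refl))
...     | inj₂ e₄ with ∨-elim {k ≡ᵇ 6} e₄
...       | inj₁ h with refl ← ≡true⇒≡ {k} {6} h = inj₂ (inj₂ (inj₁ (≡true⇒≡ e₁ , refl)))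
...       | inj₂ h with refl ← ≡true⇒≡ {k} {8} h = inj₂ (inj₂ (inj₂ (≡true⇒≡ e₁ , refl)))

checkSmall-sound : ∀ k n d → checkSmall k ((k !) ^ 12) ≡ true → 4 ≤ k → k ≤ 12 → 2 * k ≤ n → n < cube (suc k) → k < n →
  ¬ Exceptional k n → 0 < d → d < k → ¬ Compatible k n d
checkSmall-sound k n (suc d) ok 4≤k k≤12 2k≤n n< k<n ¬exc _ d<k comp
  with ∨-elim (subst (λ z → checkDegrees k ((k !) ^ 12) z ≡ true) (m+[n∸m]≡n 2k≤n)
                (allBelow-sound (cube (suc k) ∸ 2 * k) (λ i → checkDegrees k ((k !) ^ 12) (2 * k + i)) ok (∸-monoˡ-< n< 2k≤n)))
... | inj₁ e = ¬exc (exceptional?-sound k n e)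
... | inj₂ e with anyBelow-sound (suc k) _ (allBelow-sound (pred k) (λ d → anyBelow (suc k) (excludes? k n ((k !) ^ 12) (suc d))) e
                    (<⇒≤pred d<k))
...   | l , l<1+k , e′ = excludes?-sound (≤-pred l<1+k) k<n
  (<-≤-trans n< (≤-trans (*-mono-≤ (s≤s k≤12) (*-mono-≤ (s≤s k≤12) (s≤s k≤12))) (≤ᵇ-sound {2197} {2209} refl))) e′ comp

incompatible : ∀ k n → 4 ≤ k → 2 * k ≤ n → n < cube (suc k) → ¬ Exceptional k n →
  ∀ d → 0 < d → d < k → ¬ Compatible k n d
incompatible k n 4≤k 2k≤n n< ¬exc d 0<d d<k = go
  where
  0<k : 0 < k
  0<k = ≤-trans (s≤s z≤n) 4≤k
  k<n : k < n
  k<n = <-≤-trans (m<m+n k (≤-trans 0<k (≤-reflexive (sym (+-identityʳ k))))) 2k≤n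
  from-windows : (n < suc k * suc k → Window k n) → (suc k * suc k ≤ n → OddWindow k n) → ¬ Compatible k n d
  from-windows low odd with n <? suc k * suc k
  ... | yes h = window-incompatible h k<n (low h)
  ... | no h = oddWindow-incompatible (odd (≮⇒≥ h))
  go : ¬ Compatible k n d
  go with k ≤? 12
  ... | yes k≤12 = checkSmall-sound k n d
    (subst (λ z → checkSmall z ((z !) ^ 12) ≡ true) (m+[n∸m]≡n 4≤k)
      (allBelow-sound 9 (λ i → checkSmall (4 + i) (((4 + i) !) ^ 12)) small-ok {k ∸ 4} (s≤s (∸-monoˡ-≤ 4 k≤12))))
    4≤k k≤12 2k≤n n< k<n ¬exc 0<d d<k
  ... | no k≰12 with k <? 74
  ...   | yes k<74 = from-windows (λ h → proj₁ (smallWindows k (≰⇒> k≰12) k<74) n 2k≤n h)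
                       (λ h → proj₂ (smallWindows k (≰⇒> k≰12) k<74) n h n<)
  ...   | no k≮74 with k <? 16384
  ...     | yes k<K = from-windows (λ _ → block-window (primeBlock k (≮⇒≥ k≮74) k<K) 0<k 2k≤n)
                        (block-oddWindow (oddBlock k (≮⇒≥ k≮74) k<K) 0<k)
  ...     | no k≮K = from-windows (λ _ → LargeWindow.window k n (≮⇒≥ k≮K) 2k≤n)
                       (large-oddWindow k n (≮⇒≥ k≮K))

-- Factorisations modulo prime powers and the edges of Newton polygons

ι : ℕ → ℤ
ι n = ℤ.+ n

-- f is, up to degree dg + dh, the product of G (degree ≤ dg) and H (degree ≤ dh): modulo any q dividing all
-- other terms of the convolution at a₀ + b₀, the coefficient agrees with G a₀ H b₀ as far as divisibility is concerned.
-- This form is visibly symmetric and stable under reversal of the coefficients.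
Product : (f G H : ℕ → ℤ) (dg dh : ℕ) → Set
Product f G H dg dh = ∀ q a₀ b₀ → a₀ ≤ dg → b₀ ≤ dh →
  (∀ a b → a ≤ dg → b ≤ dh → a + b ≡ a₀ + b₀ → a ≢ a₀ → q ∣ᶻ G a ℤ.* H b) →
  (q ∣ᶻ f (a₀ + b₀) → q ∣ᶻ G a₀ ℤ.* H b₀) × (q ∣ᶻ G a₀ ℤ.* H b₀ → q ∣ᶻ f (a₀ + b₀))

Product-swap : ∀ {f G H dg dh} → Product f G H dg dh → Product f H G dh dg
Product-swap {f} {G} {H} P q b₀ a₀ b₀≤ a₀≤ others =
  (λ h → comm (G a₀) (H b₀) (proj₁ iso (subst (λ z → q ∣ᶻ f z) (+-comm b₀ a₀) h))) ,
  (λ h → subst (λ z → q ∣ᶻ f z) (+-comm a₀ b₀) (proj₂ iso (comm (H b₀) (G a₀) h)))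
  where
  comm : ∀ x y → q ∣ᶻ x ℤ.* y → q ∣ᶻ y ℤ.* x
  comm x y = subst (q ∣ᶻ_) (ℤ.*-comm x y)
  iso = P q a₀ b₀ a₀≤ b₀≤ λ a b a≤ b≤ eq a≢ → comm (H b) (G a) (others b a b≤ a≤ (trans (+-comm b a) (trans eq (+-comm a₀ b₀)))
    λ { refl → a≢ (+-cancelʳ-≡ b a a₀ eq) })

-- Beyond `d` truncated subtraction repeats `G 0`; `Product` and `First` look only at indices up to
-- the degree.
reverse : ℕ → (ℕ → ℤ) → ℕ → ℤ
reverse d G a = G (d ∸ a)

∸-+-∸ : ∀ {a b m n} → a ≤ m → b ≤ n → (m ∸ a) + (n ∸ b) ≡ m + n ∸ (a + b)
∸-+-∸ {a} {b} {m} {n} a≤m b≤n = sym (trans (cong (_∸ (a + b)) eq) (m+n∸n≡m ((m ∸ a) + (n ∸ b)) (a + b)))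
  where
  shuffle : ∀ x a y b → x + a + (y + b) ≡ x + y + (a + b)
  shuffle = solve-∀
  eq : m + n ≡ (m ∸ a) + (n ∸ b) + (a + b)
  eq = trans (cong₂ _+_ (sym (m∸n+n≡m a≤m)) (sym (m∸n+n≡m b≤n))) (shuffle (m ∸ a) a (n ∸ b) b)

-- Reversal turns the right edge of the Newton polygon into a left edge, so edges are studied only
-- at the constant coefficient.
Product-reverse : ∀ {f G H dg dh} → Product f G H dg dh → Product (reverse (dg + dh) f) (reverse dg G) (reverse dh H) dg dh
Product-reverse {f} {G} {H} {dg} {dh} P q a₀ b₀ a₀≤ b₀≤ others =
  (λ h → proj₁ iso (subst (λ z → q ∣ᶻ f z) (sym index) h)) , (λ h → subst (λ z → q ∣ᶻ f z) index (proj₂ iso h))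
  where
  index : (dg ∸ a₀) + (dh ∸ b₀) ≡ dg + dh ∸ (a₀ + b₀)
  index = ∸-+-∸ a₀≤ b₀≤
  iso = P q (dg ∸ a₀) (dh ∸ b₀) (m∸n≤m dg a₀) (m∸n≤m dh b₀) λ a b a≤ b≤ eq a≢ →
    subst₂ (λ x y → q ∣ᶻ G x ℤ.* H y) (m∸[m∸n]≡n a≤) (m∸[m∸n]≡n b≤)
      (others (dg ∸ a) (dh ∸ b) (m∸n≤m dg a) (m∸n≤m dh b)
        (trans (∸-+-∸ a≤ b≤) (trans (cong (dg + dh ∸_) (trans eq index)) (m∸[m∸n]≡n (+-mono-≤ a₀≤ b₀≤))))
        (λ e → a≢ (trans (sym (m∸[m∸n]≡n a≤)) (cong (dg ∸_) e))))

ι-euclid : ∀ {p} → Prime p → ∀ x y → ι p ∣ᶻ x ℤ.* y → ι p ∣ᶻ x ⊎ ι p ∣ᶻ y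
ι-euclid {p} pp x y d with euclidsLemma ℤ.∣ x ∣ ℤ.∣ y ∣ pp (subst (p ∣_) (ℤ.abs-* x y) (ℤ∣.∣⇒∣ᵤ d))
... | inj₁ e = inj₁ (ℤ∣.∣ᵤ⇒∣ e)
... | inj₂ e = inj₂ (ℤ∣.∣ᵤ⇒∣ e)

ι-nonZero : ∀ {p} → Prime p → ℤ.NonZero (ι p)
ι-nonZero {suc p} _ = _
ι-nonZero {zero} pp = ⊥-elim (¬prime[0] pp)

*-pres-∣ᶻ : ∀ {p q x y} → p ∣ᶻ x → q ∣ᶻ y → p ℤ.* q ∣ᶻ x ℤ.* y
*-pres-∣ᶻ {p} {q} {x} {y} p∣x q∣y = ℤ∣.∣-trans (ℤ∣.*-monoˡ-∣ q p∣x) (ℤ∣.*-monoʳ-∣ x q∣y)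

square-∣-cofactor : ∀ {p} → Prime p → ∀ x y → ¬ ι p ∣ᶻ x → ι p ℤ.* ι p ∣ᶻ x ℤ.* y → ι p ℤ.* ι p ∣ᶻ y
square-∣-cofactor {p} pp x y p∤x d with ι-euclid pp x y (ℤ∣.∣-trans (ℤ∣.∣m⇒∣m*n (ι p) ℤ∣.∣-refl) d)
... | inj₁ e = ⊥-elim (p∤x e)
... | inj₂ (ℤ∣.divides z refl) with ι-euclid pp x z (ℤ∣.*-cancelʳ-∣ (ι p) {{ι-nonZero pp}} (subst (ι p ℤ.* ι p ∣ᶻ_) (sym (ℤ.*-assoc x z (ι p))) d))
...   | inj₁ e = ⊥-elim (p∤x e)
...   | inj₂ e = ℤ∣.*-monoˡ-∣ (ι p) e

-- `index` is the order of vanishing of G modulo p at 0, the point where the left edge of the Newton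
-- polygon reaches height 0.
record First (p : ℕ) (G : ℕ → ℤ) (d : ℕ) : Set where
  constructor first
  field
    index : ℕ
    index≤ : index ≤ d
    nondiv : ¬ ι p ∣ᶻ G index
    below : ∀ a → a < index → ι p ∣ᶻ G a

open First public

findFirst : ∀ p G d → (∀ a → a ≤ d → ι p ∣ᶻ G a) ⊎ First p G d
findFirst p G zero with ι p ∣ᶻ? G 0
... | yes h = inj₁ λ { _ z≤n → h }
... | no h = inj₂ (first 0 z≤n h λ _ ())
findFirst p G (suc d) with findFirst p G d
... | inj₂ (first i i≤ h b) = inj₂ (first i (m≤n⇒m≤1+n i≤) h b)
... | inj₁ all with ι p ∣ᶻ? G (suc d)
...   | no h = inj₂ (first (suc d) ≤-refl h λ a a< → all a (≤-pred a<))
...   | yes h = inj₁ λ a a≤ → [ (λ a< → all a (≤-pred a<)) , (λ { refl → h }) ]′ (m≤n⇒m<n∨m≡n a≤)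

split-index : ∀ l dg dh → l ≤ dg + dh → ∃₂ λ a b → a ≤ dg × b ≤ dh × a + b ≡ l
split-index l dg dh l≤ with ≤-total l dg
... | inj₁ l≤dg = l , 0 , l≤dg , z≤n , +-identityʳ l
... | inj₂ dg≤l = dg , l ∸ dg , ≤-refl , m≤n+o⇒m∸n≤o l dg l≤ , m+[n∸m]≡n dg≤l

∣-all : ∀ {f G H dg dh p} → Product f G H dg dh → (∀ a → a ≤ dg → ι p ∣ᶻ G a) → ∀ l → l ≤ dg + dh → ι p ∣ᶻ f l
∣-all {f} {G} {H} {dg} {dh} {p} P all l l≤ with split-index l dg dh l≤
... | a , b , a≤ , b≤ , refl = proj₂ (P (ι p) a b a≤ b≤ λ a′ b′ a′≤ _ _ _ → ℤ∣.∣m⇒∣m*n (H b′) (all a′ a′≤))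
  (ℤ∣.∣m⇒∣m*n (H b) (all a a≤))

-- In the coefficient at the sum of the two indices, every other term has a factor to the left of
-- its `index` and is divisible by p.
first-product : ∀ {f G H dg dh p} → Prime p → Product f G H dg dh → (I : First p G dg) (J : First p H dh) →
  ¬ ι p ∣ᶻ f (index I + index J)
first-product {f} {G} {H} {dg} {dh} {p} pp P I J d =
  [ nondiv I , nondiv J ]′ (ι-euclid pp (G (index I)) (H (index J)) (proj₁ (P (ι p) (index I) (index J) (index≤ I) (index≤ J) others) d))
  where
  others : ∀ a b → a ≤ dg → b ≤ dh → a + b ≡ index I + index J → a ≢ index I → ι p ∣ᶻ G a ℤ.* H b
  others a b _ _ eq a≢ with <-cmp a (index I)
  ... | tri< a<i _ _ = ℤ∣.∣m⇒∣m*n (H b) (below I a a<i)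
  ... | tri≈ _ e _ = ⊥-elim (a≢ e)
  ... | tri> _ _ i<a = ℤ∣.∣n⇒∣m*n (G a) (below J b (+-cancelˡ-< (index I) b (index J) (<-≤-trans (+-monoˡ-< b i<a) (≤-reflexive eq))))

-- Modulo p the product is a monomial of degree l, so the orders of vanishing of the two factors add
-- up to l.
firsts : ∀ {f G H dg dh p l} → Prime p → Product f G H dg dh → l ≤ dg + dh → ¬ ι p ∣ᶻ f l →
  (∀ j → j ≤ dg + dh → j ≢ l → ι p ∣ᶻ f j) →
  Σ (First p G dg) λ I → Σ (First p H dh) λ J → index I + index J ≡ l
firsts {f} {G} {H} {dg} {dh} {p} {l} pp P l≤ p∤ others with findFirst p G dg | findFirst p H dh
... | inj₁ all | _ = ⊥-elim (p∤ (∣-all {f} {G} {H} P all l l≤))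
... | inj₂ _ | inj₁ all = ⊥-elim (p∤ (∣-all {f} {H} {G} (Product-swap {f} {G} {H} P) all l (subst (l ≤_) (+-comm dg dh) l≤)))
... | inj₂ I | inj₂ J with index I + index J ≟ l
...   | yes eq = I , J , eq
...   | no ne = ⊥-elim (first-product {f} {G} {H} pp P I J (others _ (+-mono-≤ (index≤ I) (index≤ J)) ne))

product₀ : ∀ {f G H dg dh} → Product f G H dg dh → ∀ q → q ∣ᶻ G 0 ℤ.* H 0 → q ∣ᶻ f 0
product₀ P q = proj₂ (P q 0 0 z≤n z≤n λ { zero b _ _ _ a≢ → ⊥-elim (a≢ refl) })

-- edge₁ and edge₂ treat a left edge of the Newton polygon of height 1 and 2.
edge₁ : ∀ {f G H dg dh p l} → Product f G H dg dh → (I : First p G dg) (J : First p H dh) → index I + index J ≡ l →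
  (0 < l → ¬ ι p ℤ.* ι p ∣ᶻ f 0) → index I ≡ 0 ⊎ index J ≡ 0
edge₁ {f} {G} {H} {p = p} P I J eq p²∤ with index I in eqI | index J in eqJ
... | zero | _ = inj₁ refl
... | suc i | zero = inj₂ refl
... | suc i | suc j = ⊥-elim (p²∤ (subst (0 <_) eq (s≤s z≤n)) (product₀ {f} {G} {H} P (ι p ℤ.* ι p)
  (*-pres-∣ᶻ (below I 0 (subst (0 <_) (sym eqI) (s≤s z≤n))) (below J 0 (subst (0 <_) (sym eqJ) (s≤s z≤n))))))

-- In the coefficient at i = `index I`, every term other than G_i H_0 has a < i and b < `index J`,
-- so p² divides it. Hence p² divides H_0, and with p dividing G_0 the edge would have height above
-- 2.
edge₂-< : ∀ {f G H dg dh p l} → Prime p → Product f G H dg dh → (I : First p G dg) (J : First p H dh) →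
  index I + index J ≡ l → (∀ j → j < l → ι p ℤ.* ι p ∣ᶻ f j) → ¬ ι p ℤ.* ι p ℤ.* ι p ∣ᶻ f 0 →
  0 < index I → index I < index J → ⊥
edge₂-< {f} {G} {H} {dg} {dh} {p} {l} pp P I J eq p²∣ p³∤ 0<i i<j = p³∤ (product₀ {f} {G} {H} P (ι p ℤ.* ι p ℤ.* ι p)
  (subst₂ _∣ᶻ_ (sym (ℤ.*-assoc (ι p) (ι p) (ι p))) refl (*-pres-∣ᶻ (below I 0 0<i) p²∣H₀)))
  where
  i = index I
  j = index J
  others : ∀ a b → a ≤ dg → b ≤ dh → a + b ≡ i + 0 → a ≢ i → ι p ℤ.* ι p ∣ᶻ G a ℤ.* H b
  others a b _ _ e a≢ = *-pres-∣ᶻ (below I a (≤∧≢⇒< a≤i a≢)) (below J b (≤-<-trans b≤i i<j))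
    where
    a≤i : a ≤ i
    a≤i = ≤-trans (m≤m+n a b) (≤-reflexive (trans e (+-identityʳ i)))
    b≤i : b ≤ i
    b≤i = ≤-trans (m≤n+m b a) (≤-reflexive (trans e (+-identityʳ i)))
  p²∣H₀ : ι p ℤ.* ι p ∣ᶻ H 0
  p²∣H₀ = square-∣-cofactor pp (G i) (H 0) (nondiv I) (proj₁ (P (ι p ℤ.* ι p) i 0 (index≤ I) z≤n others)
    (p²∣ (i + 0) (subst (i + 0 <_) eq (+-monoʳ-< i (≤-<-trans z≤n i<j)))))

edge₂ : ∀ {f G H dg dh p l} → Prime p → Product f G H dg dh → (I : First p G dg) (J : First p H dh) →
  index I + index J ≡ l → (∀ j → j < l → ι p ℤ.* ι p ∣ᶻ f j) → (0 < l → ¬ ι p ℤ.* ι p ℤ.* ι p ∣ᶻ f 0) →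
  index I ≡ 0 ⊎ index J ≡ 0 ⊎ index I ≡ index J
edge₂ {f} {G} {H} {dg} {dh} {p} {l} pp P I J eq p²∣ p³∤ with index I ≟ 0 | index J ≟ 0
... | yes e | _ = inj₁ e
... | no _ | yes e = inj₂ (inj₁ e)
... | no i≢0 | no j≢0 with <-cmp (index I) (index J)
...   | tri≈ _ e _ = inj₂ (inj₂ e)
...   | tri< i<j _ _ = ⊥-elim (edge₂-< {f} {G} {H} pp P I J eq p²∣ (p³∤ 0<l) (n≢0⇒n>0 i≢0) i<j)
  where 0<l = subst (0 <_) eq (<-≤-trans (n≢0⇒n>0 i≢0) (m≤m+n (index I) (index J)))
...   | tri> _ _ j<i = ⊥-elim (edge₂-< {f} {H} {G} pp (Product-swap {f} {G} {H} P) J I (trans (+-comm (index J) (index I)) eq)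
        p²∣ (p³∤ 0<l) (n≢0⇒n>0 j≢0) j<i)
  where 0<l = subst (0 <_) eq (<-≤-trans (n≢0⇒n>0 i≢0) (m≤m+n (index I) (index J)))

-- The first nondivisible coefficients of G, H and of their reversals sit at the same vertex, so the degrees are the
-- sums of the horizontal lengths of the left and right edges.
degrees : ∀ {G H dg dh p l} (I : First p G dg) (J : First p H dh)
  (I′ : First p (reverse dg G) dg) (J′ : First p (reverse dh H) dh) → l ≤ dg + dh →
  index I + index J ≡ l → index I′ + index J′ ≡ dg + dh ∸ l → dg ≡ index I + index I′ × dh ≡ index J + index J′
degrees {G} {H} {dg} {dh} {p} {l} I J I′ J′ l≤ eq eq′ = ≤-antisym dg≤ (vertex I I′) , ≤-antisym dh≤ (vertex J J′)
  where
  vertex : ∀ {G d} (I : First p G d) (I′ : First p (reverse d G) d) → index I + index I′ ≤ d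
  vertex {G} {d} I I′ = ≮⇒≥ λ d<i+i′ → nondiv I′ (below I (d ∸ index I′)
    (+-cancelʳ-< (index I′) (d ∸ index I′) (index I) (subst (_< index I + index I′) (sym (m∸n+n≡m (index≤ I′))) d<i+i′)))
  total : (index I + index I′) + (index J + index J′) ≡ dg + dh
  total = trans (shuffle (index I) (index I′) (index J) (index J′)) (trans (cong₂ _+_ eq eq′) (m+[n∸m]≡n l≤))
    where shuffle : ∀ a b c d → (a + b) + (c + d) ≡ (a + c) + (b + d)
          shuffle = solve-∀
  dg≤ : dg ≤ index I + index I′
  dg≤ = +-cancelʳ-≤ dh _ _ (≤-trans (≤-reflexive (sym total)) (+-monoʳ-≤ (index I + index I′) (vertex J J′)))
  dh≤ : dh ≤ index J + index J′
  dh≤ = +-cancelˡ-≤ dg _ _ (≤-trans (≤-reflexive (sym total)) (+-monoˡ-≤ (index J + index J′) (vertex I I′)))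

strong-arith : ∀ {i j i′ j′ dg dh} → dg ≡ i + i′ → dh ≡ j + j′ → 0 < dg → 0 < dh → i ≡ 0 ⊎ j ≡ 0 → i′ ≡ 0 ⊎ j′ ≡ 0 →
  Strong (dg + dh) dg (i + j)
strong-arith refl refl 0<dg 0<dh (inj₁ refl) (inj₁ refl) = ⊥-elim (<-irrefl refl 0<dg)
strong-arith {j = j} {i′} refl refl _ _ (inj₁ refl) (inj₂ refl) = inj₂ (trans (+-comm j i′) (cong (i′ +_) (sym (+-identityʳ j))))
strong-arith {i} refl refl _ _ (inj₂ refl) (inj₁ refl) = inj₁ refl
strong-arith refl refl _ 0<dh (inj₂ refl) (inj₂ refl) = ⊥-elim (<-irrefl refl 0<dh)

-- `i` and `j` are the shares of the two factors in the left edge, `i′` and `j′` those in the right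
-- edge. An edge goes to one factor or is halved: no halving is `Strong`, one halved edge gives the
-- four equations in 2d, two give 2d = k with l even.
weak-arith : ∀ {i j i′ j′ dg dh} → dg ≡ i + i′ → dh ≡ j + j′ → 0 < dg → 0 < dh →
  i ≡ 0 ⊎ j ≡ 0 ⊎ i ≡ j → i′ ≡ 0 ⊎ j′ ≡ 0 ⊎ i′ ≡ j′ → Weak (dg + dh) dg (i + j)
weak-arith e e′ h h′ (inj₁ a) (inj₁ b) = inj₁ (strong-arith e e′ h h′ (inj₁ a) (inj₁ b))
weak-arith e e′ h h′ (inj₁ a) (inj₂ (inj₁ b)) = inj₁ (strong-arith e e′ h h′ (inj₁ a) (inj₂ b))
weak-arith e e′ h h′ (inj₂ (inj₁ a)) (inj₁ b) = inj₁ (strong-arith e e′ h h′ (inj₂ a) (inj₁ b))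
weak-arith e e′ h h′ (inj₂ (inj₁ a)) (inj₂ (inj₁ b)) = inj₁ (strong-arith e e′ h h′ (inj₂ a) (inj₂ b))
weak-arith {i} {j} {i′} refl refl _ _ (inj₁ refl) (inj₂ (inj₂ refl)) = inj₂ (inj₂ (inj₁ (eq i′ j)))
  where eq : ∀ i′ j → 0 + j + 2 * (0 + i′) ≡ 0 + i′ + (j + i′)
        eq = solve-∀
weak-arith {i} {j} {i′} refl refl _ _ (inj₂ (inj₁ refl)) (inj₂ (inj₂ refl)) = inj₂ (inj₂ (inj₂ (inj₂ (inj₁ (eq i i′)))))
  where eq : ∀ i i′ → i + 0 + (i + i′ + (0 + i′)) ≡ 2 * (i + i′)
        eq = solve-∀
weak-arith {i} {j} {i′} {j′} refl refl _ _ (inj₂ (inj₂ refl)) (inj₁ refl) = inj₂ (inj₁ (eq i))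
  where eq : ∀ i → i + i ≡ 2 * (i + 0)
        eq = solve-∀
weak-arith {i} {j} {i′} {j′} refl refl _ _ (inj₂ (inj₂ refl)) (inj₂ (inj₁ refl)) = inj₂ (inj₂ (inj₂ (inj₁ (eq i i′))))
  where eq : ∀ i i′ → i + i + 2 * (i + i′) ≡ 2 * (i + i′ + (i + 0))
        eq = solve-∀
weak-arith {i} {j} {i′} {j′} refl refl _ _ (inj₂ (inj₂ refl)) (inj₂ (inj₂ refl)) =
  inj₂ (inj₂ (inj₂ (inj₂ (inj₂ (eq i i′ , i , eq′ i)))))
  where eq : ∀ i i′ → 2 * (i + i′) ≡ i + i′ + (i + i′)
        eq = solve-∀
        eq′ : ∀ i → i + i ≡ 2 * i
        eq′ = solve-∀

local-firsts : ∀ {f G H dg dh p l} → Prime p → Product f G H dg dh → l ≤ dg + dh → ¬ ι p ∣ᶻ f l →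
  (∀ j → j ≤ dg + dh → j ≢ l → ι p ∣ᶻ f j) →
  Σ (First p (reverse dg G) dg) λ I → Σ (First p (reverse dh H) dh) λ J → index I + index J ≡ dg + dh ∸ l
local-firsts {f} {G} {H} {dg} {dh} {p} {l} pp P l≤ p∤ p∣ =
  firsts {reverse (dg + dh) f} {reverse dg G} {reverse dh H} pp (Product-reverse {f} {G} {H} P) (m∸n≤m (dg + dh) l)
    (subst (λ z → ¬ ι p ∣ᶻ f z) (sym (m∸[m∸n]≡n l≤)) p∤)
    (λ j j≤ j≢ → p∣ (dg + dh ∸ j) (m∸n≤m (dg + dh) j) λ e → j≢ (trans (sym (m∸[m∸n]≡n j≤)) (cong (dg + dh ∸_) e)))

-- The vertex may be an end point: for l = 0 or l = dg + dh one edge is missing. This is why `edge₁`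
-- asks about `f 0` only under `0 < l`.
strong-local : ∀ {f G H dg dh p l} → Prime p → Product f G H dg dh → 0 < dg → 0 < dh → l ≤ dg + dh →
  ¬ ι p ∣ᶻ f l → (∀ j → j ≤ dg + dh → j ≢ l → ι p ∣ᶻ f j) →
  (∀ j → j ≤ dg + dh → j ≢ l → ¬ ι p ℤ.* ι p ∣ᶻ f j) → Strong (dg + dh) dg l
strong-local {f} {G} {H} {dg} {dh} {p} {l} pp P 0<dg 0<dh l≤ p∤ p∣ p²∤
  with firsts {f} {G} {H} pp P l≤ p∤ p∣ | local-firsts {f} {G} {H} pp P l≤ p∤ p∣
... | I , J , eq | I′ , J′ , eq′ with degrees I J I′ J′ l≤ eq eq′
...   | dg≡ , dh≡ = subst (Strong (dg + dh) dg) eq (strong-arith dg≡ dh≡ 0<dg 0<dh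
  (edge₁ {f} {G} {H} P I J eq (λ 0<l → p²∤ 0 z≤n (<⇒≢ 0<l)))
  (edge₁ {reverse (dg + dh) f} {reverse dg G} {reverse dh H} (Product-reverse {f} {G} {H} P) I′ J′ eq′
    (λ 0<k-l → p²∤ (dg + dh) ≤-refl (λ e → <-irrefl (sym (trans (cong (dg + dh ∸_) (sym e)) (n∸n≡0 (dg + dh)))) 0<k-l))))

weak-local : ∀ {f G H dg dh p l} → Prime p → Product f G H dg dh → 0 < dg → 0 < dh → l ≤ dg + dh →
  ¬ ι p ∣ᶻ f l → (∀ j → j ≤ dg + dh → j ≢ l → ι p ℤ.* ι p ∣ᶻ f j) →
  (∀ j → j ≤ dg + dh → j ≢ l → ¬ ι p ℤ.* ι p ℤ.* ι p ∣ᶻ f j) → Weak (dg + dh) dg l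
weak-local {f} {G} {H} {dg} {dh} {p} {l} pp P 0<dg 0<dh l≤ p∤ p²∣ p³∤
  with firsts {f} {G} {H} pp P l≤ p∤ (λ j j≤ j≢ → weaken (p²∣ j j≤ j≢)) | local-firsts {f} {G} {H} pp P l≤ p∤ (λ j j≤ j≢ → weaken (p²∣ j j≤ j≢))
  where
  weaken : ∀ {x} → ι p ℤ.* ι p ∣ᶻ x → ι p ∣ᶻ x
  weaken = ℤ∣.∣-trans (ℤ∣.∣m⇒∣m*n (ι p) ℤ∣.∣-refl)
... | I , J , eq | I′ , J′ , eq′ with degrees I J I′ J′ l≤ eq eq′
...   | dg≡ , dh≡ = subst (Weak (dg + dh) dg) eq (weak-arith dg≡ dh≡ 0<dg 0<dh
  (edge₂ {f} {G} {H} pp P I J eq (λ j j<l → p²∣ j (≤-trans (<⇒≤ j<l) l≤) (<⇒≢ j<l)) (λ 0<l → p³∤ 0 z≤n (<⇒≢ 0<l)))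
  (edge₂ {reverse (dg + dh) f} {reverse dg G} {reverse dh H} pp (Product-reverse {f} {G} {H} P) I′ J′ eq′
    (λ j j<k-l → p²∣ (dg + dh ∸ j) (m∸n≤m (dg + dh) j) (λ e → <⇒≱ j<k-l (≤-reflexive
      (trans (cong (dg + dh ∸_) (sym e)) (m∸[m∸n]≡n (≤-trans (<⇒≤ j<k-l) (m∸n≤m (dg + dh) l)))))))
    (λ 0<k-l → p³∤ (dg + dh) ≤-refl (λ e → <-irrefl (sym (trans (cong (dg + dh ∸_) (sym e)) (n∸n≡0 (dg + dh)))) 0<k-l))))

quotients : ∀ p (G : ℕ → ℤ) d → (∀ a → a ≤ d → ι p ∣ᶻ G a) → ∃ λ G′ → ∀ a → a ≤ d → G a ≡ G′ a ℤ.* ι p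
quotients p G d all = G′ , G′-eq
  where
  G′ : ℕ → ℤ
  G′ a with a ≤? d
  ... | yes a≤ = ℤ∣.quotient (all a a≤)
  ... | no _ = 0ℤ
  G′-eq : ∀ a → a ≤ d → G a ≡ G′ a ℤ.* ι p
  G′-eq a a≤ with a ≤? d
  ... | yes a≤′ = ℤ∣._∣_.equality (all a a≤′)
  ... | no ≰ = ⊥-elim (≰ a≤)

-- The relation for N at the modulus q is the relation for N p at the modulus q p with p cancelled.
Product-divide : ∀ {f G H : ℕ → ℤ} {dg dh p} N → Prime p → (∀ a → a ≤ dg → ι p ∣ᶻ G a) →
  Product (λ j → ι (N * p) ℤ.* f j) G H dg dh → ∃ λ G′ → Product (λ j → ι N ℤ.* f j) G′ H dg dh
Product-divide {f} {G} {H} {dg} {dh} {p} N pp all P with quotients p G dg all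
... | G′ , G≡ = G′ , λ q a₀ b₀ a₀≤ b₀≤ others →
  let iso = P (q ℤ.* ι p) a₀ b₀ a₀≤ b₀≤ λ a b a≤ b≤ eq a≢ →
              subst (q ℤ.* ι p ∣ᶻ_) (sym (G-eq a b a≤)) (ℤ∣.*-monoˡ-∣ (ι p) (others a b a≤ b≤ eq a≢))
  in (λ h → ℤ∣.*-cancelʳ-∣ (ι p) {{ι-nonZero pp}} (subst (q ℤ.* ι p ∣ᶻ_) (G-eq a₀ b₀ a₀≤)
        (proj₁ iso (subst (q ℤ.* ι p ∣ᶻ_) (sym (f-eq (a₀ + b₀))) (ℤ∣.*-monoˡ-∣ (ι p) h))))) ,
     (λ h → ℤ∣.*-cancelʳ-∣ (ι p) {{ι-nonZero pp}} (subst (q ℤ.* ι p ∣ᶻ_) (f-eq (a₀ + b₀))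
        (proj₂ iso (subst (q ℤ.* ι p ∣ᶻ_) (sym (G-eq a₀ b₀ a₀≤)) (ℤ∣.*-monoˡ-∣ (ι p) h)))))
  where
  move : ∀ x y z → x ℤ.* y ℤ.* z ≡ x ℤ.* z ℤ.* y
  move x y z = trans (ℤ.*-assoc x y z) (trans (cong (x ℤ.*_) (ℤ.*-comm y z)) (sym (ℤ.*-assoc x z y)))
  G-eq : ∀ a b → a ≤ dg → G a ℤ.* H b ≡ G′ a ℤ.* H b ℤ.* ι p
  G-eq a b a≤ = trans (cong (ℤ._* H b) (G≡ a a≤)) (move (G′ a) (ι p) (H b))
  f-eq : ∀ j → ι (N * p) ℤ.* f j ≡ ι N ℤ.* f j ℤ.* ι p
  f-eq j = trans (cong (ℤ._* f j) (ℤ.pos-* N p)) (move (ι N) (ι p) (f j))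

-- Gauss's lemma
coprime-scaling : ∀ {f : ℕ → ℤ} {dg dh p} → Prime p → ∀ N → Acc _<_ N → 0 < N → ∀ {G H : ℕ → ℤ} → Product (λ j → ι N ℤ.* f j) G H dg dh →
  ∃ λ N′ → 0 < N′ × ¬ p ∣ N′ × Σ (ℕ → ℤ) λ G′ → Σ (ℕ → ℤ) λ H′ → Product (λ j → ι N′ ℤ.* f j) G′ H′ dg dh
coprime-scaling {f} {dg} {dh} {p} pp N (acc rec) 0<N {G} {H} P with p ∣? N
... | no p∤N = N , 0<N , p∤N , G , H , P
... | yes (divides M refl) with findFirst p G dg | findFirst p H dh
...   | inj₁ all | _ = coprime-scaling {f} pp M (rec M<) 0<M {proj₁ div} {H} (proj₂ div)
  where
  div = Product-divide {f} {G} {H} M pp all P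
  0<M = *-pos⁻ˡ 0<N
  M< = m<m*n M p {{>-nonZero 0<M}} (prime>1 pp)
...   | inj₂ _ | inj₁ all = coprime-scaling {f} pp M (rec M<) 0<M {G} {proj₁ div}
  (Product-swap {λ j → ι M ℤ.* f j} {proj₁ div} {G} (proj₂ div))
  where
  0<M = *-pos⁻ˡ 0<N
  M< = m<m*n M p {{>-nonZero 0<M}} (prime>1 pp)
  div = Product-divide {f} {H} {G} M pp all (Product-swap {λ j → ι (M * p) ℤ.* f j} {G} {H} P)
-- Neither factor vanishes modulo p, yet p divides every coefficient of the scaled product.
...   | inj₂ I | inj₂ J = ⊥-elim (first-product {λ j → ι (M * p) ℤ.* f j} {G} {H} pp P I J
  (ℤ∣.∣m⇒∣m*n {ι p} {ι (M * p)} (f (index I + index J)) (ℤ∣.∣ᵤ⇒∣ (n∣m*n M))))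

-- Valuations of the coefficients

ν-∏-one : ∀ {p} → Prime p → ∀ s x i₀ → i₀ < s → (∀ i → i < s → 0 < x i) → (∀ i → i < s → i ≢ i₀ → ¬ p ∣ x i) →
  ν p (∏ s x) ≡ ν p (x i₀)
ν-∏-one {p} pp (suc s) x i₀ i₀<s 0<x others with m≤n⇒m<n∨m≡n (≤-pred i₀<s)
... | inj₁ i₀<s′ = trans (ν-* pp (∏-pos s (λ i → 0<x i ∘ m<n⇒m<1+n)) (0<x s ≤-refl))
  (trans (cong₂ _+_ (ν-∏-one pp s x i₀ i₀<s′ (λ i → 0<x i ∘ m<n⇒m<1+n) (λ i → others i ∘ m<n⇒m<1+n))
    (ν-∤ (others s ≤-refl (<⇒≢ i₀<s′ ∘ sym)))) (+-identityʳ _))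
... | inj₂ refl = trans (ν-* pp (∏-pos s (λ i → 0<x i ∘ m<n⇒m<1+n)) (0<x s ≤-refl))
  (cong (_+ ν p (x s)) (ν-∤ λ d → bad (prime∣∏ pp s d)))
  where
  bad : ¬ ∃ λ i → i < s × p ∣ x i
  bad (i , i<s , d) = others i (m<n⇒m<1+n i<s) (<⇒≢ i<s) d

choose-! : ∀ {n k} → k ≤ n → (n choose k) * (k ! * (n ∸ k) !) ≡ n !
choose-! {n} {k} k≤n = trans (cong (_* (k ! * (n ∸ k) !)) (nCk≡n!/k![n-k]! k≤n))
  (m/n*n≡m {{k !* (n ∸ k) !≢0}} (k![n∸k]!∣n! k≤n))

cofactor : ℕ → ℕ → ℕ → ℕ
cofactor n k j = (n choose j) * ((n ∸ j ∸ 1) choose (k ∸ j))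

-- The factor (n-k-1)! completes n(n-1)⋯(n-k) to n!, so both binomials unfold into factorials.
cofactor-! : ∀ {n k j} → j ≤ k → k < n → j ! * (k ∸ j) ! * ((n ∸ j) * cofactor n k j) * (n ∸ suc k) ! ≡ n !
cofactor-! {n} {k} {j} j≤k k<n = begin
  j ! * (k ∸ j) ! * ((n ∸ j) * (A * B)) * (n ∸ suc k) !   ≡⟨ regroup (j !) ((k ∸ j) !) (n ∸ j) A B ((n ∸ suc k) !) ⟩
  A * (j ! * ((n ∸ j) * (B * ((k ∸ j) ! * (n ∸ suc k) !))))
    ≡⟨ cong (λ z → A * (j ! * ((n ∸ j) * (B * ((k ∸ j) ! * z !))))) rest ⟨
  A * (j ! * ((n ∸ j) * (B * ((k ∸ j) ! * (n ∸ j ∸ 1 ∸ (k ∸ j)) !))))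
    ≡⟨ cong (λ z → A * (j ! * ((n ∸ j) * z))) (choose-! {n ∸ j ∸ 1} {k ∸ j} k-j≤) ⟩
  A * (j ! * ((n ∸ j) * (n ∸ j ∸ 1) !))                  ≡⟨ cong (λ z → A * (j ! * z)) (factorial (m<n⇒0<n∸m (≤-<-trans j≤k k<n))) ⟩
  A * (j ! * (n ∸ j) !)                                  ≡⟨ choose-! (≤-trans j≤k (<⇒≤ k<n)) ⟩
  n !                                                    ∎
  where
  open ≡-Reasoning
  A = n choose j
  B = (n ∸ j ∸ 1) choose (k ∸ j)
  regroup : ∀ a b c A B d → a * b * (c * (A * B)) * d ≡ A * (a * (c * (B * (b * d))))
  regroup = solve-∀
  factorial : ∀ {m} → 0 < m → m * (m ∸ 1) ! ≡ m !
  factorial {suc m} _ = refl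
  n-j-1 : n ∸ j ∸ 1 ≡ n ∸ suc j
  n-j-1 = trans (∸-+-assoc n j 1) (cong (n ∸_) (+-comm j 1))
  k-j≤ : k ∸ j ≤ n ∸ j ∸ 1
  k-j≤ = subst (k ∸ j ≤_) (sym n-j-1) (∸-monoˡ-≤ (suc j) k<n)
  rest : n ∸ j ∸ 1 ∸ (k ∸ j) ≡ n ∸ suc k
  rest = trans (cong (_∸ (k ∸ j)) n-j-1) (trans (∸-+-assoc n (suc j) (k ∸ j)) (cong (n ∸_) (cong suc (m+[n∸m]≡n j≤k))))

cofactor-pos : ∀ {n k j} → j ≤ k → k < n → 0 < cofactor n k j
cofactor-pos {n} {k} {j} j≤k k<n = *-pos⁻ʳ {n ∸ j} (*-pos⁻ʳ {j ! * (k ∸ j) !} (*-pos⁻ˡ {_} {(n ∸ suc k) !}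
  (subst (0 <_) (sym (cofactor-! j≤k k<n)) (!-pos n))))

module CoefficientValuation {n k p l : ℕ} (pp : Prime p) (k<p : k < p) (k<n : k < n) (l≤k : l ≤ k) (p∣n-l : p ∣ n ∸ l) where

  p∤other : ∀ {j} → j ≤ k → j ≢ l → ¬ p ∣ n ∸ j
  p∤other {j} j≤k j≢l p∣n-j with <-cmp j l
  ... | tri≈ _ e _ = j≢l e
  ... | tri< j<l _ _ = close l≤k k<n j<l p∣n-l p∣n-j
    where
    close : ∀ {j l} → l ≤ k → k < n → j < l → p ∣ n ∸ l → p ∣ n ∸ j → ⊥
    close {j} {l} l≤k k<n j<l d d′ = >⇒∤ {{>-nonZero (m<n⇒0<n∸m j<l)}} (≤-<-trans (≤-trans (m∸n≤m l j) l≤k) k<p)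
      (∣m+n∣m⇒∣n (subst (p ∣_) (sym eq) d′) d)
      where
      eq : n ∸ l + (l ∸ j) ≡ n ∸ j
      eq = trans (sym (+-∸-assoc (n ∸ l) (<⇒≤ j<l))) (cong (_∸ j) (m∸n+n≡m (≤-trans l≤k (<⇒≤ k<n))))
  ... | tri> _ _ l<j = >⇒∤ {{>-nonZero (m<n⇒0<n∸m l<j)}} (≤-<-trans (≤-trans (m∸n≤m j l) j≤k) k<p)
      (∣m+n∣m⇒∣n (subst (p ∣_) (sym eq) p∣n-l) p∣n-j)
      where
      eq : n ∸ j + (j ∸ l) ≡ n ∸ l
      eq = trans (sym (+-∸-assoc (n ∸ j) (<⇒≤ l<j))) (cong (_∸ l) (m∸n+n≡m (≤-trans j≤k (<⇒≤ k<n))))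

  u = n ∸ suc k

  term : ∀ {i} → i ≤ k → suc (u + i) ≡ n ∸ (k ∸ i)
  term {i} i≤k = sym (trans (cong (_∸ (k ∸ i)) (sym total)) (m+n∸n≡m (suc (u + i)) (k ∸ i)))
    where
    total : suc (u + i) + (k ∸ i) ≡ n
    total = trans (cong suc (trans (+-assoc u i (k ∸ i)) (cong (u +_) (m+[n∸m]≡n i≤k))))
      (trans (sym (+-suc u k)) (m∸n+n≡m k<n))

  ν-rising : ν p (rising (suc k) u) ≡ ν p (n ∸ l)
  ν-rising = trans (ν-∏-one pp (suc k) _ (k ∸ l) (s≤s (m∸n≤m k l)) (λ _ _ → s≤s z≤n) others)
    (cong (ν p) (trans (term (m∸n≤m k l)) (cong (n ∸_) (m∸[m∸n]≡n l≤k))))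
    where
    others : ∀ i → i < suc k → i ≢ k ∸ l → ¬ p ∣ suc (u + i)
    others i i<k i≢ d = p∤other (m∸n≤m k i) (λ e → i≢ (trans (sym (m∸[m∸n]≡n (≤-pred i<k))) (cong (k ∸_) e)))
      (subst (p ∣_) (term (≤-pred i<k)) d)

  -- In `cofactor-!` the factor j!(k-j)! is prime to p because p > k, and u! cancels. Of the k + 1
  -- consecutive terms that remain, only n - l is divisible by p.
  ν-sum : ∀ {j} → j ≤ k → ν p (n ∸ j) + ν p (cofactor n k j) ≡ ν p (n ∸ l)
  ν-sum {j} j≤k = +-cancelʳ-≡ (ν p (u !)) _ _ (begin
    ν p (n ∸ j) + ν p B + ν p (u !)                         ≡⟨ cong (_+ ν p (u !)) (ν-* pp 0<n-j 0<B) ⟨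
    ν p ((n ∸ j) * B) + ν p (u !)                           ≡⟨ cong (λ z → z + ν p ((n ∸ j) * B) + ν p (u !)) small ⟨
    ν p (j ! * (k ∸ j) !) + ν p ((n ∸ j) * B) + ν p (u !)   ≡⟨ cong (_+ ν p (u !)) (ν-* pp (*-pos (!-pos j) (!-pos (k ∸ j))) (*-pos 0<n-j 0<B)) ⟨
    ν p (j ! * (k ∸ j) ! * ((n ∸ j) * B)) + ν p (u !)       ≡⟨ ν-* pp (*-pos (*-pos (!-pos j) (!-pos (k ∸ j))) (*-pos 0<n-j 0<B)) (!-pos u) ⟨
    ν p (j ! * (k ∸ j) ! * ((n ∸ j) * B) * u !)             ≡⟨ cong (ν p) (cofactor-! j≤k k<n) ⟩
    ν p (n !)                                               ≡⟨ cong (ν p) (trans (!-∏-tail u (suc k)) (cong _! (m∸n+n≡m k<n))) ⟨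
    ν p (u ! * rising (suc k) u)                            ≡⟨ ν-* pp (!-pos u) (rising-pos (suc k) u) ⟩
    ν p (u !) + ν p (rising (suc k) u)                      ≡⟨ +-comm (ν p (u !)) _ ⟩
    ν p (rising (suc k) u) + ν p (u !)                      ≡⟨ cong (_+ ν p (u !)) ν-rising ⟩
    ν p (n ∸ l) + ν p (u !)                                 ∎)
    where
    open ≡-Reasoning
    B = cofactor n k j
    0<n-j : 0 < n ∸ j
    0<n-j = m<n⇒0<n∸m (≤-<-trans j≤k k<n)
    0<B : 0 < B
    0<B = cofactor-pos j≤k k<n
    small : ν p (j ! * (k ∸ j) !) ≡ 0
    small = trans (ν-* pp (!-pos j) (!-pos (k ∸ j))) (cong₂ _+_ (ν-∤ (prime∤! pp (≤-<-trans j≤k k<p)))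
      (ν-∤ (prime∤! pp (≤-<-trans (m∸n≤m k j) k<p))))

  ν-vertex : ν p (cofactor n k l) ≡ 0
  ν-vertex = +-cancelˡ-≡ (ν p (n ∸ l)) _ _ (trans (ν-sum l≤k) (sym (+-identityʳ _)))

  ν-other : ∀ {j} → j ≤ k → j ≢ l → ν p (cofactor n k j) ≡ ν p (n ∸ l)
  ν-other {j} j≤k j≢l = trans (cong (_+ ν p (cofactor n k j)) (sym (ν-∤ (p∤other j≤k j≢l)))) (ν-sum j≤k)

-- From ℚ to ℤ

toℚᵘ-toℚ : ∀ z → ℚ.toℚᵘ (toℚ z) ℚᵘ.≃ ℚᵘ.mkℚᵘ z 0
toℚᵘ-toℚ z = ℚ.toℚᵘ-fromℚᵘ (ℚᵘ.mkℚᵘ z 0)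

toℚ-+ : ∀ x y → toℚ (x ℤ.+ y) ≡ toℚ x ℚ.+ toℚ y
toℚ-+ x y = ℚ.toℚᵘ-injective (ℚᵘ.≃-trans (toℚᵘ-toℚ (x ℤ.+ y)) (ℚᵘ.≃-trans sum
  (ℚᵘ.≃-sym (ℚᵘ.≃-trans (ℚ.toℚᵘ-homo-+ (toℚ x) (toℚ y)) (ℚᵘ.+-cong (toℚᵘ-toℚ x) (toℚᵘ-toℚ y))))))
  where
  sum : ℚᵘ.mkℚᵘ (x ℤ.+ y) 0 ℚᵘ.≃ ℚᵘ.mkℚᵘ x 0 ℚᵘ.+ ℚᵘ.mkℚᵘ y 0
  sum = ℚᵘ.*≡* (cong (ℤ._* ℤ.1ℤ) (sym (cong₂ ℤ._+_ (ℤ.*-identityʳ x) (ℤ.*-identityʳ y))))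

toℚ-* : ∀ x y → toℚ (x ℤ.* y) ≡ toℚ x ℚ.* toℚ y
toℚ-* x y = ℚ.toℚᵘ-injective (ℚᵘ.≃-trans (toℚᵘ-toℚ (x ℤ.* y))
  (ℚᵘ.≃-sym (ℚᵘ.≃-trans (ℚ.toℚᵘ-homo-* (toℚ x) (toℚ y)) (ℚᵘ.*-cong (toℚᵘ-toℚ x) (toℚᵘ-toℚ y)))))

toℚ-injective : ∀ {x y} → toℚ x ≡ toℚ y → x ≡ y
toℚ-injective {x} {y} e with ℚᵘ.≃-trans (ℚᵘ.≃-sym (toℚᵘ-toℚ x)) (ℚᵘ.≃-trans (ℚᵘ.≃-reflexive (cong ℚ.toℚᵘ e)) (toℚᵘ-toℚ y))
... | ℚᵘ.*≡* eq = trans (sym (ℤ.*-identityʳ x)) (trans eq (ℤ.*-identityʳ y))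

clear-denominator : ∀ a → toℚ (ℚ.↥ a) ≡ toℚ (ℚ.↧ a) ℚ.* a
clear-denominator a@(ℚ.mkℚ _ _ _) = ℚ.toℚᵘ-injective (ℚᵘ.≃-trans (toℚᵘ-toℚ (ℚ.↥ a)) (ℚᵘ.≃-trans cancel
  (ℚᵘ.≃-sym (ℚᵘ.≃-trans (ℚ.toℚᵘ-homo-* (toℚ (ℚ.↧ a)) a) (ℚᵘ.*-cong (toℚᵘ-toℚ (ℚ.↧ a)) (ℚᵘ.≃-refl {ℚ.toℚᵘ a}))))))
  where
  cancel : ℚᵘ.mkℚᵘ (ℚ.↥ a) 0 ℚᵘ.≃ ℚᵘ.mkℚᵘ (ℚ.↧ a) 0 ℚᵘ.* ℚ.toℚᵘ a
  cancel = ℚᵘ.*≡* (trans (cong (λ z → ℚ.↥ a ℤ.* ι z) (*-identityˡ (ℚ.↧ₙ a)))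
    (trans (ℤ.*-comm (ℚ.↥ a) (ℚ.↧ a)) (sym (ℤ.*-identityʳ (ℚ.↧ a ℤ.* ℚ.↥ a)))))

-- `clear` scales by the plain product of the denominators; powers of p in it are removed later by
-- `coprime-scaling`. `zero⇒` carries non-vanishing over to the integers.
record Cleared (g : Poly) : Set where
  field
    scale : ℕ
    scale>0 : 0 < scale
    coef : ℕ → ℤ
    coef-eq : ∀ i → toℚ (coef i) ≡ toℚ (ι scale) ℚ.* coeff g i
    zero⇒ : ∀ i → coef i ≡ 0ℤ → coeff g i ≡ 0ℚ
    beyond : ∀ i → length g ≤ i → coef i ≡ 0ℤ

ℚ-interchange : ∀ a b c d → (a ℚ.* b) ℚ.* (c ℚ.* d) ≡ (a ℚ.* c) ℚ.* (b ℚ.* d)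
ℚ-interchange = CommutativeSemigroup.interchange (CommutativeMonoid.commutativeSemigroup ℚ.*-1-commutativeMonoid)

clear : ∀ g → Cleared g
clear [] = record { scale = 1 ; scale>0 = s≤s z≤n ; coef = λ _ → 0ℤ ; coef-eq = λ _ → sym (ℚ.*-zeroʳ (toℚ (ι 1)))
                  ; zero⇒ = λ _ _ → refl ; beyond = λ _ _ → refl }
clear (a ∷ g) = record
  { scale = ℚ.↧ₙ a * scale
  ; scale>0 = *-pos {ℚ.↧ₙ a} (s≤s z≤n) scale>0
  ; coef = G
  ; coef-eq = eq
  ; zero⇒ = zeros
  ; beyond = λ { (suc i) (s≤s h) → trans (cong (ℚ.↧ a ℤ.*_) (beyond i h)) (ℤ.*-zeroʳ (ℚ.↧ a)) }
  }
  where
  open Cleared (clear g)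
  G : ℕ → ℤ
  G zero = ℚ.↥ a ℤ.* ι scale
  G (suc i) = ℚ.↧ a ℤ.* coef i
  scale-eq : toℚ (ι (ℚ.↧ₙ a * scale)) ≡ toℚ (ℚ.↧ a) ℚ.* toℚ (ι scale)
  scale-eq = trans (cong toℚ (ℤ.pos-* (ℚ.↧ₙ a) scale)) (toℚ-* (ℚ.↧ a) (ι scale))
  eq : ∀ i → toℚ (G i) ≡ toℚ (ι (ℚ.↧ₙ a * scale)) ℚ.* coeff (a ∷ g) i
  eq zero = begin
    toℚ (ℚ.↥ a ℤ.* ι scale)                            ≡⟨ toℚ-* (ℚ.↥ a) (ι scale) ⟩
    toℚ (ℚ.↥ a) ℚ.* toℚ (ι scale)                      ≡⟨ cong (ℚ._* toℚ (ι scale)) (clear-denominator a) ⟩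
    toℚ (ℚ.↧ a) ℚ.* a ℚ.* toℚ (ι scale)                ≡⟨ ℚ.*-assoc (toℚ (ℚ.↧ a)) a _ ⟩
    toℚ (ℚ.↧ a) ℚ.* (a ℚ.* toℚ (ι scale))              ≡⟨ cong (toℚ (ℚ.↧ a) ℚ.*_) (ℚ.*-comm a _) ⟩
    toℚ (ℚ.↧ a) ℚ.* (toℚ (ι scale) ℚ.* a)              ≡⟨ ℚ.*-assoc (toℚ (ℚ.↧ a)) _ a ⟨
    toℚ (ℚ.↧ a) ℚ.* toℚ (ι scale) ℚ.* a                ≡⟨ cong (ℚ._* a) scale-eq ⟨
    toℚ (ι (ℚ.↧ₙ a * scale)) ℚ.* a                     ∎
    where open ≡-Reasoning
  eq (suc i) = begin
    toℚ (ℚ.↧ a ℤ.* coef i)                             ≡⟨ toℚ-* (ℚ.↧ a) (coef i) ⟩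
    toℚ (ℚ.↧ a) ℚ.* toℚ (coef i)                       ≡⟨ cong (toℚ (ℚ.↧ a) ℚ.*_) (coef-eq i) ⟩
    toℚ (ℚ.↧ a) ℚ.* (toℚ (ι scale) ℚ.* coeff g i)      ≡⟨ ℚ.*-assoc (toℚ (ℚ.↧ a)) _ _ ⟨
    toℚ (ℚ.↧ a) ℚ.* toℚ (ι scale) ℚ.* coeff g i        ≡⟨ cong (ℚ._* coeff g i) scale-eq ⟨
    toℚ (ι (ℚ.↧ₙ a * scale)) ℚ.* coeff g i             ∎
    where open ≡-Reasoning
  zeros : ∀ i → G i ≡ 0ℤ → coeff (a ∷ g) i ≡ 0ℚ
  zeros zero e with ℤ.i*j≡0⇒i≡0∨j≡0 (ℚ.↥ a) e
  ... | inj₁ e′ = ℚ.↥p≡0⇒p≡0 a e′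
  ... | inj₂ e′ = ⊥-elim (<-irrefl (sym (ℤ.+-injective e′)) scale>0)
  zeros (suc i) e with ℤ.i*j≡0⇒i≡0∨j≡0 (ℚ.↧ a) e
  ... | inj₂ e′ = zero⇒ i e′

coeff-⊕ : ∀ p q i → coeff (p ⊕ q) i ≡ coeff p i ℚ.+ coeff q i
coeff-⊕ [] q i = sym (ℚ.+-identityˡ _)
coeff-⊕ (a ∷ p) [] i = sym (ℚ.+-identityʳ _)
coeff-⊕ (a ∷ p) (b ∷ q) zero = refl
coeff-⊕ (a ∷ p) (b ∷ q) (suc i) = coeff-⊕ p q i

coeff-map : ∀ a q i → coeff (map (a ℚ.*_) q) i ≡ a ℚ.* coeff q i
coeff-map a [] i = sym (ℚ.*-zeroʳ a)
coeff-map a (b ∷ q) zero = refl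
coeff-map a (b ∷ q) (suc i) = coeff-map a q i

shift : (ℕ → ℤ) → ℕ → ℤ
shift f zero = 0ℤ
shift f (suc i) = f i

-- Convolution with the recursion of `_⊗_`; the number argument says how many coefficients of the
-- left factor enter.
conv : ℕ → (ℕ → ℤ) → (ℕ → ℤ) → ℕ → ℤ
conv zero G H i = 0ℤ
conv (suc m) G H i = G 0 ℤ.* H i ℤ.+ shift (conv m (G ∘ suc) H) i

conv-⊗ : ∀ g h {D E : ℚ} (G H : ℕ → ℤ) → (∀ i → toℚ (G i) ≡ D ℚ.* coeff g i) → (∀ i → toℚ (H i) ≡ E ℚ.* coeff h i) →
  ∀ i → toℚ (conv (length g) G H i) ≡ D ℚ.* E ℚ.* coeff (g ⊗ h) i
conv-⊗ [] h {D} {E} G H _ _ i = sym (ℚ.*-zeroʳ (D ℚ.* E))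
conv-⊗ (a ∷ g) h {D} {E} G H G≡ H≡ i = begin
  toℚ (G 0 ℤ.* H i ℤ.+ shift tail i)               ≡⟨ toℚ-+ (G 0 ℤ.* H i) (shift tail i) ⟩
  toℚ (G 0 ℤ.* H i) ℚ.+ toℚ (shift tail i)         ≡⟨ cong₂ ℚ._+_ head-eq (tail-eq i) ⟩
  D ℚ.* E ℚ.* (a ℚ.* coeff h i) ℚ.+ D ℚ.* E ℚ.* coeff (0ℚ ∷ (g ⊗ h)) i
    ≡⟨ ℚ.*-distribˡ-+ (D ℚ.* E) _ _ ⟨
  D ℚ.* E ℚ.* (a ℚ.* coeff h i ℚ.+ coeff (0ℚ ∷ (g ⊗ h)) i)
    ≡⟨ cong (λ z → D ℚ.* E ℚ.* (z ℚ.+ coeff (0ℚ ∷ (g ⊗ h)) i)) (coeff-map a h i) ⟨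
  D ℚ.* E ℚ.* (coeff (map (a ℚ.*_) h) i ℚ.+ coeff (0ℚ ∷ (g ⊗ h)) i)
    ≡⟨ cong (D ℚ.* E ℚ.*_) (coeff-⊕ (map (a ℚ.*_) h) (0ℚ ∷ (g ⊗ h)) i) ⟨
  D ℚ.* E ℚ.* coeff ((a ∷ g) ⊗ h) i                ∎
  where
  open ≡-Reasoning
  tail = conv (length g) (G ∘ suc) H
  head-eq : toℚ (G 0 ℤ.* H i) ≡ D ℚ.* E ℚ.* (a ℚ.* coeff h i)
  head-eq = trans (toℚ-* (G 0) (H i)) (trans (cong₂ ℚ._*_ (G≡ 0) (H≡ i)) (ℚ-interchange D a E (coeff h i)))
  tail-eq : ∀ i → toℚ (shift tail i) ≡ D ℚ.* E ℚ.* coeff (0ℚ ∷ (g ⊗ h)) i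
  tail-eq zero = sym (ℚ.*-zeroʳ (D ℚ.* E))
  tail-eq (suc i) = conv-⊗ g h {D} {E} (G ∘ suc) H (G≡ ∘ suc) H≡ i

∣0 : ∀ q → q ∣ᶻ 0ℤ
∣0 q = ℤ∣.divides 0ℤ refl

conv-all : ∀ m G H q i → (∀ a b → a < m → a + b ≡ i → q ∣ᶻ G a ℤ.* H b) → q ∣ᶻ conv m G H i
conv-all zero G H q i h = ∣0 q
conv-all (suc m) G H q zero h = ℤ∣.∣m∣n⇒∣m+n (h 0 0 (s≤s z≤n) refl) (∣0 q)
conv-all (suc m) G H q (suc i) h = ℤ∣.∣m∣n⇒∣m+n (h 0 (suc i) (s≤s z≤n) refl)
  (conv-all m (G ∘ suc) H q i (λ a b a<m e → h (suc a) b (s≤s a<m) (cong suc e)))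

conv-isolate : ∀ m G H q a₀ b₀ → a₀ < m → (∀ a b → a < m → a + b ≡ a₀ + b₀ → a ≢ a₀ → q ∣ᶻ G a ℤ.* H b) →
  (q ∣ᶻ conv m G H (a₀ + b₀) → q ∣ᶻ G a₀ ℤ.* H b₀) × (q ∣ᶻ G a₀ ℤ.* H b₀ → q ∣ᶻ conv m G H (a₀ + b₀))
conv-isolate (suc m) G H q zero b₀ _ others = (λ d → ℤ∣.∣m+n∣n⇒∣m d (tail b₀ others)) , (λ d → ℤ∣.∣m∣n⇒∣m+n d (tail b₀ others))
  where
  tail : ∀ b₀ → (∀ a b → a < suc m → a + b ≡ b₀ → a ≢ 0 → q ∣ᶻ G a ℤ.* H b) → q ∣ᶻ shift (conv m (G ∘ suc) H) b₀
  tail zero _ = ∣0 q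
  tail (suc b₀) h = conv-all m (G ∘ suc) H q b₀ (λ a b a<m e → h (suc a) b (s≤s a<m) (cong suc e) λ ())
conv-isolate (suc m) G H q (suc a₀) b₀ (s≤s a₀<m) others =
  (λ d → proj₁ rest (ℤ∣.∣m+n∣m⇒∣n d head)) , (λ d → ℤ∣.∣m∣n⇒∣m+n head (proj₂ rest d))
  where
  head : q ∣ᶻ G 0 ℤ.* H (suc (a₀ + b₀))
  head = others 0 (suc (a₀ + b₀)) (s≤s z≤n) refl λ ()
  rest = conv-isolate m (G ∘ suc) H q a₀ b₀ a₀<m
    (λ a b a<m e a≢ → others (suc a) b (s≤s a<m) (cong suc e) (λ e′ → a≢ (suc-injective e′)))

-- Coefficient lists may end in zeros, so the degree is found by descending from the length. The
-- index `i` will be the witness of non-constancy and makes the degree positive.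
record Degree (G : ℕ → ℤ) (m i : ℕ) : Set where
  field
    deg : ℕ
    i≤deg : i ≤ deg
    deg<m : deg < m
    leading : G deg ≢ 0ℤ
    vanish : ∀ a → deg < a → G a ≡ 0ℤ

degree : ∀ m G → (∀ i → m ≤ i → G i ≡ 0ℤ) → ∀ i → G i ≢ 0ℤ → Degree G m i
degree zero G z i h = ⊥-elim (h (z i z≤n))
degree (suc m) G z i h with G m ℤ.≟ 0ℤ
... | no Gm≢0 = record { deg = m ; i≤deg = ≮⇒≥ (λ m<i → h (z i m<i)) ; deg<m = ≤-refl ; leading = Gm≢0 ; vanish = z }
... | yes Gm≡0 = record { Degree d ; deg<m = m<n⇒m<1+n (Degree.deg<m d) }
  where
  d = degree m G (λ i m≤i → [ (λ m<i → z i m<i) , (λ { refl → Gm≡0 }) ]′ (m≤n⇒m<n∨m≡n m≤i)) i h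

-- Terms of the convolution beyond the degrees are 0 and hence divisible by every modulus.
conv-Product : ∀ {f m G H dg dh} → (∀ i → f i ≡ conv m G H i) → dg < m →
  (∀ a → dg < a → G a ≡ 0ℤ) → (∀ b → dh < b → H b ≡ 0ℤ) → Product f G H dg dh
conv-Product {f} {m} {G} {H} {dg} {dh} f≡ dg<m Gz Hz q a₀ b₀ a₀≤ b₀≤ others =
  subst (λ z → (q ∣ᶻ z → q ∣ᶻ G a₀ ℤ.* H b₀) × (q ∣ᶻ G a₀ ℤ.* H b₀ → q ∣ᶻ z)) (sym (f≡ (a₀ + b₀)))
    (conv-isolate m G H q a₀ b₀ (≤-<-trans a₀≤ dg<m) all)
  where
  all : ∀ a b → a < m → a + b ≡ a₀ + b₀ → a ≢ a₀ → q ∣ᶻ G a ℤ.* H b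
  all a b _ e a≢ with a ≤? dg | b ≤? dh
  ... | yes a≤ | yes b≤ = others a b a≤ b≤ e a≢
  ... | no a≰ | _ = subst (q ∣ᶻ_) (sym (cong (ℤ._* H b) (Gz a (≰⇒> a≰)))) (∣0 q)
  ... | yes _ | no b≰ = subst (q ∣ᶻ_) (sym (trans (cong (G a ℤ.*_) (Hz b (≰⇒> b≰))) (ℤ.*-zeroʳ (G a)))) (∣0 q)

-- The Newton polygon of F at a prime above k

ι-^2 : ∀ p → ι p ℤ.* ι p ≡ ι (p ^ 2)
ι-^2 p = trans (sym (ℤ.pos-* p p)) (cong ι (cong (p *_) (sym (*-identityʳ p))))

ι-^3 : ∀ p → ι p ℤ.* ι p ℤ.* ι p ≡ ι (p ^ 3)
ι-^3 p = trans (cong (ℤ._* ι p) (ι-^2 p)) (trans (sym (ℤ.pos-* (p ^ 2) p)) (cong ι (*-comm (p ^ 2) p)))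

ν-∣ᶻ : ∀ {p x e} → e ≤ ν p ℤ.∣ x ∣ → ι (p ^ e) ∣ᶻ x
ν-∣ᶻ {p} {x} e≤ν = ℤ∣.∣ᵤ⇒∣ (∣-trans (^-∣-mono p e≤ν) (p^ν∣n p ℤ.∣ x ∣))

ν-∤ᶻ : ∀ {p x e} → Prime p → 0 < ℤ.∣ x ∣ → ν p ℤ.∣ x ∣ < e → ¬ ι (p ^ e) ∣ᶻ x
ν-∤ᶻ pp 0<x ν<e d = <⇒≱ ν<e (ν-max pp 0<x (ℤ∣.∣⇒∣ᵤ d))

-- `N` may contain p, so for each prime the factors are first rescaled. Then the coefficients have
-- the p-adic valuations of the `cofactor`s, and n < (k+1)³ ≤ p³ caps these at 2.
compatible : ∀ {k n dg dh N} {f G H : ℕ → ℤ} → dg + dh ≡ k → k < n → n < cube (suc k) → 0 < dg → 0 < dh → 0 < N →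
  (∀ j → j ≤ k → 0 < ℤ.∣ f j ∣) →
  (∀ {p} → Prime p → k < p → ∀ j → j ≤ k → ν p ℤ.∣ f j ∣ ≡ ν p (cofactor n k j)) →
  Product (λ j → ι N ℤ.* f j) G H dg dh → Compatible k n dg
compatible {k} {n} {dg} {dh} {N} {f} {G} {H} refl k<n n< 0<dg 0<dh 0<N f>0 ν-f P = record { weak = weak ; strong = strong }
  where
  module At {l p} (l≤k : l ≤ k) (pp : Prime p) (k<p : k < p) (p∣ : p ∣ n ∸ l) where
    open CoefficientValuation pp k<p k<n l≤k p∣
    scaled = coprime-scaling {f} {dg} {dh} pp N (<-wellFounded N) 0<N {G} {H} P
    N′ = proj₁ scaled
    0<N′ = proj₁ (proj₂ scaled)
    p∤N′ = proj₁ (proj₂ (proj₂ scaled))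
    G′ = proj₁ (proj₂ (proj₂ (proj₂ scaled)))
    H′ = proj₁ (proj₂ (proj₂ (proj₂ (proj₂ scaled))))
    P′ = proj₂ (proj₂ (proj₂ (proj₂ (proj₂ scaled))))
    f′ : ℕ → ℤ
    f′ j = ι N′ ℤ.* f j
    f′>0 : ∀ {j} → j ≤ k → 0 < ℤ.∣ f′ j ∣
    f′>0 {j} j≤k = subst (0 <_) (sym (ℤ.abs-* (ι N′) (f j))) (*-pos 0<N′ (f>0 j j≤k))
    ν-f′ : ∀ {j} → j ≤ k → ν p ℤ.∣ f′ j ∣ ≡ ν p (cofactor n k j)
    ν-f′ {j} j≤k = trans (cong (ν p) (ℤ.abs-* (ι N′) (f j))) (trans (ν-* pp 0<N′ (f>0 j j≤k))
      (trans (cong (_+ ν p ℤ.∣ f j ∣) (ν-∤ p∤N′)) (ν-f pp k<p j j≤k)))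
    0<n-l : 0 < n ∸ l
    0<n-l = m<n⇒0<n∸m (≤-<-trans l≤k k<n)
    at-vertex : ¬ ι p ∣ᶻ f′ l
    at-vertex d = ν-∤ᶻ {p} {f′ l} {1} pp (f′>0 l≤k) (≤-reflexive (cong suc (trans (ν-f′ l≤k) ν-vertex)))
      (subst (_∣ᶻ f′ l) (cong ι (sym (*-identityʳ p))) d)
    elsewhere : ∀ {e} j → j ≤ k → j ≢ l → e ≤ ν p (n ∸ l) → ι (p ^ e) ∣ᶻ f′ j
    elsewhere {e} j j≤k j≢l h = ν-∣ᶻ {p} {f′ j} {e} (subst (e ≤_) (sym (trans (ν-f′ j≤k) (ν-other j≤k j≢l))) h)
    elsewhere-∤ : ∀ {e} j → j ≤ k → j ≢ l → ν p (n ∸ l) < e → ¬ ι (p ^ e) ∣ᶻ f′ j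
    elsewhere-∤ {e} j j≤k j≢l h = ν-∤ᶻ {p} {f′ j} {e} pp (f′>0 j≤k) (subst (_< e) (sym (trans (ν-f′ j≤k) (ν-other j≤k j≢l))) h)
    bounded : ν p (n ∸ l) < 3
    bounded = ≰⇒> λ 3≤ν → <⇒≱ n< (≤-trans (*-mono-≤ k<p (*-mono-≤ k<p k<p)) (≤-trans
      (≤-reflexive (cong (λ z → p * (p * z)) (sym (*-identityʳ p))))
      (≤-trans (∣⇒≤′ 0<n-l (∣-trans (^-∣-mono p 3≤ν) (p^ν∣n p (n ∸ l)))) (m∸n≤m n l))))
    simple : ¬ p * p ∣ n ∸ l → Strong k dg l
    simple p²∤ = strong-local {f′} {G′} {H′} pp P′ 0<dg 0<dh l≤k at-vertex
      (λ j j≤ j≢ → subst (_∣ᶻ f′ j) (cong ι (*-identityʳ p)) (elsewhere j j≤ j≢ (ν-∣ pp 0<n-l p∣)))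
      (λ j j≤ j≢ d → elsewhere-∤ j j≤ j≢ ν<2 (subst (_∣ᶻ f′ j) (ι-^2 p) d))
      where
      ν<2 : ν p (n ∸ l) < 2
      ν<2 = ≰⇒> λ 2≤ν → p²∤ (subst (_∣ n ∸ l) (cong (p *_) (*-identityʳ p)) (∣-trans (^-∣-mono p 2≤ν) (p^ν∣n p (n ∸ l))))
    double : p * p ∣ n ∸ l → Weak k dg l
    double p²∣ = weak-local {f′} {G′} {H′} pp P′ 0<dg 0<dh l≤k at-vertex
      (λ j j≤ j≢ → subst (_∣ᶻ f′ j) (sym (ι-^2 p)) (elsewhere j j≤ j≢
        (ν-max {e = 2} pp 0<n-l (subst (_∣ n ∸ l) (cong (p *_) (sym (*-identityʳ p))) p²∣))))
      (λ j j≤ j≢ d → elsewhere-∤ j j≤ j≢ bounded (subst (_∣ᶻ f′ j) (ι-^3 p) d))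
  strong : ∀ {l p} → l ≤ k → Prime p → k < p → p ∣ n ∸ l → ¬ p * p ∣ n ∸ l → Strong k dg l
  strong l≤k pp k<p p∣ = At.simple l≤k pp k<p p∣
  weak : ∀ {l p} → l ≤ k → Prime p → k < p → p ∣ n ∸ l → Weak k dg l
  weak {l} {p} l≤k pp k<p p∣ with p * p ∣? n ∸ l
  ... | yes p²∣ = At.double l≤k pp k<p p∣ p²∣
  ... | no p²∤ = inj₁ (At.simple l≤k pp k<p p∣ p²∤)

coeff-tabulate : ∀ m (φ : Fin m → ℚ) i (i<m : i < m) → coeff (tabulate φ) i ≡ φ (fromℕ< i<m)
coeff-tabulate (suc m) φ zero (s≤s _) = refl
coeff-tabulate (suc m) φ (suc i) (s≤s i<m) = coeff-tabulate m (φ ∘ Fin.suc) i i<m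

coeff-tabulate-beyond : ∀ m (φ : Fin m → ℚ) i → m ≤ i → coeff (tabulate φ) i ≡ 0ℚ
coeff-tabulate-beyond zero φ i _ = refl
coeff-tabulate-beyond (suc m) φ (suc i) (s≤s h) = coeff-tabulate-beyond m (φ ∘ Fin.suc) i h

abs-sign : ∀ m → ℤ.∣ ℤ.-[1+ 0 ] ℤ.^ m ∣ ≡ 1
abs-sign zero = refl
abs-sign (suc m) = trans (ℤ.abs-* ℤ.-[1+ 0 ] (ℤ.-[1+ 0 ] ℤ.^ m)) (trans (+-identityʳ _) (abs-sign m))

abs-c : ∀ n k j → ℤ.∣ c n k j ∣ ≡ cofactor n k j
abs-c n k j = trans (ℤ.abs-* (ℤ.-[1+ 0 ] ℤ.^ (k ∸ j)) (ι (cofactor n k j)))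
  (trans (cong (_* cofactor n k j) (abs-sign (k ∸ j))) (*-identityˡ _))

abs>0 : ∀ {x} → x ≢ 0ℤ → 0 < ℤ.∣ x ∣
abs>0 x≢0 = n≢0⇒n>0 (x≢0 ∘ ℤ.∣i∣≡0⇒i≡0)

-- Irreducibility of F

module Irreducibility (k n : ℕ) (4≤k : 4 ≤ k) (2k≤n : 2 * k ≤ n) (n< : n < cube (suc k)) (¬exc : ¬ Exceptional k n)
  (a : Fin (suc k) → ℤ) (a≢0 : ∀ j → a j ≢ 0ℤ) (smooth : ∀ j → Smooth k (a j)) where

  0<k : 0 < k
  0<k = ≤-trans (s≤s z≤n) 4≤k

  k<n : k < n
  k<n = <-≤-trans (m<m+n k (≤-trans 0<k (≤-reflexive (sym (+-identityʳ k))))) 2k≤n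

  -- The extension by 0 allows the coefficient at dg + dh to be read before dg + dh ≤ k is known.
  f : ℕ → ℤ
  f i with i <? suc k
  ... | yes i<k = a (fromℕ< i<k) ℤ.* c n k i
  ... | no _ = 0ℤ

  term : Fin (suc k) → ℚ
  term j = toℚ (a j ℤ.* c n k (toℕ j))

  coeff-F : ∀ i → coeff (F n k a) i ≡ toℚ (f i)
  coeff-F i with i <? suc k
  ... | yes i<k = trans (coeff-tabulate (suc k) term i i<k) (cong (λ z → toℚ (a (fromℕ< i<k) ℤ.* c n k z)) (toℕ-fromℕ< i<k))
  ... | no i≮k = coeff-tabulate-beyond (suc k) term i (≮⇒≥ i≮k)

  f-beyond : ∀ i → k < i → f i ≡ 0ℤ
  f-beyond i k<i with i <? suc k
  ... | yes i<k = ⊥-elim (<⇒≱ k<i (≤-pred i<k))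
  ... | no _ = refl

  f-abs : ∀ i → i ≤ k → Σ ℤ λ x → x ≢ 0ℤ × Smooth k x × ℤ.∣ f i ∣ ≡ ℤ.∣ x ∣ * cofactor n k i
  f-abs i i≤k with i <? suc k
  ... | yes i<k = a (fromℕ< i<k) , a≢0 _ , smooth _ ,
    trans (ℤ.abs-* (a (fromℕ< i<k)) (c n k i)) (cong (ℤ.∣ a (fromℕ< i<k) ∣ *_) (abs-c n k i))
  ... | no i≮k = ⊥-elim (i≮k (s≤s i≤k))

  f>0 : ∀ i → i ≤ k → 0 < ℤ.∣ f i ∣
  f>0 i i≤k with f-abs i i≤k
  ... | x , x≢0 , _ , eq = subst (0 <_) (sym eq) (*-pos (abs>0 x≢0) (cofactor-pos i≤k k<n))

  ν-f : ∀ {p} → Prime p → k < p → ∀ i → i ≤ k → ν p ℤ.∣ f i ∣ ≡ ν p (cofactor n k i)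
  ν-f {p} pp k<p i i≤k with f-abs i i≤k
  ... | x , x≢0 , sm , eq = trans (cong (ν p) eq) (trans (ν-* pp (abs>0 x≢0) (cofactor-pos i≤k k<n))
    (cong (_+ ν p (cofactor n k i)) (ν-∤ λ d → <⇒≱ k<p (sm p pp d))))

  f-k≢0 : f k ≢ 0ℤ
  f-k≢0 e = <-irrefl (sym (cong ℤ.∣_∣ e)) (f>0 k ≤-refl)

  nonConstant : NonConstant (F n k a)
  nonConstant = k , 0<k , λ e → f-k≢0 (toℚ-injective (trans (sym (coeff-F k)) e))

  irreducible : ¬ ReducibleQ (F n k a)
  irreducible (g , h , (ig , 1≤ig , g≢0) , (ih , 1≤ih , h≢0) , factors) =
    incompatible k n 4≤k 2k≤n n< ¬exc dg 0<dg (subst (dg <_) total (m<m+n dg 0<dh))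
      (compatible {N = N} {f} {G} {H} total k<n n< 0<dg 0<dh 0<N f>0 ν-f scaled)
    where
    module g = Cleared (clear g)
    module h = Cleared (clear h)
    G = g.coef
    H = h.coef
    N = g.scale * h.scale
    0<N : 0 < N
    0<N = *-pos g.scale>0 h.scale>0
    module dg = Degree (degree (length g) G g.beyond ig (g≢0 ∘ g.zero⇒ ig))
    module dh = Degree (degree (length h) H h.beyond ih (h≢0 ∘ h.zero⇒ ih))
    dg = dg.deg
    dh = dh.deg
    0<dg : 0 < dg
    0<dg = ≤-trans 1≤ig dg.i≤deg
    0<dh : 0 < dh
    0<dh = ≤-trans 1≤ih dh.i≤deg
    integral : ∀ i → ι N ℤ.* f i ≡ conv (length g) G H i
    integral i = toℚ-injective (begin
      toℚ (ι N ℤ.* f i)                                          ≡⟨ toℚ-* (ι N) (f i) ⟩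
      toℚ (ι N) ℚ.* toℚ (f i)                                    ≡⟨ cong₂ ℚ._*_ (trans (cong toℚ (ℤ.pos-* g.scale h.scale)) (toℚ-* (ι g.scale) (ι h.scale)))
                                                                      (trans (sym (coeff-F i)) (factors i)) ⟩
      toℚ (ι g.scale) ℚ.* toℚ (ι h.scale) ℚ.* coeff (g ⊗ h) i    ≡⟨ conv-⊗ g h {toℚ (ι g.scale)} {toℚ (ι h.scale)} G H g.coef-eq h.coef-eq i ⟨
      toℚ (conv (length g) G H i)                                ∎)
      where open ≡-Reasoning
    scaled : Product (λ j → ι N ℤ.* f j) G H dg dh
    scaled = conv-Product {λ j → ι N ℤ.* f j} {length g} integral dg.deg<m dg.vanish dh.vanish
    product-zero : ∀ x y → x ≢ 0ℤ → y ≢ 0ℤ → x ℤ.* y ≢ 0ℤ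
    product-zero x y x≢0 y≢0 e = [ x≢0 , y≢0 ]′ (ℤ.i*j≡0⇒i≡0∨j≡0 x e)
    ιN≢0 : ι N ≢ 0ℤ
    ιN≢0 e = <-irrefl (sym (ℤ.+-injective e)) 0<N
    -- Here Product is used with q = 0, where divisibility means vanishing.
    top : dg + dh ≤ k
    top = ≮⇒≥ λ k< → product-zero (G dg) (H dh) dg.leading dh.leading
      (ℤ∣.0∣⇒≡0 (proj₁ (scaled 0ℤ dg dh ≤-refl ≤-refl vanishing)
        (ℤ∣.∣-reflexive (sym (trans (cong (ι N ℤ.*_) (f-beyond (dg + dh) k<)) (ℤ.*-zeroʳ (ι N)))))))
      where
      vanishing : ∀ a b → a ≤ dg → b ≤ dh → a + b ≡ dg + dh → a ≢ dg → 0ℤ ∣ᶻ G a ℤ.* H b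
      vanishing a b a≤ b≤ e a≢ = ⊥-elim (<-irrefl e (+-mono-<-≤ (≤∧≢⇒< a≤ a≢) b≤))
    -- If the degrees added up to less than k, each term of the convolution at k would have a
    -- vanishing factor, whereas `f k` is non-zero.
    bottom : k ≤ dg + dh
    bottom = ≮⇒≥ λ <k → product-zero (ι N) (f k) ιN≢0 f-k≢0 (trans (integral k)
      (ℤ∣.0∣⇒≡0 (conv-all (length g) G H 0ℤ k λ a b _ e → vanishing a b e <k)))
      where
      vanishing : ∀ a b → a + b ≡ k → dg + dh < k → 0ℤ ∣ᶻ G a ℤ.* H b
      vanishing a b e <k with a ≤? dg | b ≤? dh
      ... | yes a≤ | yes b≤ = ⊥-elim (<⇒≱ <k (≤-trans (≤-reflexive (sym e)) (+-mono-≤ a≤ b≤)))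
      ... | no a≰ | _ = ℤ∣.∣-reflexive (sym (cong (ℤ._* H b) (dg.vanish a (≰⇒> a≰))))
      ... | yes _ | no b≰ = ℤ∣.∣-reflexive (sym (trans (cong (G a ℤ.*_) (dh.vanish b (≰⇒> b≰))) (ℤ.*-zeroʳ (G a))))
    total : dg + dh ≡ k
    total = ≤-antisym top bottom

theorem1p2 : (k n : ℕ) → 0 < k → 0 < n → 8 ≤ 2 * k → 2 * k ≤ n → n < (suc k) ^ 3 →
    (a : Fin (suc k) → ℤ) → (∀ j → a j ≢ 0ℤ) → (∀ j → Smooth k (a j)) →
    ¬ (n ≡ 8 × k ≡ 4) → ¬ (n ≡ 10 × k ≡ 5) → ¬ (n ≡ 12 × k ≡ 6) → ¬ (n ≡ 16 × k ≡ 8) →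
    IrreducibleQ (F n k a)
theorem1p2 k n _ _ 8≤2k 2k≤n n< a a≢0 smooth ¬8 ¬10 ¬12 ¬16 = nonConstant , irreducible
  where
  open Irreducibility k n (*-cancelˡ-≤ 2 8≤2k) 2k≤n
    (subst (λ z → n < suc k * (suc k * z)) (*-identityʳ (suc k)) n<)
    [ ¬8 , [ ¬10 , [ ¬12 , ¬16 ]′ ]′ ]′ a a≢0 smooth
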